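{- Let $\Gamma=(X,\mathcal E)$ be the Heawood graph (the distance-regular graph with $14$ vertices and intersection array $\{3,2,2;1,1,3\}$); the spectrum of its adjacency matrix $A$ is $3^1(\sqrt2)^6(-\sqrt2)^6(-3)^1$. Let $x\in X$ and $T=T(x)$. Order the three vertices of $\Gamma_1(x)$ arbitrarily, and order $\Gamma_2(x)$ as $y_1,\dots,y_6$ so that each of the pairs $\{y_1,y_2\},\{y_3,y_4\},\{y_5,y_6\}$ has a common neighbor in $\Gamma_1(x)$. Then the standard module $V=\mathbb C^X$ is an orthogonal direct sum of irreducible $T$-modules $V=W_0\oplus W_{1,a}\oplus W_{1,b}\oplus W_{2,a}\oplus W_{2,b}\oplus W_{2,c}$, where two summands are isomorphic if and only if they have the same type in the following list, and the data are as listed. Each listed basis is a pure basis of the module. For each summand other than $W_0$, the seed vector $\nu$ spans $E_r^*W$ (so $\dim E_r^*W=1$), where $r$ is the endpoint of the summand $W$, and is given by its essential part. Type I ($W_0$): endpoint 0, multiplicity 1, dimension 4, diameter 3, shape $(1,1,1,1)$; basis $e_0^*,e_1^*,e_2^*,e_3^*$; matrix representing $A$: $\begin{pmatrix}0&3&0&0\\1&0&2&0\\0&1&0&2\\0&0&3&0\end{pmatrix}$, with eigenvalues $3,\sqrt2,-\sqrt2,-3$. Type II ($W_{1,a},W_{1,b}$): endpoint 1, multiplicity 2, dimension 2, diameter 1, shape $(1,1)$; basis $\nu,A\nu$ (with $A\nu=E_2^*A\nu$), where $\nu=[1,-1,0]$ for $W_{1,a}$ and $\nu=[1,1,-2]$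 for $W_{1,b}$; matrix representing $A$: $\begin{pmatrix}0&2\\1&0\end{pmatrix}$, with eigenvalues $\sqrt2,-\sqrt2$. Type III ($W_{2,a},W_{2,b},W_{2,c}$): endpoint 2, multiplicity 3, dimension 2, diameter 1, shape $(1,1)$; basis $\nu,A\nu$ (with $A\nu=E_3^*A\nu$), where $\nu=[1,-1,0,0,0,0]$ for $W_{2,a}$, $\nu=[0,0,1,-1,0,0]$ for $W_{2,b}$, $\nu=[0,0,0,0,1,-1]$ for $W_{2,c}$; matrix representing $A$: $\begin{pmatrix}0&2\\1&0\end{pmatrix}$. Moreover $\dim T=4^2+2^2+2^2=24$.
   Context: Let $\Gamma=(X,\mathcal E)$ be a finite undirected connected graph without loops or multiple edges, with path-length distance $d$ and diameter $D\ge1$; put $\Gamma_i(x)=\{y\in X:d(x,y)=i\}$. $\Gamma$ is distance-regular if for all $0\le h,i,j\le D$ the number $p^h_{i,j}=|\Gamma_i(y)\cap\Gamma_j(z)|$ is the same for all $y,z\in X$ with $d(y,z)=h$. Its intersection array is $\{b_0,\dots,b_{D-1};c_1,\dots,c_D\}$ with $b_i=p^i_{1,i+1}$, $c_i=p^i_{1,i-1}$. $A\in\mathrm{Mat}_X(\mathbb C)$ is the adjacency matrix; in its spectrum, exponents denote multiplicities. The standard module $V=\mathbb C^X$ (column vectors) carries the Hermitian inner product $\langle u,v\rangle=u^t\bar v$. Fix a base vertex $x\in X$. For $0\le i\le D$, $E_i^*=E_i^*(x)$ is the diagonal matrix with $(y,y)$-entry $1$ if $d(x,y)=i$ and $0$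 otherwise, and $e_i^*\in V$ is the vector with $y$-entry $1$ if $d(x,y)=i$ and $0$ otherwise. The Terwilliger algebra $T=T(x)$ is the subalgebra of $\mathrm{Mat}_X(\mathbb C)$ generated by $A$ and $E_0^*,\dots,E_D^*$. A $T$-module is a subspace $W\subseteq V$ with $BW\subseteq W$ for all $B\in T$; it is irreducible if $W\ne0$ and it properly contains no nonzero $T$-module. Isomorphisms of $T$-modules are vector space isomorphisms commuting with every $B\in T$. The endpoint of $W$ is $r=\min\{i:E_i^*W\ne0\}$; the diameter of an irreducible $W$ is $\delta=|\{i:E_i^*W\ne0\}|-1$, and its shape is $(\dim E_r^*W,\dots,\dim E_{r+\delta}^*W)$. The multiplicity of an irreducible module is the number of summands isomorphic to it in an orthogonal decomposition of $V$ into irreducible $T$-modules. A nonzero vector is pure with support $i$ if it lies in $E_i^*V$; its essential part is the row vector of its coordinates at the vertices of $\Gamma_i(x)$, in the chosen order (all its other coordinates are $0$). A pure basis of an irreducible $T$-module is an ordered basis of pure vectors with weakly increasing supports. The matrix $B$ representing $A$ with respect to a basis $v_1,\dots,v_\ell$ is given by $Av_j=\sum_iB_{ij}v_i$. -}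

module Defs where

open import Algebra.Bundles using (CommutativeRing)
open import Algebra.Module.Bundles.Raw using (RawLeftModule)
import Algebra.Definitions.RawMonoid as RawMonoidDefinitions
open import Algebra.Definitions using (Identity; Inverse; _DistributesOver_)
open import Algebra.Structures
  using (IsMagma; IsSemigroup; IsMonoid; IsGroup; IsAbelianGroup; IsRing; IsCommutativeRing)
open import Data.Bool.Base using (if_then_else_)
open import Data.Fin.Base using (Fin; toℕ)
import Data.Fin.Base as Fin
open import Data.Fin.Properties using () renaming (_≟_ to _≟ᶠ_)
open import Data.Fin.Subset as Subset using (Subset; _∈_)
open import Data.Integer.Base as ℤ using (ℤ)
open import Data.List.Base using (List; length; filter; allFin; map; upTo)
open import Data.List.Relation.Unary.All using (All)
open import Data.List.Relation.Unary.AllPairs using (AllPairs)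
open import Data.List.Relation.Unary.Any using (Any)
open import Data.Nat.Base as ℕ using (ℕ; suc; pred; _⊔_)
import Data.Nat.Properties as ℕ
open import Data.Product.Base using (∃; ∃-syntax; Σ-syntax; _×_; _,_; proj₁; proj₂)
open import Data.Rational.Base as ℚ using (ℚ; 0ℚ; 1ℚ; ½)
import Data.Rational.Properties as ℚ
open import Data.Vec.Base using (Vec; lookup)
open import Data.Vec.Functional using (Vector)
open import Function.Bundles using (_⇔_)
open import Function.Definitions using (Injective)
open import Level using (0ℓ)
open import Relation.Binary.Core using (Rel)
open import Relation.Binary.Definitions using (Decidable; Symmetric; Irreflexive)
open import Relation.Binary.Structures using (IsEquivalence)
open import Relation.Binary.PropositionalEquality as ≡
  using (_≡_; _≢_; refl; sym; cong; subst)
open import Relation.Nullary.Decidable using (does; _×-dec_)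
open import Relation.Nullary.Negation using (¬_)
open import Relation.Unary using (Pred; _⊆_; _⊂_; U)

------------------------------------------------------------------------
-- Real numbers: Cauchy sequences of rationals, two of them being equal
-- when their difference tends to 0.  ℝ and ℂ have no η-equality and their
-- operations are defined by copatterns, to keep the operations from unfolding
-- during unification.

module Rational where
  open import Data.Rational.Base
  open import Data.Rational.Solver
  open +-*-Solver

  private
    0<½ : 0ℚ < ½
    0<½ = ℚ.positive⁻¹ ½

  half : ℚ → ℚ
  half ε = ½ * ε

  0<* : ∀ {p q} → 0ℚ < p → 0ℚ < q → 0ℚ < p * q
  0<* {p} {q} 0<p 0<q =
    subst (_< p * q) (ℚ.*-zeroʳ p) (ℚ.*-monoʳ-<-pos p {{positive 0<p}} 0<q)

  0<half : ∀ {ε} → 0ℚ < ε → 0ℚ < half ε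
  0<half = 0<* 0<½

  half+half : ∀ ε → half ε + half ε ≡ ε
  half+half ε = ≡.trans (sym (ℚ.*-distribʳ-+ ε ½ ½)) (ℚ.*-identityˡ ε)

  ∣-∣-sym : ∀ p q → ∣ p - q ∣ ≡ ∣ q - p ∣
  ∣-∣-sym p q = ≡.trans (sym (ℚ.∣-p∣≡∣p∣ (p - q))) (cong ∣_∣ (lemma p q))
    where
    lemma : ∀ p q → - (p - q) ≡ q - p
    lemma = solve 2 (λ p q → :- (p :- q) := q :- p) refl

  ∣+∣<ε : ∀ p q {ε} → ∣ p ∣ < half ε → ∣ q ∣ < half ε → ∣ p + q ∣ < ε
  ∣+∣<ε p q {ε} p< q< = ℚ.≤-<-trans (ℚ.∣p+q∣≤∣p∣+∣q∣ p q)
    (subst (∣ p ∣ + ∣ q ∣ <_) (half+half ε) (ℚ.+-mono-< p< q<))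

  triangle : ∀ p q r {ε} → ∣ p - q ∣ < half ε → ∣ q - r ∣ < half ε → ∣ p - r ∣ < ε
  triangle p q r {ε} p< q< =
    subst (λ s → ∣ s ∣ < ε) (lemma p q r) (∣+∣<ε (p - q) (q - r) p< q<)
    where
    lemma : ∀ p q r → (p - q) + (q - r) ≡ p - r
    lemma = solve 3 (λ p q r → (p :- q) :+ (q :- r) := p :- r) refl

  inverse : ∀ {b} → 0ℚ < b → ∃[ c ] 0ℚ < c × c * b ≡ 1ℚ
  inverse {b} 0<b = c , 0<c , ℚ.*-inverseˡ b
    where
    instance
      b-pos : Positive b
      b-pos = positive 0<b
      b-nonZero : NonZero b
      b-nonZero = ℚ.pos⇒nonZero b
    c : ℚ
    c = 1/ b
    0<c : 0ℚ < c
    0<c = ℚ.positive⁻¹ c {{ℚ.1/pos⇒pos b}}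

  ∣*∣<ε : ∀ p q {b c ε} → 0ℚ < b → c * b ≡ 1ℚ →
          ∣ p ∣ < ε * c → ∣ q ∣ ≤ b → ∣ p * q ∣ < ε
  ∣*∣<ε p q {b} {c} {ε} 0<b cb≡1 p< q≤ = begin-strict
    ∣ p * q ∣       ≡⟨ ℚ.∣p*q∣≡∣p∣*∣q∣ p q ⟩
    ∣ p ∣ * ∣ q ∣   ≤⟨ ℚ.*-monoˡ-≤-nonNeg ∣ p ∣ {{ℚ.∣-∣-nonNeg p}} q≤ ⟩
    ∣ p ∣ * b       <⟨ ℚ.*-monoˡ-<-pos b {{positive 0<b}} p< ⟩
    ε * c * b       ≡⟨ ℚ.*-assoc ε c b ⟩
    ε * (c * b)     ≡⟨ cong (ε *_) cb≡1 ⟩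
    ε * 1ℚ          ≡⟨ ℚ.*-identityʳ ε ⟩
    ε               ∎
    where open ℚ.≤-Reasoning

  product-close : ∀ p q p′ q′ {b c b′ c′ ε} →
    0ℚ < b → c * b ≡ 1ℚ → 0ℚ < b′ → c′ * b′ ≡ 1ℚ →
    ∣ q ∣ ≤ b → ∣ p′ ∣ ≤ b′ →
    ∣ p - p′ ∣ < half ε * c → ∣ q - q′ ∣ < half ε * c′ →
    ∣ p * q - p′ * q′ ∣ < ε
  product-close p q p′ q′ {ε = ε} 0<b cb 0<b′ cb′ q≤ p′≤ p< q< =
    subst (λ s → ∣ s ∣ < ε) (lemma p q p′ q′)
      (∣+∣<ε ((p - p′) * q) ((q - q′) * p′)
        (∣*∣<ε (p - p′) q 0<b cb p< q≤) (∣*∣<ε (q - q′) p′ 0<b′ cb′ q< p′≤))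
    where
    lemma : ∀ p q p′ q′ → (p - p′) * q + (q - q′) * p′ ≡ p * q - p′ * q′
    lemma = solve 4 (λ p q p′ q′ → (p :- p′) :* q :+ (q :- q′) :* p′ := p :* q :- p′ :* q′) refl

  negate-difference : ∀ p q → ∣ p - q ∣ ≡ ∣ - p - - q ∣
  negate-difference p q = ≡.trans (∣-∣-sym p q) (cong ∣_∣ (lemma p q))
    where
    lemma : ∀ p q → q - p ≡ - p - - q
    lemma = solve 2 (λ p q → q :- p := :- p :- :- q) refl

  add-difference : ∀ p q p′ q′ → (p - p′) + (q - q′) ≡ (p + q) - (p′ + q′)
  add-difference = solve 4 (λ p q p′ q′ → (p :- p′) :+ (q :- q′) := (p :+ q) :- (p′ :+ q′)) refl

  bound : ∀ p q → ∣ p - q ∣ < 1ℚ → ∣ p ∣ ≤ ∣ q ∣ + 1ℚ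
  bound p q p-q<1 = begin
    ∣ p ∣               ≡⟨ cong ∣_∣ (lemma p q) ⟩
    ∣ q + (p - q) ∣     ≤⟨ ℚ.∣p+q∣≤∣p∣+∣q∣ q (p - q) ⟩
    ∣ q ∣ + ∣ p - q ∣   ≤⟨ ℚ.+-monoʳ-≤ ∣ q ∣ (ℚ.<⇒≤ p-q<1) ⟩
    ∣ q ∣ + 1ℚ          ∎
    where
    open ℚ.≤-Reasoning
    lemma : ∀ p q → p ≡ q + (p - q)
    lemma = solve 2 (λ p q → p := q :+ (p :- q)) refl

  0<∣∣+1 : ∀ p → 0ℚ < ∣ p ∣ + 1ℚ
  0<∣∣+1 p = ℚ.+-mono-≤-< (ℚ.0≤∣p∣ p) (ℚ.positive⁻¹ 1ℚ)

open Rational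

IsCauchy : (ℕ → ℚ) → Set
IsCauchy s = ∀ ε → 0ℚ ℚ.< ε →
  ∃[ N ] ∀ {m n} → N ℕ.≤ m → N ℕ.≤ n → ℚ.∣ s m ℚ.- s n ∣ ℚ.< ε

record ℝ : Set where
  no-eta-equality
  field
    seq    : ℕ → ℚ
    cauchy : IsCauchy seq

module Real where
  open ℝ

  infix  4 _≈_
  infixl 6 _+_
  infixl 7 _*_
  infix  8 -_

  -- A record rather than a function, so that x and y can be inferred from x ≈ y.
  record _≈_ (x y : ℝ) : Set where
    constructor mk≈
    field
      null : ∀ ε → 0ℚ ℚ.< ε →
        ∃[ N ] ∀ {n} → N ℕ.≤ n → ℚ.∣ seq x n ℚ.- seq y n ∣ ℚ.< ε

  open _≈_ public

  Positive : Pred ℝ 0ℓ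
  Positive x = ∃[ ε ] 0ℚ ℚ.< ε × ∃[ N ] ∀ {n} → N ℕ.≤ n → ε ℚ.< seq x n

  fromℚ : ℚ → ℝ
  fromℚ q .seq _ = q
  fromℚ q .cauchy ε 0<ε =
    0 , λ _ _ → subst (λ r → ℚ.∣ r ∣ ℚ.< ε) (sym (ℚ.+-inverseʳ q)) 0<ε

  private
    boundedBy : (x : ℝ) → ∃[ N ] ∃[ b ] 0ℚ ℚ.< b × (∀ {n} → N ℕ.≤ n → ℚ.∣ seq x n ∣ ℚ.≤ b)
    boundedBy x with cauchy x 1ℚ (ℚ.positive⁻¹ 1ℚ)
    ... | N , close = N , ℚ.∣ seq x N ∣ ℚ.+ 1ℚ , 0<∣∣+1 (seq x N) ,
      λ {n} N≤n → bound (seq x n) (seq x N) (close N≤n ℕ.≤-refl)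

    left : ∀ {m n o} → m ⊔ n ℕ.≤ o → m ℕ.≤ o
    left {m} {n} = ℕ.m⊔n≤o⇒m≤o m n

    right : ∀ {m n o} → m ⊔ n ℕ.≤ o → n ℕ.≤ o
    right {m} {n} = ℕ.m⊔n≤o⇒n≤o m n

  _+_ : ℝ → ℝ → ℝ
  (x + y) .seq n = seq x n ℚ.+ seq y n
  (x + y) .cauchy ε 0<ε =
    let N , x-close = cauchy x (half ε) (0<half 0<ε)
        M , y-close = cauchy y (half ε) (0<half 0<ε)
    in N ⊔ M , λ {m} {n} m≥ n≥ →
      subst (λ r → ℚ.∣ r ∣ ℚ.< ε) (add-difference (seq x m) (seq y m) (seq x n) (seq y n))
        (∣+∣<ε (seq x m ℚ.- seq x n) (seq y m ℚ.- seq y n)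
          (x-close (left m≥) (left n≥)) (y-close (right {N} m≥) (right {N} n≥)))

  -_ : ℝ → ℝ
  (- x) .seq n = ℚ.- seq x n
  (- x) .cauchy ε 0<ε =
    let N , x-close = cauchy x ε 0<ε
    in N , λ {m} {n} m≥ n≥ →
      subst (ℚ._< ε) (negate-difference (seq x m) (seq x n)) (x-close m≥ n≥)

  _*_ : ℝ → ℝ → ℝ
  (x * y) .seq n = seq x n ℚ.* seq y n
  (x * y) .cauchy ε 0<ε =
    let K , b  , 0<b  , y≤b  = boundedBy y
        L , b′ , 0<b′ , x≤b′ = boundedBy x
        c  , 0<c  , cb≡1   = inverse 0<b
        c′ , 0<c′ , c′b′≡1 = inverse 0<b′
        N , x-close = cauchy x (half ε ℚ.* c)  (0<* (0<half 0<ε) 0<c)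
        M , y-close = cauchy y (half ε ℚ.* c′) (0<* (0<half 0<ε) 0<c′)
    in (K ⊔ L) ⊔ (N ⊔ M) , λ {m} {n} m≥ n≥ →
      product-close (seq x m) (seq y m) (seq x n) (seq y n) 0<b cb≡1 0<b′ c′b′≡1
        (y≤b (left (left {K ⊔ L} m≥))) (x≤b′ (right {K} (left {K ⊔ L} n≥)))
        (x-close (left (right {K ⊔ L} m≥)) (left (right {K ⊔ L} n≥)))
        (y-close (right {N} (right {K ⊔ L} m≥)) (right {N} (right {K ⊔ L} n≥)))

  0ℝ 1ℝ : ℝ
  0ℝ = fromℚ 0ℚ
  1ℝ = fromℚ 1ℚ

  pointwise : ∀ {x y} → (∀ n → seq x n ≡ seq y n) → x ≈ y
  pointwise {x} {y} eq = mk≈ λ ε 0<ε → 0 , λ {n} _ →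
    subst (λ r → ℚ.∣ r ∣ ℚ.< ε)
      (≡.trans (sym (ℚ.+-inverseʳ (seq y n))) (cong (ℚ._- seq y n) (sym (eq n)))) 0<ε

  ≈-refl : ∀ {x} → x ≈ x
  ≈-refl = pointwise λ _ → refl

  ≈-sym : ∀ {x y} → x ≈ y → y ≈ x
  ≈-sym {x} {y} x≈y = mk≈ λ ε 0<ε →
    let N , close = null x≈y ε 0<ε
    in N , λ {n} n≥ → subst (ℚ._< ε) (∣-∣-sym (seq x n) (seq y n)) (close n≥)

  ≈-trans : ∀ {x y z} → x ≈ y → y ≈ z → x ≈ z
  ≈-trans {x} {y} {z} x≈y y≈z = mk≈ λ ε 0<ε →
    let N , x-y = null x≈y (half ε) (0<half 0<ε)
        M , y-z = null y≈z (half ε) (0<half 0<ε)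
    in N ⊔ M , λ {n} n≥ →
      triangle (seq x n) (seq y n) (seq z n) (x-y (left n≥)) (y-z (right {N} n≥))

  +-cong : ∀ {x x′ y y′} → x ≈ x′ → y ≈ y′ → x + y ≈ x′ + y′
  +-cong {x} {x′} {y} {y′} x≈x′ y≈y′ = mk≈ λ ε 0<ε →
    let N , x-close = null x≈x′ (half ε) (0<half 0<ε)
        M , y-close = null y≈y′ (half ε) (0<half 0<ε)
    in N ⊔ M , λ {n} n≥ →
      subst (λ r → ℚ.∣ r ∣ ℚ.< ε) (add-difference (seq x n) (seq y n) (seq x′ n) (seq y′ n))
        (∣+∣<ε (seq x n ℚ.- seq x′ n) (seq y n ℚ.- seq y′ n)
          (x-close (left n≥)) (y-close (right {N} n≥)))

  -‿cong : ∀ {x y} → x ≈ y → - x ≈ - y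
  -‿cong {x} {y} x≈y = mk≈ λ ε 0<ε →
    let N , close = null x≈y ε 0<ε
    in N , λ {n} n≥ → subst (ℚ._< ε) (negate-difference (seq x n) (seq y n)) (close n≥)

  *-cong : ∀ {x x′ y y′} → x ≈ x′ → y ≈ y′ → x * y ≈ x′ * y′
  *-cong {x} {x′} {y} {y′} x≈x′ y≈y′ = mk≈ λ ε 0<ε →
    let K , b  , 0<b  , y≤b   = boundedBy y
        L , b′ , 0<b′ , x′≤b′ = boundedBy x′
        c  , 0<c  , cb≡1   = inverse 0<b
        c′ , 0<c′ , c′b′≡1 = inverse 0<b′
        N , x-close = null x≈x′ (half ε ℚ.* c)  (0<* (0<half 0<ε) 0<c)
        M , y-close = null y≈y′ (half ε ℚ.* c′) (0<* (0<half 0<ε) 0<c′)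
    in (K ⊔ L) ⊔ (N ⊔ M) , λ {n} n≥ →
      product-close (seq x n) (seq y n) (seq x′ n) (seq y′ n) 0<b cb≡1 0<b′ c′b′≡1
        (y≤b (left (left {K ⊔ L} n≥))) (x′≤b′ (right {K} (left {K ⊔ L} n≥)))
        (x-close (left (right {K ⊔ L} n≥)))
        (y-close (right {N} (right {K ⊔ L} n≥)))

  private
    +-assoc : ∀ x y z → x + y + z ≈ x + (y + z)
    +-assoc x y z = pointwise λ n → ℚ.+-assoc (seq x n) (seq y n) (seq z n)

    +-comm : ∀ x y → x + y ≈ y + x
    +-comm x y = pointwise λ n → ℚ.+-comm (seq x n) (seq y n)

    +-identityˡ : ∀ x → 0ℝ + x ≈ x
    +-identityˡ x = pointwise λ n → ℚ.+-identityˡ (seq x n)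

    -‿inverseˡ : ∀ x → - x + x ≈ 0ℝ
    -‿inverseˡ x = pointwise λ n → ℚ.+-inverseˡ (seq x n)

    *-assoc : ∀ x y z → x * y * z ≈ x * (y * z)
    *-assoc x y z = pointwise λ n → ℚ.*-assoc (seq x n) (seq y n) (seq z n)

    *-comm : ∀ x y → x * y ≈ y * x
    *-comm x y = pointwise λ n → ℚ.*-comm (seq x n) (seq y n)

    *-identityˡ : ∀ x → 1ℝ * x ≈ x
    *-identityˡ x = pointwise λ n → ℚ.*-identityˡ (seq x n)

    distribˡ : ∀ x y z → x * (y + z) ≈ x * y + x * z
    distribˡ x y z = pointwise λ n → ℚ.*-distribˡ-+ (seq x n) (seq y n) (seq z n)

    isEquivalence : IsEquivalence _≈_
    isEquivalence = record { refl = ≈-refl ; sym = ≈-sym ; trans = ≈-trans }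

    open IsEquivalence isEquivalence using (trans)

    +-isMagma : IsMagma _≈_ _+_
    +-isMagma = record { isEquivalence = isEquivalence ; ∙-cong = +-cong }

    +-isSemigroup : IsSemigroup _≈_ _+_
    +-isSemigroup = record { isMagma = +-isMagma ; assoc = +-assoc }

    +-identity : Identity _≈_ 0ℝ _+_
    +-identity = +-identityˡ , λ x → trans (+-comm x 0ℝ) (+-identityˡ x)

    +-isMonoid : IsMonoid _≈_ _+_ 0ℝ
    +-isMonoid = record { isSemigroup = +-isSemigroup ; identity = +-identity }

    -‿inverse : Inverse _≈_ 0ℝ -_ _+_
    -‿inverse = -‿inverseˡ , λ x → trans (+-comm x (- x)) (-‿inverseˡ x)

    +-isGroup : IsGroup _≈_ _+_ 0ℝ -_
    +-isGroup = record { isMonoid = +-isMonoid ; inverse = -‿inverse ; ⁻¹-cong = -‿cong }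

    +-isAbelianGroup : IsAbelianGroup _≈_ _+_ 0ℝ -_
    +-isAbelianGroup = record { isGroup = +-isGroup ; comm = +-comm }

    *-identity : Identity _≈_ 1ℝ _*_
    *-identity = *-identityˡ , λ x → trans (*-comm x 1ℝ) (*-identityˡ x)

    distrib : _DistributesOver_ _≈_ _*_ _+_
    distrib = distribˡ , λ x y z →
      trans (*-comm (y + z) x) (trans (distribˡ x y z) (+-cong (*-comm x y) (*-comm x z)))

    isRing : IsRing _≈_ _+_ _*_ -_ 0ℝ 1ℝ
    isRing = record
      { +-isAbelianGroup = +-isAbelianGroup
      ; *-cong = *-cong
      ; *-assoc = *-assoc
      ; *-identity = *-identity
      ; distrib = distrib
      }

    isCommutativeRing : IsCommutativeRing _≈_ _+_ _*_ -_ 0ℝ 1ℝ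
    isCommutativeRing = record { isRing = isRing ; *-comm = *-comm }

  commutativeRing : CommutativeRing 0ℓ 0ℓ
  commutativeRing = record { isCommutativeRing = isCommutativeRing }

------------------------------------------------------------------------
-- Complex numbers

private module ComplexLaws where
  open import Data.Rational.Base
  open import Data.Rational.Solver
  open +-*-Solver

  assoc-re : ∀ a b c d e f →
    (a * c - b * d) * e - (a * d + b * c) * f ≡
    a * (c * e - d * f) - b * (c * f + d * e)
  assoc-re = solve 6 (λ a b c d e f →
    (a :* c :- b :* d) :* e :- (a :* d :+ b :* c) :* f :=
    a :* (c :* e :- d :* f) :- b :* (c :* f :+ d :* e)) refl

  assoc-im : ∀ a b c d e f →
    (a * c - b * d) * f + (a * d + b * c) * e ≡
    a * (c * f + d * e) + b * (c * e - d * f)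
  assoc-im = solve 6 (λ a b c d e f →
    (a :* c :- b :* d) :* f :+ (a :* d :+ b :* c) :* e :=
    a :* (c :* f :+ d :* e) :+ b :* (c :* e :- d :* f)) refl

  comm-re : ∀ a b c d →
    a * c - b * d ≡
    c * a - d * b
  comm-re = solve 4 (λ a b c d →
    a :* c :- b :* d :=
    c :* a :- d :* b) refl

  comm-im : ∀ a b c d →
    a * d + b * c ≡
    c * b + d * a
  comm-im = solve 4 (λ a b c d →
    a :* d :+ b :* c :=
    c :* b :+ d :* a) refl

  identityˡ-re : ∀ a b →
    1ℚ * a - 0ℚ * b ≡
    a
  identityˡ-re = solve 2 (λ a b →
    con 1ℚ :* a :- con 0ℚ :* b :=
    a) refl

  identityˡ-im : ∀ a b →
    1ℚ * b + 0ℚ * a ≡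
    b
  identityˡ-im = solve 2 (λ a b →
    con 1ℚ :* b :+ con 0ℚ :* a :=
    b) refl

  distribˡ-re : ∀ a b c d e f →
    a * (c + e) - b * (d + f) ≡
    (a * c - b * d) + (a * e - b * f)
  distribˡ-re = solve 6 (λ a b c d e f →
    a :* (c :+ e) :- b :* (d :+ f) :=
    (a :* c :- b :* d) :+ (a :* e :- b :* f)) refl

  distribˡ-im : ∀ a b c d e f →
    a * (d + f) + b * (c + e) ≡
    (a * d + b * c) + (a * f + b * e)
  distribˡ-im = solve 6 (λ a b c d e f →
    a :* (d :+ f) :+ b :* (c :+ e) :=
    (a :* d :+ b :* c) :+ (a :* f :+ b :* e)) refl

record ℂ : Set where
  no-eta-equality
  field
    re im : ℝ

module Complex where
  open ℂ
  private
    module R = CommutativeRing Real.commutativeRing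

  infix  4 _≈_
  infixl 6 _+_
  infixl 7 _*_
  infix  8 -_

  record _≈_ (z w : ℂ) : Set where
    constructor mk≈
    field
      re≈ : re z R.≈ re w
      im≈ : im z R.≈ im w

  open _≈_ public

  _+_ _*_ : ℂ → ℂ → ℂ
  (z + w) .re = re z R.+ re w
  (z + w) .im = im z R.+ im w
  (z * w) .re = re z R.* re w R.- im z R.* im w
  (z * w) .im = re z R.* im w R.+ im z R.* re w

  -_ conj : ℂ → ℂ
  (- z)  .re = R.- re z
  (- z)  .im = R.- im z
  conj z .re = re z
  conj z .im = R.- im z

  fromℝ : ℝ → ℂ
  fromℝ x .re = x
  fromℝ x .im = Real.0ℝ

  fromℤ : ℤ → ℂ
  fromℤ k = fromℝ (Real.fromℚ (k ℚ./ 1))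

  0ℂ 1ℂ : ℂ
  0ℂ = fromℝ Real.0ℝ
  1ℂ = fromℝ Real.1ℝ

  private
    open ℝ using (seq)
    module L = ComplexLaws

    *-comm : ∀ z w → z * w ≈ w * z
    *-comm z w = mk≈
      (Real.pointwise λ n → L.comm-re (seq (re z) n) (seq (im z) n) (seq (re w) n) (seq (im w) n))
      (Real.pointwise λ n → L.comm-im (seq (re z) n) (seq (im z) n) (seq (re w) n) (seq (im w) n))

    *-assoc : ∀ z w v → z * w * v ≈ z * (w * v)
    *-assoc z w v = mk≈
      (Real.pointwise λ n →
        L.assoc-re (seq (re z) n) (seq (im z) n) (seq (re w) n) (seq (im w) n)
          (seq (re v) n) (seq (im v) n))
      (Real.pointwise λ n →
        L.assoc-im (seq (re z) n) (seq (im z) n) (seq (re w) n) (seq (im w) n)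
          (seq (re v) n) (seq (im v) n))

    *-identityˡ : ∀ z → 1ℂ * z ≈ z
    *-identityˡ z = mk≈
      (Real.pointwise λ n → L.identityˡ-re (seq (re z) n) (seq (im z) n))
      (Real.pointwise λ n → L.identityˡ-im (seq (re z) n) (seq (im z) n))

    distribˡ : ∀ z w v → z * (w + v) ≈ z * w + z * v
    distribˡ z w v = mk≈
      (Real.pointwise λ n →
        L.distribˡ-re (seq (re z) n) (seq (im z) n) (seq (re w) n) (seq (im w) n)
          (seq (re v) n) (seq (im v) n))
      (Real.pointwise λ n →
        L.distribˡ-im (seq (re z) n) (seq (im z) n) (seq (re w) n) (seq (im w) n)
          (seq (re v) n) (seq (im v) n))

    +-cong : ∀ {z z′ w w′} → z ≈ z′ → w ≈ w′ → z + w ≈ z′ + w′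
    +-cong (mk≈ p q) (mk≈ p′ q′) = mk≈ (R.+-cong p p′) (R.+-cong q q′)

    *-cong : ∀ {z z′ w w′} → z ≈ z′ → w ≈ w′ → z * w ≈ z′ * w′
    *-cong (mk≈ p q) (mk≈ p′ q′) = mk≈
      (R.+-cong (R.*-cong p p′) (R.-‿cong (R.*-cong q q′)))
      (R.+-cong (R.*-cong p q′) (R.*-cong q p′))

    +-assoc : ∀ z w v → z + w + v ≈ z + (w + v)
    +-assoc z w v = mk≈ (R.+-assoc (re z) (re w) (re v)) (R.+-assoc (im z) (im w) (im v))

    +-comm : ∀ z w → z + w ≈ w + z
    +-comm z w = mk≈ (R.+-comm (re z) (re w)) (R.+-comm (im z) (im w))

    +-identityˡ : ∀ z → 0ℂ + z ≈ z
    +-identityˡ z = mk≈ (R.+-identityˡ (re z)) (R.+-identityˡ (im z))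

    -‿inverseˡ : ∀ z → - z + z ≈ 0ℂ
    -‿inverseˡ z = mk≈ (R.-‿inverseˡ (re z)) (R.-‿inverseˡ (im z))

    -‿cong : ∀ {z w} → z ≈ w → - z ≈ - w
    -‿cong (mk≈ p q) = mk≈ (R.-‿cong p) (R.-‿cong q)

    isEquivalence : IsEquivalence _≈_
    isEquivalence = record
      { refl  = mk≈ R.refl R.refl
      ; sym   = λ (mk≈ p q) → mk≈ (R.sym p) (R.sym q)
      ; trans = λ (mk≈ p q) (mk≈ p′ q′) → mk≈ (R.trans p p′) (R.trans q q′)
      }

    open IsEquivalence isEquivalence using (trans)

    +-isMagma : IsMagma _≈_ _+_
    +-isMagma = record { isEquivalence = isEquivalence ; ∙-cong = +-cong }

    +-isSemigroup : IsSemigroup _≈_ _+_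
    +-isSemigroup = record { isMagma = +-isMagma ; assoc = +-assoc }

    +-identity : Identity _≈_ 0ℂ _+_
    +-identity = +-identityˡ , λ x → trans (+-comm x 0ℂ) (+-identityˡ x)

    +-isMonoid : IsMonoid _≈_ _+_ 0ℂ
    +-isMonoid = record { isSemigroup = +-isSemigroup ; identity = +-identity }

    -‿inverse : Inverse _≈_ 0ℂ -_ _+_
    -‿inverse = -‿inverseˡ , λ x → trans (+-comm x (- x)) (-‿inverseˡ x)

    +-isGroup : IsGroup _≈_ _+_ 0ℂ -_
    +-isGroup = record { isMonoid = +-isMonoid ; inverse = -‿inverse ; ⁻¹-cong = -‿cong }

    +-isAbelianGroup : IsAbelianGroup _≈_ _+_ 0ℂ -_
    +-isAbelianGroup = record { isGroup = +-isGroup ; comm = +-comm }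

    *-identity : Identity _≈_ 1ℂ _*_
    *-identity = *-identityˡ , λ x → trans (*-comm x 1ℂ) (*-identityˡ x)

    distrib : _DistributesOver_ _≈_ _*_ _+_
    distrib = distribˡ , λ x y z →
      trans (*-comm (y + z) x) (trans (distribˡ x y z) (+-cong (*-comm x y) (*-comm x z)))

    isRing : IsRing _≈_ _+_ _*_ -_ 0ℂ 1ℂ
    isRing = record
      { +-isAbelianGroup = +-isAbelianGroup
      ; *-cong = *-cong
      ; *-assoc = *-assoc
      ; *-identity = *-identity
      ; distrib = distrib
      }

    isCommutativeRing : IsCommutativeRing _≈_ _+_ _*_ -_ 0ℂ 1ℂ
    isCommutativeRing = record { isRing = isRing ; *-comm = *-comm }

  commutativeRing : CommutativeRing 0ℓ 0ℓ
  commutativeRing = record { isCommutativeRing = isCommutativeRing }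

------------------------------------------------------------------------
-- Linear algebra over ℂ

module LinearAlgebra (M : RawLeftModule ℂ 0ℓ 0ℓ) where
  open RawLeftModule M
  open RawMonoidDefinitions +ᴹ-rawMonoid public using (sum)

  linearCombination : ∀ {k} → Vector ℂ k → Vector Carrierᴹ k → Carrierᴹ
  linearCombination c v = sum λ i → c i *ₗ v i

  Span : ∀ {k} → Vector Carrierᴹ k → Pred Carrierᴹ 0ℓ
  Span v u = ∃[ c ] u ≈ᴹ linearCombination c v

  LinearlyIndependent : ∀ {k} → Vector Carrierᴹ k → Set
  LinearlyIndependent v =
    ∀ c → linearCombination c v ≈ᴹ 0ᴹ → ∀ i → c i Complex.≈ Complex.0ℂ

  record IsSubspace (W : Pred Carrierᴹ 0ℓ) : Set where
    field
      ∈-resp-≈ : ∀ {u v} → u ≈ᴹ v → W u → W v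
      0∈       : W 0ᴹ
      +-closed : ∀ {u v} → W u → W v → W (u +ᴹ v)
      *-closed : ∀ c {v} → W v → W (c *ₗ v)

  Nonzero : Pred Carrierᴹ 0ℓ → Set
  Nonzero W = ∃[ v ] W v × ¬ (v ≈ᴹ 0ᴹ)

  record IsBasis (W : Pred Carrierᴹ 0ℓ) {k} (v : Vector Carrierᴹ k) : Set where
    field
      members     : ∀ i → W (v i)
      independent : LinearlyIndependent v
      spanning    : W ⊆ Span v

  HasDimension : Pred Carrierᴹ 0ℓ → ℕ → Set
  HasDimension W k = Σ[ v ∈ Vector Carrierᴹ k ] IsBasis W v

Matrix : ℕ → Set
Matrix n = Fin n → Fin n → ℂ

vectorSpace : ℕ → RawLeftModule ℂ 0ℓ 0ℓ
vectorSpace n = record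
  { Carrierᴹ = Vector ℂ n
  ; _≈ᴹ_     = λ u v → ∀ i → u i Complex.≈ v i
  ; _+ᴹ_     = λ u v i → u i Complex.+ v i
  ; _*ₗ_     = λ c v i → c Complex.* v i
  ; 0ᴹ       = λ _ → Complex.0ℂ
  ; -ᴹ_      = λ v i → Complex.- v i
  }

matrixSpace : ℕ → RawLeftModule ℂ 0ℓ 0ℓ
matrixSpace n = record
  { Carrierᴹ = Matrix n
  ; _≈ᴹ_     = λ M N → ∀ i j → M i j Complex.≈ N i j
  ; _+ᴹ_     = λ M N i j → M i j Complex.+ N i j
  ; _*ₗ_     = λ c M i j → c Complex.* M i j
  ; 0ᴹ       = λ _ _ → Complex.0ℂ
  ; -ᴹ_      = λ M i j → Complex.- M i j
  }

module 𝕍 {n : ℕ} where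
  open RawLeftModule (vectorSpace n) public
  open LinearAlgebra (vectorSpace n) public

module 𝕄 {n : ℕ} where
  open RawLeftModule (matrixSpace n) public
  open LinearAlgebra (matrixSpace n) public

∑ : ∀ {n} → Vector ℂ n → ℂ
∑ = RawMonoidDefinitions.sum (CommutativeRing.+-rawMonoid Complex.commutativeRing)

infixr 8 _·_ _⊙_ _⟨_⟩

_·_ : ∀ {n} → Matrix n → Vector ℂ n → Vector ℂ n
(M · v) i = ∑ λ j → M i j Complex.* v j

_⊙_ : ∀ {n} → Matrix n → Matrix n → Matrix n
(M ⊙ N) i j = ∑ λ k → M i k Complex.* N k j

identityMatrix : ∀ n → Matrix n
identityMatrix _ i j = if does (i ≟ᶠ j) then Complex.1ℂ else Complex.0ℂ

-- The image M W of a set of vectors W.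
_⟨_⟩ : ∀ {n} → Matrix n → Pred (Vector ℂ n) 0ℓ → Pred (Vector ℂ n) 0ℓ
(M ⟨ W ⟩) v = ∃[ w ] W w × v 𝕍.≈ᴹ M · w

inner : ∀ {n} → Vector ℂ n → Vector ℂ n → ℂ
inner u v = ∑ λ i → u i Complex.* Complex.conj (v i)

Eigenspace : ∀ {n} → Matrix n → ℂ → Pred (Vector ℂ n) 0ℓ
Eigenspace M θ v = M · v 𝕍.≈ᴹ θ 𝕍.*ₗ v

-- Multiplicities are geometric.  They agree with the algebraic ones for the
-- adjacency matrix of a graph, which is Hermitian, and for an m × m matrix
-- with m distinct eigenvalues.
record HasSpectrum {n} (M : Matrix n) (spectrum : List (ℂ × ℕ)) : Set where
  field
    distinct       : AllPairs (λ (θ , _) (η , _) → ¬ (θ Complex.≈ η)) spectrum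
    multiplicities : All (λ (θ , m) → 𝕍.HasDimension (Eigenspace M θ) m) spectrum
    complete       : ∀ θ → 𝕍.Nonzero (Eigenspace M θ) →
                     Any (λ (η , _) → θ Complex.≈ η) spectrum

-- The matrix with the given rows.
fromRows : ∀ {m} → Vec (Vec ℕ m) m → Matrix m
fromRows rows i j = Complex.fromℤ (ℤ.+ lookup (lookup rows i) j)

fromEntries : ∀ {m} → Vec ℤ m → Vector ℂ m
fromEntries entries i = Complex.fromℤ (lookup entries i)

module _ {n : ℕ} where

  record DirectSum {k} (W : Vector (Pred (Vector ℂ n) 0ℓ) k) : Set where
    field
      decompose : ∀ v → Σ[ w ∈ (Fin k → Vector ℂ n) ] (∀ i → W i (w i)) × v 𝕍.≈ᴹ 𝕍.sum w
      unique    : ∀ {w w′ : Fin k → Vector ℂ n} →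
                  (∀ i → W i (w i)) → (∀ i → W i (w′ i)) →
                  𝕍.sum w 𝕍.≈ᴹ 𝕍.sum w′ → ∀ i → w i 𝕍.≈ᴹ w′ i

  record OrthogonalDirectSum {k} (W : Vector (Pred (Vector ℂ n) 0ℓ) k) : Set where
    field
      directSum  : DirectSum W
      orthogonal : ∀ {i j} → i ≢ j → ∀ {u v} → W i u → W j v → inner u v Complex.≈ Complex.0ℂ

------------------------------------------------------------------------
-- Distance-regular graphs

module _ {n : ℕ} (Adj : Rel (Fin n) 0ℓ) where

  data Walk : ℕ → Rel (Fin n) 0ℓ where
    []  : ∀ {x} → Walk 0 x x
    _∷_ : ∀ {k x y z} → Adj x y → Walk k y z → Walk (suc k) x z

-- Simple graphs on n vertices; connectedness is the existence of the path-length
-- distance d.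
record ConnectedGraph (n : ℕ) : Set₁ where
  field
    Adj         : Rel (Fin n) 0ℓ
    adj?        : Decidable Adj
    adj-sym     : Symmetric Adj
    adj-irrefl  : Irreflexive _≡_ Adj
    d           : Fin n → Fin n → ℕ
    d-attained  : ∀ x y → Walk Adj (d x y) x y
    d-minimal   : ∀ {k x y} → Walk Adj k x y → d x y ℕ.≤ k

record DistanceRegular {n} (Γ : ConnectedGraph n) : Set where
  open ConnectedGraph Γ
  field
    D            : ℕ
    D≥1          : 1 ℕ.≤ D
    d≤D          : ∀ x y → d x y ℕ.≤ D
    D-attained   : ∃[ x ] ∃[ y ] d x y ≡ D
    p            : (h i j : ℕ) → ℕ
    intersection : ∀ {h i j} → h ℕ.≤ D → i ℕ.≤ D → j ℕ.≤ D → ∀ {y z} → d y z ≡ h →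
      length (filter (λ w → (d y w ℕ.≟ i) ×-dec (d z w ℕ.≟ j)) (allFin n)) ≡ p h i j

  b c : ℕ → ℕ
  b i = p i 1 (suc i)
  c i = p i 1 (pred i)

  -- (b₀ , … , b_{D-1}) and (c₁ , … , c_D)
  intersectionArray : List ℕ × List ℕ
  intersectionArray = map b (upTo D) , map (λ i → c (suc i)) (upTo D)

module _ {n : ℕ} (Γ : ConnectedGraph n) where
  open ConnectedGraph Γ

  adjacencyMatrix : Matrix n
  adjacencyMatrix x y = if does (adj? x y) then Complex.1ℂ else Complex.0ℂ

  -- An ordering z₁ , … , zₘ of the vertices of Γᵢ(x).
  record OrdersSphere (i : ℕ) (x : Fin n) {m} (z : Fin m → Fin n) : Set where
    field
      injective : Injective _≡_ _≡_ z
      covers    : ∀ y → (d x y ≡ i) ⇔ (∃[ j ] z j ≡ y)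

  -- y and z have a common neighbour in Γ₁(x).
  CommonNeighbourIn₁ : (x y z : Fin n) → Set
  CommonNeighbourIn₁ x y z = ∃[ w ] d x w ≡ 1 × Adj w y × Adj w z

-- The vector with essential part a with respect to the ordering z.
withEssentialPart : ∀ {m n} → (Fin m → Fin n) → Vector ℂ m → Vector ℂ n
withEssentialPart z a y = ∑ λ j → if does (z j ≟ᶠ y) then a j else Complex.0ℂ

------------------------------------------------------------------------
-- Terwilliger algebras

module Terwilliger {n : ℕ} {Γ : ConnectedGraph n} (Γ-dr : DistanceRegular Γ) (x : Fin n) where
  open ConnectedGraph Γ
  open DistanceRegular Γ-dr

  A : Matrix n
  A = adjacencyMatrix Γ

  e* : ℕ → Vector ℂ n
  e* i y = if does (d x y ℕ.≟ i) then Complex.1ℂ else Complex.0ℂ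

  E* : ℕ → Matrix n
  E* i y z = if does (y ≟ᶠ z) then e* i y else Complex.0ℂ

  data T : Pred (Matrix n) 0ℓ where
    A∈       : T A
    E*∈      : ∀ {i} → i ℕ.≤ D → T (E* i)
    1∈       : T (identityMatrix n)
    +-closed : ∀ {M N} → T M → T N → T (M 𝕄.+ᴹ N)
    *-closed : ∀ c {M} → T M → T (c 𝕄.*ₗ M)
    ⊙-closed : ∀ {M N} → T M → T N → T (M ⊙ N)
    ∈-resp-≈ : ∀ {M N} → M 𝕄.≈ᴹ N → T M → T N

  Subset-V : Set₁
  Subset-V = Pred (Vector ℂ n) 0ℓ

  record IsModule (W : Subset-V) : Set where
    field
      isSubspace : 𝕍.IsSubspace W
      T-closed   : ∀ {B v} → T B → W v → W (B · v)

  -- W′ ⊂ W is W′ ⊆ W × ¬ (W ⊆ W′): W has no nonzero proper submodule.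
  record Irreducible (W : Subset-V) : Set₁ where
    field
      isModule : IsModule W
      nonzero  : 𝕍.Nonzero W
      minimal  : ∀ {W′} → IsModule W′ → 𝕍.Nonzero W′ → ¬ (W′ ⊂ W)

  -- The membership proofs are irrelevant up to ≈ by to-cong and from-cong.
  record Isomorphic (W W′ : Subset-V) : Set where
    field
      to        : ∃ W → ∃ W′
      from      : ∃ W′ → ∃ W
      to-cong   : ∀ {u v} → proj₁ u 𝕍.≈ᴹ proj₁ v → proj₁ (to u) 𝕍.≈ᴹ proj₁ (to v)
      from-cong : ∀ {u v} → proj₁ u 𝕍.≈ᴹ proj₁ v → proj₁ (from u) 𝕍.≈ᴹ proj₁ (from v)
      to-from   : ∀ v → proj₁ (to (from v)) 𝕍.≈ᴹ proj₁ v
      from-to   : ∀ v → proj₁ (from (to v)) 𝕍.≈ᴹ proj₁ v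
      additive  : ∀ {u v} (p : W u) (q : W v) (r : W (u 𝕍.+ᴹ v)) →
                  proj₁ (to (_ , r)) 𝕍.≈ᴹ proj₁ (to (_ , p)) 𝕍.+ᴹ proj₁ (to (_ , q))
      scalar    : ∀ c {v} (p : W v) (q : W (c 𝕍.*ₗ v)) →
                  proj₁ (to (_ , q)) 𝕍.≈ᴹ c 𝕍.*ₗ proj₁ (to (_ , p))
      commutes  : ∀ {B} → T B → ∀ {v} (p : W v) (q : W (B · v)) →
                  proj₁ (to (_ , q)) 𝕍.≈ᴹ B · proj₁ (to (_ , p))

  -- Exactly m summands of the family W are isomorphic to W′.
  MultiplicityIn : ∀ {k} → Vector Subset-V k → Subset-V → ℕ → Set
  MultiplicityIn {k} W W′ m =
    Σ[ S ∈ Subset k ] (∀ i → i ∈ S ⇔ Isomorphic (W i) W′) × Subset.∣ S ∣ ≡ m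

  record HasEndpoint (W : Subset-V) (r : ℕ) : Set where
    field
      r≤D     : r ℕ.≤ D
      nonzero : 𝕍.Nonzero (E* r ⟨ W ⟩)
      minimal : ∀ {i} → i ℕ.< r → ¬ 𝕍.Nonzero (E* i ⟨ W ⟩)

  HasDiameter : Subset-V → ℕ → Set
  HasDiameter W δ =
    Σ[ S ∈ Subset (suc D) ]
      (∀ i → i ∈ S ⇔ 𝕍.Nonzero (E* (toℕ i) ⟨ W ⟩)) × Subset.∣ S ∣ ≡ suc δ

  HasShape : Subset-V → (r : ℕ) {δ : ℕ} → Vec ℕ (suc δ) → Set
  HasShape W r shape =
    ∀ i → 𝕍.HasDimension (E* (r ℕ.+ toℕ i) ⟨ W ⟩) (lookup shape i)

  PureWithSupport : ℕ → Pred (Vector ℂ n) 0ℓ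
  PureWithSupport i v = (E* i ⟨ U ⟩) v × ¬ (v 𝕍.≈ᴹ 𝕍.0ᴹ)

  record IsPureBasis (W : Subset-V) {k} (v : Vector (Vector ℂ n) k) : Set where
    field
      isBasis    : 𝕍.IsBasis W v
      support    : Fin k → ℕ
      support≤D  : ∀ i → support i ℕ.≤ D
      pure       : ∀ i → PureWithSupport (support i) (v i)
      increasing : ∀ {i j} → i Fin.≤ j → support i ℕ.≤ support j

  -- B represents A with respect to v.
  Represents : ∀ {k} → Matrix k → Vector (Vector ℂ n) k → Set
  Represents B v = ∀ j → A · v j 𝕍.≈ᴹ 𝕍.sum λ i → B i j 𝕍.*ₗ v i

  record HasData (W : Subset-V) (r dim δ : ℕ) (shape : Vec ℕ (suc δ))
                 (basis : Vector (Vector ℂ n) dim) (B : Matrix dim) : Set where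
    field
      endpoint    : HasEndpoint W r
      dimension   : 𝕍.HasDimension W dim
      diameter    : HasDiameter W δ
      hasShape    : HasShape W r shape
      isPureBasis : IsPureBasis W basis
      represents  : Represents B basis

  record HasSeed (W : Subset-V) (r : ℕ) (ν : Vector ℂ n) : Set where
    field
      spans  : 𝕍.IsBasis (E* r ⟨ W ⟩) {1} (λ _ → ν)
      A-seed : A · ν 𝕍.≈ᴹ E* (suc r) · A · ν

data ModuleType : Set where
  I II III : ModuleType

{-# OPTIONS --safe #-}
module Submission where

-- The integers bᵢ, cᵢ determine the graph: cᵢ + bᵢ = 3 makes it bipartite and c₂ = 1 forbids
-- squares, so the vertices can be labelled, starting from x and the given orderings, in such a way
-- that adjacency is known up to a permutation of Γ₁(x) and one parity.  In each of these 12 cases an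
-- integer calculation shows that the listed pure vectors are orthogonal, resolve the identity, and are
-- transformed by A as stated.  Hence every element of T acts on all summands of one type by the same
-- block, which embeds T into Mat₄ × Mat₂ × Mat₂.  Words in A and E*ᵢ realise the 24 matrix units
-- (up to nonzero integers): they give dim T, and, applied to a vector with an invertible coordinate,
-- irreducibility.  Types are told apart by the levels on which the E*ᵢ vanish, and the spectrum of A is
-- read off from those of the two blocks.
--
-- Constructively, an eigenvalue θ is located as follows: P(θ)v = 0 with v ≠ 0 gives P(θ) = 0 because
-- equality of Cauchy reals is ¬¬-stable, and a product that vanishes has a vanishing factor as soon as
-- the difference of the factors is invertible.

open import Defs
open import Algebra.Bundles using (CommutativeRing; RawRing)
import Algebra.Properties.CommutativeMonoid.Sum as CommutativeMonoidSum
import Algebra.Properties.Ring as RingProperties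
import Algebra.Properties.Semiring.Sum as SemiringSum
import Algebra.Solver.Ring as RingSolver
import Algebra.Solver.Ring.AlmostCommutativeRing as ACR
open import Data.Bool.Base using (Bool; true; false; if_then_else_; not; _xor_)
import Data.Bool.Properties as Bool
open import Data.Empty using (⊥)
open import Data.Fin.Base using (Fin; toℕ; zero; suc; remQuot; _↑ˡ_; _↑ʳ_; splitAt; punchOut)
import Data.Fin.Base as Fin
open import Data.Fin.Patterns using (0F; 1F; 2F; 3F; 4F; 5F)
open import Data.Fin.Permutation using (Permutation; permutation; _⟨$⟩ʳ_)
import Data.Fin.Properties as Fin
open import Data.Fin.Subset as Subset using (_∈_)
open import Data.Integer.Base as ℤ using (ℤ; +_; -[1+_]; 0ℤ; 1ℤ; -1ℤ)
import Data.Integer.Properties as ℤ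
open import Data.List.Base using (List; []; _∷_; length; filter; allFin; map; upTo)
import Data.List.Base as List
open import Data.List.Membership.Propositional.Properties using (∈-filter⁺; ∈-filter⁻; ∈-lookup; ∈-allFin)
import Data.List.Properties as List
open import Data.List.Relation.Unary.All as All using ([]; _∷_)
open import Data.List.Relation.Unary.AllPairs using (AllPairs; []; _∷_)
open import Data.List.Relation.Unary.Any as Any using (Any; here; there)
import Data.List.Relation.Unary.Any.Properties as Any
open import Data.List.Relation.Unary.Unique.Propositional using (Unique)
import Data.List.Relation.Unary.Unique.Propositional.Properties as Unique
open import Data.Maybe.Base using (Maybe; just; nothing)
open import Data.Nat.Base as ℕ using (ℕ; zero; suc; _⊔_)
import Data.Nat.Properties as ℕ
open import Data.Product.Base using (∃; ∃-syntax; Σ-syntax; _×_; _,_; proj₁; proj₂)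
open import Data.Product.Properties using (,-injectiveˡ; ,-injectiveʳ)
open import Data.Rational.Base as ℚ using (ℚ; mkℚ; 0ℚ; 1ℚ; ½; _/_)
import Data.Rational.Properties as ℚ
import Data.Rational.Unnormalised.Base as ℚᵘ
import Data.Rational.Unnormalised.Properties as ℚᵘ
open import Data.Sum.Base using (_⊎_; inj₁; inj₂)
open import Data.Vec.Base using (Vec; lookup; replicate; tabulate; []; _∷_)
open import Data.Vec.Functional using (Vector) renaming ([] to ⟨⟩; _∷_ to _▹_)
import Data.Vec.Properties as Vec
open import Function.Bundles using (_⇔_; mk⇔; Equivalence)
open import Function.Definitions using (Injective)
open import Level using (0ℓ)
open import Relation.Binary.Definitions using (DecidableEquality)
open import Relation.Binary.PropositionalEquality as ≡
  using (_≡_; _≢_; refl; sym; trans; cong; cong₂; subst; subst₂)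
open import Relation.Nullary.Decidable
  using (Dec; yes; no; does; dec-true; dec-false; decidable-stable; from-yes; _×-dec_; _→-dec_; ¬?; map′)
open import Relation.Nullary.Negation using (¬_; contradiction)
open import Relation.Unary using (Pred; Decidable; _⊆_; _⊂_)

-- Equality on ℂ cannot be decided by evaluation. Everything finite is therefore stated over ℤ,
-- decided there, and carried to ℂ by `ι`. The interface between the graph and the linear algebra is
-- `Frame`: the listed vectors `b` together with a dual family `κ`, which takes the place of
-- inverting a 14 by 14 matrix. The squared norms of the listed vectors are 1, 2, 3, 4, 6 and 12, so
-- the common denominator 12 makes all identities about `κ` integral. The number of cases is 6 · 2:
-- a bijection from the three given pairs in Γ₂(x) to Γ₁(x), and the parity of the incidences
-- between Γ₂(x) and Γ₃(x). Types II and III have the same block of `A`. Hence only the `E*` can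
-- separate them, and a root of θ² - 2 has one eigenvector in each of the six summands, which is the
-- multiplicity 6, while 3 and -3 occur in W₀ alone. Irreducibility is a negative statement, so an
-- invertible coordinate never has to be exhibited: a vector none of whose coordinates is invertible
-- is zero.

/1-+ : ∀ k l → (k ℤ.+ l) / 1 ≡ (k / 1) ℚ.+ (l / 1)
/1-+ k l = ℚ.toℚᵘ-injective (begin
  ℚ.toℚᵘ ((k ℤ.+ l) / 1)  ≈⟨ ℚ.toℚᵘ-fromℚᵘ (ℚᵘ.mkℚᵘ (k ℤ.+ l) 0) ⟩
  ℚᵘ.mkℚᵘ (k ℤ.+ l) 0
    ≡⟨ cong (λ i → ℚᵘ.mkℚᵘ i 0) (≡.cong₂ ℤ._+_ (ℤ.*-identityʳ k) (ℤ.*-identityʳ l)) ⟨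
  ℚᵘ.mkℚᵘ k 0 ℚᵘ.+ ℚᵘ.mkℚᵘ l 0
    ≈⟨ ℚᵘ.+-cong (ℚ.toℚᵘ-fromℚᵘ (ℚᵘ.mkℚᵘ k 0)) (ℚ.toℚᵘ-fromℚᵘ (ℚᵘ.mkℚᵘ l 0)) ⟨
  ℚ.toℚᵘ (k / 1) ℚᵘ.+ ℚ.toℚᵘ (l / 1)  ≈⟨ ℚ.toℚᵘ-homo-+ (k / 1) (l / 1) ⟨
  ℚ.toℚᵘ ((k / 1) ℚ.+ (l / 1))  ∎)
  where open ℚᵘ.≃-Reasoning

/1-* : ∀ k l → (k ℤ.* l) / 1 ≡ (k / 1) ℚ.* (l / 1)
/1-* k l = ℚ.toℚᵘ-injective (begin
  ℚ.toℚᵘ ((k ℤ.* l) / 1)  ≈⟨ ℚ.toℚᵘ-fromℚᵘ (ℚᵘ.mkℚᵘ (k ℤ.* l) 0) ⟩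
  ℚᵘ.mkℚᵘ k 0 ℚᵘ.* ℚᵘ.mkℚᵘ l 0
    ≈⟨ ℚᵘ.*-cong (ℚ.toℚᵘ-fromℚᵘ (ℚᵘ.mkℚᵘ k 0)) (ℚ.toℚᵘ-fromℚᵘ (ℚᵘ.mkℚᵘ l 0)) ⟨
  ℚ.toℚᵘ (k / 1) ℚᵘ.* ℚ.toℚᵘ (l / 1)  ≈⟨ ℚ.toℚᵘ-homo-* (k / 1) (l / 1) ⟨
  ℚ.toℚᵘ ((k / 1) ℚ.* (l / 1))  ∎)
  where open ℚᵘ.≃-Reasoning

/1-neg : ∀ k → (ℤ.- k) / 1 ≡ ℚ.- (k / 1)
/1-neg k = ℚ.toℚᵘ-injective (begin
  ℚ.toℚᵘ ((ℤ.- k) / 1)  ≈⟨ ℚ.toℚᵘ-fromℚᵘ (ℚᵘ.mkℚᵘ (ℤ.- k) 0) ⟩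
  ℚᵘ.- ℚᵘ.mkℚᵘ k 0  ≈⟨ ℚᵘ.-‿cong (ℚ.toℚᵘ-fromℚᵘ (ℚᵘ.mkℚᵘ k 0)) ⟨
  ℚᵘ.- ℚ.toℚᵘ (k / 1)  ≈⟨ ℚ.toℚᵘ-homo‿- (k / 1) ⟨
  ℚ.toℚᵘ (ℚ.- (k / 1))  ∎)
  where open ℚᵘ.≃-Reasoning

0<suc/1 : ∀ n → 0ℚ ℚ.< (+ suc n) / 1
0<suc/1 n = ℚ.toℚᵘ-cancel-< (ℚᵘ.<-respʳ-≃ (ℚᵘ.≃-sym (ℚ.toℚᵘ-fromℚᵘ (ℚᵘ.mkℚᵘ (+ suc n) 0)))
  (ℚᵘ.*<* (ℤ.+<+ (ℕ.s≤s ℕ.z≤n))))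

0≤n/1 : ∀ n → 0ℚ ℚ.≤ (+ n) / 1
0≤n/1 zero    = ℚ.≤-refl
0≤n/1 (suc n) = ℚ.<⇒≤ (0<suc/1 n)

suc/1 : ∀ n → (+ suc n) / 1 ≡ 1ℚ ℚ.+ (+ n) / 1
suc/1 n = /1-+ (+ 1) (+ n)

-- Estimates for rationals

module Rationals where
  open import Data.Rational.Base using (_+_; _*_; _-_; -_; ∣_∣; _<_; _≤_)
  open import Data.Rational.Solver
  open +-*-Solver
  open Rational
  open ℚ.≤-Reasoning

  *-monoˡ : ∀ {p q r} → 0ℚ ≤ r → p ≤ q → r * p ≤ r * q
  *-monoˡ {r = r} 0≤r = ℚ.*-monoˡ-≤-nonNeg r {{ℚ.nonNegative 0≤r}}

  *-monoʳ : ∀ {p q r} → 0ℚ ≤ r → p ≤ q → p * r ≤ q * r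
  *-monoʳ {r = r} 0≤r = ℚ.*-monoʳ-≤-nonNeg r {{ℚ.nonNegative 0≤r}}

  -- Write a = b - (b - a) and use b ≥ 2q. One approximation `b` of a Cauchy sequence thus bounds a
  -- whole tail from below.
  lower-bound : ∀ a b q → ∣ b - a ∣ < q → q + q ≤ b → q < a
  lower-bound a b q close q+q≤b = subst₂ _<_ (solve 1 (λ q → q :+ q :+ :- q :=
      q) refl q) (solve 2 (λ b a → b :+ :- (b :- a) := a) refl b a)
    (ℚ.+-mono-≤-< q+q≤b (ℚ.neg-antimono-< (ℚ.≤-<-trans (p≤∣p∣ (b - a)) close)))
    where
    p≤∣p∣ : ∀ p → p ≤ ∣ p ∣
    p≤∣p∣ p with ℚ.≤-total 0ℚ p
    ... | inj₁ 0≤p = ℚ.≤-reflexive (sym (ℚ.0≤p⇒∣p∣≡p 0≤p))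
    ... | inj₂ p≤0 = ℚ.≤-trans p≤0 (ℚ.0≤∣p∣ p)

  -- The witness is read off the representation of ε: multiplying by its denominator `suc d` leaves
  -- its numerator, a positive integer.
  archimedean : ∀ ε → 0ℚ < ε → ∃[ n ] 1ℚ ≤ ε * ((+ suc n) / 1)
  archimedean ε@(mkℚ -[1+ _ ] _ _) (ℚ.*<* ())
  archimedean ε@(mkℚ (+ zero) _ _) (ℚ.*<* (ℤ.+<+ ()))
  archimedean ε@(mkℚ (+ suc a) d _) 0<ε = d , ℚ.≤-trans 1≤ (ℚ.≤-reflexive (sym eq))
    where
    eq : ε * ((+ suc d) / 1) ≡ (+ suc a) / 1
    eq = ℚ.toℚᵘ-injective (ℚᵘ.≃-trans (ℚ.toℚᵘ-homo-* ε ((+ suc d) / 1))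
      (ℚᵘ.≃-trans (ℚᵘ.*-congˡ {ℚᵘ.mkℚᵘ (+ suc a) d} (ℚ.toℚᵘ-fromℚᵘ (ℚᵘ.mkℚᵘ (+ suc d) 0)))
        (ℚᵘ.≃-trans (ℚᵘ.*≡* (cong +_ (ℕ.*-assoc (suc a) (suc d) 1)))
          (ℚᵘ.≃-sym (ℚ.toℚᵘ-fromℚᵘ (ℚᵘ.mkℚᵘ (+ suc a) 0))))))
    1≤ : 1ℚ ≤ (+ suc a) / 1
    1≤ = subst₂ _≤_ (ℚ.+-identityʳ 1ℚ) (sym (suc/1 a)) (ℚ.+-monoʳ-≤ 1ℚ (0≤n/1 a))

-- Sign, comparison and inversion of Cauchy reals

module Reals where
  open ℝ
  open Real
  open Rational
  open Rationals

  private
    left : ∀ {m n o} → m ⊔ n ℕ.≤ o → m ℕ.≤ o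
    left {m} {n} = ℕ.m⊔n≤o⇒m≤o m n

    right : ∀ {m n o} → m ⊔ n ℕ.≤ o → n ℕ.≤ o
    right {m} {n} = ℕ.m⊔n≤o⇒n≤o m n

  -- Let `q` be ε/4 and `seq x N` an approximation up to `q`. If it were at least ε/2 = 2q, or at
  -- most -ε/2, then `lower-bound` would make `x` or `- x` positive. Comparison in ℚ is decidable,
  -- so the two negations give |`seq x N`| < ε/2, and the tail stays below ε.
  null-or-apart : (x : ℝ) → ¬ Positive x → ¬ Positive (- x) → x ≈ 0ℝ
  null-or-apart x ¬0<x ¬0<-x = mk≈ λ ε 0<ε →
    let q = half (half ε)
        0<q = 0<half (0<half 0<ε)
        N , close = cauchy x q 0<q
        <ε : ∀ {n} → N ℕ.≤ n → ℚ.∣ seq x n ℚ.- 0ℚ ∣ ℚ.< ε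
        <ε {n} N≤n = triangle (seq x n) (seq x N) 0ℚ
          (ℚ.<-trans (close N≤n ℕ.≤-refl) (half< (0<half 0<ε)))
          (subst (ℚ._< half ε) (cong ℚ.∣_∣ (sym (ℚ.+-identityʳ (seq x N))))
            (∣∣< (seq x N) (half ε)
              (ℚ.≰⇒> λ h≤ → ¬0<x (q , 0<q , N , λ {n} N≤n →
                lower-bound (seq x n) (seq x N) q (close ℕ.≤-refl N≤n)
                  (subst (ℚ._≤ seq x N) (sym (half+half (half ε))) h≤)))
              (ℚ.≰⇒> λ h≤ → ¬0<-x (q , 0<q , N , λ {n} N≤n →
                lower-bound (ℚ.- seq x n) (ℚ.- seq x N) q
                  (subst (ℚ._< q) (negate-difference (seq x N) (seq x n)) (close ℕ.≤-refl N≤n))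
                  (subst (ℚ._≤ ℚ.- seq x N) (sym (half+half (half ε))) h≤)))))
    in N , <ε
    where
    half< : ∀ {ε} → 0ℚ ℚ.< ε → half ε ℚ.< ε
    half< {ε} 0<ε = subst₂ ℚ._<_ (ℚ.+-identityʳ (half ε)) (half+half ε)
      (ℚ.+-monoʳ-< (half ε) (0<half 0<ε))
    ∣∣< : ∀ p h → p ℚ.< h → ℚ.- p ℚ.< h → ℚ.∣ p ∣ ℚ.< h
    ∣∣< p h p<h -p<h with ℚ.∣p∣≡p∨∣p∣≡-p p
    ... | inj₁ eq = subst (ℚ._< h) (sym eq) p<h
    ... | inj₂ eq = subst (ℚ._< h) (sym eq) -p<h

  -- The constructive substitute for comparing with a point: an approximation up to 1/4 is compared
  -- with 1/2, and since the alternatives overlap on (0, 1) the error does no harm.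
  positive-or-below-1 : (x : ℝ) → Positive x ⊎ Positive (1ℝ + - x)
  positive-or-below-1 x = go
    where
    ¼ : ℚ
    ¼ = half ½
    0<¼ : 0ℚ ℚ.< ¼
    0<¼ = ℚ.positive⁻¹ ¼
    N = proj₁ (cauchy x ¼ 0<¼)
    close = proj₂ (cauchy x ¼ 0<¼)
    shift : ∀ a b → ℚ.∣ a ℚ.- b ∣ ≡ ℚ.∣ (1ℚ ℚ.+ ℚ.- a) ℚ.- (1ℚ ℚ.+ ℚ.- b) ∣
    shift a b = ≡.trans (∣-∣-sym a b) (cong ℚ.∣_∣ (solve 2 (λ a b → b :- a :=
        (con 1ℚ :+ :- a) :- (con 1ℚ :+ :- b)) refl a b))
      where
      open import Data.Rational.Solver
      open +-*-Solver
    go : Positive x ⊎ Positive (1ℝ + - x)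
    go with ½ ℚ.≤? seq x N
    ... | yes ½≤ = inj₁ (¼ , 0<¼ , N , λ {n} N≤n →
      lower-bound (seq x n) (seq x N) ¼ (close ℕ.≤-refl N≤n) ½≤)
    ... | no ½≰ = inj₂ (¼ , 0<¼ , N , λ {n} N≤n →
      lower-bound (1ℚ ℚ.+ ℚ.- seq x n) (1ℚ ℚ.+ ℚ.- seq x N) ¼
        (subst (ℚ._< ¼) (shift (seq x N) (seq x n)) (close ℕ.≤-refl N≤n))
        (ℚ.+-monoʳ-≤ 1ℚ (ℚ.neg-antimono-≤ (ℚ.<⇒≤ (ℚ.≰⇒> ½≰)))))

  Positive-fromℚ : ∀ {q} → 0ℚ ℚ.< q → Positive (fromℚ q)
  Positive-fromℚ 0<q = let p , 0<p , p<q = ℚ.<-dense 0<q in p , 0<p , 0 , λ _ → p<q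

  Positive-square : ∀ {x} → Positive x → Positive (x * x)
  Positive-square {x} (ε , 0<ε , N , ε<) = ε ℚ.* ε , 0<* 0<ε 0<ε , N , λ {n} N≤n →
    ℚ.<-trans (ℚ.*-monoʳ-<-pos ε {{ℚ.positive 0<ε}} (ε< N≤n))
      (ℚ.*-monoˡ-<-pos (seq x n) {{ℚ.positive (ℚ.<-trans 0<ε (ε< N≤n))}} (ε< N≤n))

  Positive-resp-≈ : ∀ {x y} → x ≈ y → Positive x → Positive y
  Positive-resp-≈ {x} {y} x≈y (ε , 0<ε , N , ε<) =
    let h = half ε
        0<h = 0<half 0<ε
        M , close = null x≈y h 0<h
    in h , 0<h , N ⊔ M , λ {n} n≥ → lower-bound (seq y n) (seq x n) h (close (right {N} n≥))
      (subst (ℚ._≤ seq x n) (sym (half+half ε)) (ℚ.<⇒≤ (ε< (left n≥))))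

  Positive-+-square : ∀ {x} y → Positive x → Positive (x + y * y)
  Positive-+-square {x} y (ε , 0<ε , N , ε<) = ε , 0<ε , N , λ {n} N≤n →
    subst (ℚ._< seq x n ℚ.+ seq y n ℚ.* seq y n) (ℚ.+-identityʳ ε)
      (ℚ.+-mono-<-≤ (ε< N≤n) (0≤square (seq y n)))
    where
    0≤square : ∀ p → 0ℚ ℚ.≤ p ℚ.* p
    0≤square p with ℚ.≤-total 0ℚ p
    ... | inj₁ 0≤p = subst (ℚ._≤ p ℚ.* p) (ℚ.*-zeroʳ p) (*-monoˡ 0≤p 0≤p)
    ... | inj₂ p≤0 = subst₂ ℚ._≤_ (ℚ.*-zeroʳ p) refl
      (ℚ.*-monoˡ-≤-nonPos p {{ℚ.nonPositive p≤0}} p≤0)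

  positive-invertible : ∀ {x} → Positive x → ∃[ y ] y * x ≈ 1ℝ
  positive-invertible {x} (ε , 0<ε , N , ε<) = y , mk≈ λ δ 0<δ → N , λ {n} N≤n →
    subst (λ p → ℚ.∣ p ℚ.- 1ℚ ∣ ℚ.< δ) (sym (proj₂ (y-inverse (ε< N≤n)))) 0<δ
    where
    c = proj₁ (inverse 0<ε)
    0<c = proj₁ (proj₂ (inverse 0<ε))
    cε≡1 = proj₂ (proj₂ (inverse 0<ε))
    reciprocal : ℚ → ℚ
    reciprocal p with ε ℚ.<? p
    ... | yes ε<p = proj₁ (inverse (ℚ.<-trans 0<ε ε<p))
    -- A default for terms before index `N` that are not above ε; all estimates below concern later
    -- terms.
    ... | no _    = 0ℚ
    y-inverse : ∀ {p} → ε ℚ.< p → 0ℚ ℚ.< reciprocal p × reciprocal p ℚ.* p ≡ 1ℚ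
    y-inverse {p} ε<p with ε ℚ.<? p
    ... | yes ε<p′ = proj₂ (inverse (ℚ.<-trans 0<ε ε<p′))
    ... | no ε≮p   = contradiction ε<p ε≮p
    reciprocal≤c : ∀ {p} → ε ℚ.< p → reciprocal p ℚ.≤ c
    reciprocal≤c {p} ε<p = begin
      r  ≡⟨ ≡.trans (cong (r ℚ.*_) cε≡1) (ℚ.*-identityʳ r) ⟨
      r ℚ.* (c ℚ.* ε)  ≤⟨ *-monoˡ (ℚ.<⇒≤ 0<r) (*-monoˡ (ℚ.<⇒≤ 0<c) (ℚ.<⇒≤ ε<p)) ⟩
      r ℚ.* (c ℚ.* p)  ≡⟨ swap r c p ⟩
      c ℚ.* (r ℚ.* p)  ≡⟨ ≡.trans (cong (c ℚ.*_) (proj₂ (y-inverse ε<p))) (ℚ.*-identityʳ c) ⟩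
      c  ∎
      where
      open ℚ.≤-Reasoning
      open import Data.Rational.Solver
      open +-*-Solver
      r = reciprocal p
      0<r = proj₁ (y-inverse ε<p)
      swap : ∀ r c p → r ℚ.* (c ℚ.* p) ≡ c ℚ.* (r ℚ.* p)
      swap = solve 3 (λ r c p → r :* (c :* p) := c :* (r :* p)) refl
    difference : ∀ {p q} → ε ℚ.< p → ε ℚ.< q →
      reciprocal p ℚ.- reciprocal q ≡ (p ℚ.- q) ℚ.* ℚ.- (reciprocal p ℚ.* reciprocal q)
    difference {p} {q} ε<p ε<q = ≡.trans
      (cong₂ ℚ._-_ (one r s q (proj₂ (y-inverse ε<q))) (one s r p (proj₂ (y-inverse ε<p))))
      (solve 4 (λ p q r s → r :* (s :* q) :- s :* (r :* p) := (p :- q) :* :- (r :* s)) refl p q r s)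
      where
      open import Data.Rational.Solver
      open +-*-Solver
      r = reciprocal p
      s = reciprocal q
      one : ∀ r s q → s ℚ.* q ≡ 1ℚ → r ≡ r ℚ.* (s ℚ.* q)
      one r s q eq = ≡.trans (sym (ℚ.*-identityʳ r)) (cong (r ℚ.*_) (sym eq))
    y : ℝ
    y .seq n = reciprocal (seq x n)
    y .cauchy δ 0<δ =
      -- From |1/p - 1/q| = |p - q| · 1/(pq) and 1/(pq) ≤ 1/ε²: terms that are δε²-close have
      -- δ-close reciprocals.
      let M , close = cauchy x (δ ℚ.* (ε ℚ.* ε)) (0<* 0<δ (0<* 0<ε 0<ε))
      in N ⊔ M , λ {m} {n} m≥ n≥ →
        let ε<p = ε< (left m≥)
            ε<q = ε< (left n≥)
            r = reciprocal (seq x m)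
            s = reciprocal (seq x n)
            0<r = proj₁ (y-inverse ε<p)
            0<s = proj₁ (y-inverse ε<q)
        in subst (λ d → ℚ.∣ d ∣ ℚ.< δ) (sym (difference ε<p ε<q))
          (∣*∣<ε (seq x m ℚ.- seq x n) (ℚ.- (r ℚ.* s)) {b = c ℚ.* c} {c = ε ℚ.* ε}
            (0<* 0<c 0<c)
            (≡.trans (regroup ε c) (cong₂ ℚ._*_ cε≡1 cε≡1))
            (close (right {N} m≥) (right {N} n≥))
            (subst (ℚ._≤ c ℚ.* c)
              (≡.trans (sym (ℚ.0≤p⇒∣p∣≡p (ℚ.<⇒≤ (0<* 0<r 0<s)))) (sym (ℚ.∣-p∣≡∣p∣ (r ℚ.* s))))
              (ℚ.≤-trans (*-monoˡ (ℚ.<⇒≤ 0<r) (reciprocal≤c ε<q))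
                (*-monoʳ (ℚ.<⇒≤ 0<c) (reciprocal≤c ε<p)))))
      where
      open import Data.Rational.Solver
      open +-*-Solver
      regroup : ∀ ε c → ε ℚ.* ε ℚ.* (c ℚ.* c) ≡ (c ℚ.* ε) ℚ.* (c ℚ.* ε)
      regroup = solve 2 (λ ε c → ε :* ε :* (c :* c) := (c :* ε) :* (c :* ε)) refl

-- The square root of 2

-- s ↦ 1 + 1/(1 + s) has fixed point √2 and at least halves the error |s² − 2| when s ≥ 1.
module SquareRootOf2 where
  open import Data.Rational.Base using (_+_; _*_; _-_; -_; ∣_∣; _<_; _≤_)
  open Rational
  open Rationals
  open import Data.Rational.Solver
  open +-*-Solver

  2ℚ : ℚ
  2ℚ = + 2 / 1

  error : ℚ → ℚ
  error s = ∣ s * s - 2ℚ ∣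

  private
    0<1+ : ∀ {s} → 1ℚ ≤ s → 0ℚ < 1ℚ + s
    0<1+ 1≤s = ℚ.+-mono-<-≤ (ℚ.positive⁻¹ 1ℚ) (ℚ.≤-trans (ℚ.<⇒≤ (ℚ.positive⁻¹ 1ℚ)) 1≤s)

  improve : ∀ {s} → 1ℚ ≤ s → ∃[ t ] 1ℚ ≤ t × error t ≤ half (error s)
  improve {s} 1≤s =
    1ℚ + c ,
    subst (_≤ 1ℚ + c) (ℚ.+-identityʳ 1ℚ) (ℚ.+-monoʳ-≤ 1ℚ (ℚ.<⇒≤ 0<c)) ,
    subst (_≤ half (error s)) (sym (≡.trans (cong ∣_∣ identity) error≡))
      (*-monoʳ (ℚ.0≤∣p∣ (s * s - 2ℚ)) cc≤½)
    where
    c = proj₁ (inverse (0<1+ 1≤s))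
    0<c = proj₁ (proj₂ (inverse (0<1+ 1≤s)))
    c[1+s]≡1 = proj₂ (proj₂ (inverse (0<1+ 1≤s)))
    open ℚ.≤-Reasoning
    c≤½ : c ≤ ½
    c≤½ = begin
      c  ≡⟨ two-halves c ⟩
      ½ * (c * (1ℚ + 1ℚ))  ≤⟨ *-monoˡ (ℚ.<⇒≤ (ℚ.positive⁻¹ ½)) (*-monoˡ (ℚ.<⇒≤ 0<c) (ℚ.+-monoʳ-≤ 1ℚ 1≤s)) ⟩
      ½ * (c * (1ℚ + s))  ≡⟨ cong (½ *_) c[1+s]≡1 ⟩
      ½ * 1ℚ  ≡⟨⟩
      ½  ∎
      where
      two-halves : ∀ c → c ≡ ½ * (c * (1ℚ + 1ℚ))
      two-halves = solve 1 (λ c → c := con ½ :* (c :* (con 1ℚ :+ con 1ℚ))) refl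
    cc≤½ : c * c ≤ ½
    cc≤½ = begin
      c * c  ≤⟨ *-monoˡ (ℚ.<⇒≤ 0<c) (ℚ.≤-trans c≤½ (ℚ.*≤* (ℤ.+≤+ (ℕ.s≤s ℕ.z≤n)))) ⟩
      c * 1ℚ  ≡⟨ ℚ.*-identityʳ c ⟩
      c  ≤⟨ c≤½ ⟩
      ½  ∎
    -- The hypothesis c(1 + s) = 1 appears as a factor c(1 + s) - 1 of the error term, so this is a
    -- plain ring identity and the term vanishes afterwards.
    expand : ∀ c s → (1ℚ + c) * (1ℚ + c) - 2ℚ ≡
      - (c * c * (s * s - 2ℚ)) + (c * (1ℚ + s) - 1ℚ) * (c * s - c + 1ℚ)
    expand = solve 2 (λ c s → (con 1ℚ :+ c) :* (con 1ℚ :+ c) :- con 2ℚ :=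
      :- (c :* c :* (s :* s :- con 2ℚ)) :+ (c :* (con 1ℚ :+ s) :- con 1ℚ) :* (c :* s :- c :+ con 1ℚ)) refl
    identity : (1ℚ + c) * (1ℚ + c) - 2ℚ ≡ - (c * c * (s * s - 2ℚ))
    identity = ≡.trans (expand c s) (≡.trans
      (cong (λ z → - (c * c * (s * s - 2ℚ)) + (z - 1ℚ) * (c * s - c + 1ℚ)) c[1+s]≡1)
      (≡.trans (cong (λ z → - (c * c * (s * s - 2ℚ)) + z) (ℚ.*-zeroˡ (c * s - c + 1ℚ)))
        (ℚ.+-identityʳ _)))
    error≡ : ∣ - (c * c * (s * s - 2ℚ)) ∣ ≡ c * c * error s
    error≡ = ≡.trans (ℚ.∣-p∣≡∣p∣ (c * c * (s * s - 2ℚ))) (≡.trans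
      (ℚ.∣p*q∣≡∣p∣*∣q∣ (c * c) (s * s - 2ℚ))
      (cong (_* error s) (ℚ.0≤p⇒∣p∣≡p (ℚ.<⇒≤ (0<* 0<c 0<c)))))

  approximation : ℕ → ∃[ s ] 1ℚ ≤ s
  approximation zero    = 1ℚ , ℚ.≤-refl
  approximation (suc n) = let t , 1≤t , _ = improve (proj₂ (approximation n)) in t , 1≤t

  s : ℕ → ℚ
  s n = proj₁ (approximation n)

  1≤s : ∀ n → 1ℚ ≤ s n
  1≤s n = proj₂ (approximation n)

  -- Halving outweighs the growth from 1 + n to 2 + n, as 2 + n ≤ 2(1 + n). The resulting bound 1/(1
  -- + n) is weaker than geometric decay but combines directly with `archimedean`.
  error-bound : ∀ n → error (s n) * (1ℚ + (+ n) / 1) ≤ 1ℚ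
  error-bound zero    = ℚ.≤-refl
  error-bound (suc n) = begin
    error (s (suc n)) * (1ℚ + (+ suc n) / 1)
      ≤⟨ *-monoʳ (ℚ.+-mono-≤ 0≤1 (0≤n/1 (suc n))) (proj₂ (proj₂ (improve (1≤s n)))) ⟩
    half e * (1ℚ + (+ suc n) / 1)  ≡⟨ cong (λ z → half e * (1ℚ + z)) (suc/1 n) ⟩
    half e * (1ℚ + (1ℚ + ν))  ≤⟨ *-monoˡ (*-monoˡ (ℚ.<⇒≤ (ℚ.positive⁻¹ ½)) (ℚ.0≤∣p∣ (s n * s n - 2ℚ)))
        (ℚ.+-monoʳ-≤ 1ℚ (ℚ.+-monoʳ-≤ 1ℚ (subst (_≤ ν + ν) (ℚ.+-identityʳ ν) (ℚ.+-monoʳ-≤ ν (0≤n/1 n))))) ⟩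
    half e * (1ℚ + (1ℚ + (ν + ν)))  ≡⟨ double e ν ⟩
    e * (1ℚ + ν)  ≤⟨ error-bound n ⟩
    1ℚ  ∎
    where
    open ℚ.≤-Reasoning
    e = error (s n)
    ν = (+ n) / 1
    0≤1 : 0ℚ ≤ 1ℚ
    0≤1 = ℚ.<⇒≤ (ℚ.positive⁻¹ 1ℚ)
    double : ∀ e ν → ½ * e * (1ℚ + (1ℚ + (ν + ν))) ≡ e * (1ℚ + ν)
    double = solve 2 (λ e ν → con ½ :* e :* (con 1ℚ :+ (con 1ℚ :+ (ν :+ ν))) := e :* (con 1ℚ :+ ν)) refl

  n/1-mono : ∀ {m n} → m ℕ.≤ n → (+ m) / 1 ≤ (+ n) / 1
  n/1-mono {m} {n} m≤n = subst₂ _≤_ (ℚ.+-identityʳ _) (sym eq) (ℚ.+-monoʳ-≤ ((+ m) / 1) (0≤n/1 (n ℕ.∸ m)))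
    where
    eq : (+ n) / 1 ≡ (+ m) / 1 + (+ (n ℕ.∸ m)) / 1
    eq = ≡.trans (cong (λ k → (+ k) / 1) (sym (ℕ.m+[n∸m]≡n m≤n))) (/1-+ (+ m) (+ (n ℕ.∸ m)))

  error-null : ∀ ε → 0ℚ < ε → ∃[ N ] ∀ {n} → N ℕ.≤ n → error (s n) < ε
  error-null ε 0<ε = let N , 1≤ = archimedean ε 0<ε in suc N , λ {n} N<n →
    ℚ.*-cancelʳ-<-nonNeg (1ℚ + (+ n) / 1)
      {{ℚ.nonNegative (ℚ.+-mono-≤ (ℚ.<⇒≤ (ℚ.positive⁻¹ 1ℚ)) (0≤n/1 n))}}
      (ℚ.≤-<-trans (error-bound n) (ℚ.≤-<-trans 1≤ (ℚ.*-monoʳ-<-pos ε {{ℚ.positive 0<ε}}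
        (ℚ.≤-<-trans (n/1-mono N<n) (subst (_< 1ℚ + (+ n) / 1) (ℚ.+-identityˡ _)
          (ℚ.+-monoˡ-< ((+ n) / 1) (ℚ.positive⁻¹ 1ℚ)))))))

  -- |s − t| ≤ |s² − t²| as s + t ≥ 1.
  close-if-squares-close : ∀ {s t ε} → 1ℚ ≤ s → 1ℚ ≤ t →
    error s < half ε → error t < half ε → ∣ s - t ∣ < ε
  close-if-squares-close {s} {t} {ε} 1≤s 1≤t s< t< = ℚ.≤-<-trans (begin
    ∣ s - t ∣  ≡⟨ ℚ.*-identityʳ _ ⟨
    ∣ s - t ∣ * 1ℚ  ≤⟨ *-monoˡ (ℚ.0≤∣p∣ (s - t)) 1≤s+t ⟩
    ∣ s - t ∣ * (s + t)  ≡⟨ cong (∣ s - t ∣ *_) (ℚ.0≤p⇒∣p∣≡p (ℚ.≤-trans 0≤1 1≤s+t)) ⟨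
    ∣ s - t ∣ * ∣ s + t ∣  ≡⟨ ℚ.∣p*q∣≡∣p∣*∣q∣ (s - t) (s + t) ⟨
    ∣ (s - t) * (s + t) ∣  ≡⟨ cong ∣_∣ (squares s t) ⟩
    ∣ s * s - t * t ∣  ∎)
    (triangle (s * s) 2ℚ (t * t) s< (subst (_< half ε) (∣-∣-sym (t * t) 2ℚ) t<))
    where
    open ℚ.≤-Reasoning
    0≤1 : 0ℚ ≤ 1ℚ
    0≤1 = ℚ.<⇒≤ (ℚ.positive⁻¹ 1ℚ)
    1≤s+t : 1ℚ ≤ s + t
    1≤s+t = subst (_≤ s + t) (ℚ.+-identityʳ 1ℚ) (ℚ.+-mono-≤ 1≤s (ℚ.≤-trans 0≤1 1≤t))
    squares : ∀ s t → (s - t) * (s + t) ≡ s * s - t * t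
    squares = solve 2 (λ s t → (s :- t) :* (s :+ t) := s :* s :- t :* t) refl

  √2 : ℝ
  √2 .ℝ.seq = s
  √2 .ℝ.cauchy ε 0<ε = let N , small = error-null (half ε) (0<half 0<ε) in
    N , λ {m} {n} m≥ n≥ → close-if-squares-close (1≤s m) (1≤s n) (small m≥) (small n≥)

  √2-positive : Real.Positive √2
  √2-positive = ½ , ℚ.positive⁻¹ ½ , 0 , λ {n} _ →
    ℚ.<-≤-trans (ℚ.*<* (ℤ.+<+ (ℕ.s≤s (ℕ.s≤s ℕ.z≤n)))) (1≤s n)

  √2²≈2 : √2 Real.* √2 Real.≈ Real.fromℚ 2ℚ
  √2²≈2 = Real.mk≈ error-null

-- Complex scalars: integers, invertibility, vanishing products

module K = CommutativeRing Complex.commutativeRing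

module Scalars where
  open ℂ
  open Complex using (_≈_; mk≈; re≈; im≈; _+_; _*_; -_; 0ℂ; 1ℂ; conj; fromℝ)
  open K using (_-_)
  open import Relation.Binary.Reasoning.Setoid K.setoid
  private
    module R = CommutativeRing Real.commutativeRing

  ≡⇒≈ : ∀ {z w} → z ≡ w → z ≈ w
  ≡⇒≈ refl = K.refl

  ι : ℤ → ℂ
  ι = Complex.fromℤ

  ι-+ : ∀ k l → ι (k ℤ.+ l) ≈ ι k + ι l
  ι-+ k l = mk≈ (Real.pointwise λ _ → /1-+ k l) (Real.pointwise λ _ → refl)

  ι-* : ∀ k l → ι (k ℤ.* l) ≈ ι k * ι l
  ι-* k l = mk≈
    (Real.pointwise λ _ → ≡.trans (/1-* k l) (sym (ℚ.+-identityʳ _)))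
    (Real.pointwise λ _ → sym (≡.trans (cong₂ ℚ._+_ (ℚ.*-zeroʳ (k / 1)) (ℚ.*-zeroˡ (l / 1))) (ℚ.+-identityˡ 0ℚ)))

  ι-neg : ∀ k → ι (ℤ.- k) ≈ - ι k
  ι-neg k = mk≈ (Real.pointwise λ _ → /1-neg k) (Real.pointwise λ _ → refl)

  ι-0 : ι (+ 0) ≈ 0ℂ
  ι-0 = mk≈ (Real.pointwise λ _ → refl) (Real.pointwise λ _ → refl)

  ι-1 : ι (+ 1) ≈ 1ℂ
  ι-1 = mk≈ (Real.pointwise λ _ → refl) (Real.pointwise λ _ → refl)

  conj-ι : ∀ k → conj (ι k) ≈ ι k
  conj-ι k = mk≈ (Real.pointwise λ _ → refl) (Real.pointwise λ _ → refl)

  conj-0 : conj 0ℂ ≈ 0ℂ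
  conj-0 = mk≈ (Real.pointwise λ _ → refl) (Real.pointwise λ _ → refl)

  conj-cong : ∀ {z w} → z ≈ w → conj z ≈ conj w
  conj-cong (mk≈ p q) = mk≈ p (R.-‿cong q)

  conj-+ : ∀ z w → conj (z + w) ≈ conj z + conj w
  conj-+ z w = mk≈ R.refl
    (Real.pointwise λ n → ℚ.neg-distrib-+ (ℝ.seq (im z) n) (ℝ.seq (im w) n))

  conj-* : ∀ z w → conj (z * w) ≈ conj z * conj w
  conj-* z w = mk≈
    (Real.pointwise λ n → solve 4 (λ a b c d → a :* c :- b :* d :=
        a :* c :- (:- b) :* (:- d)) refl (ℝ.seq (re z) n) (ℝ.seq (im z) n) (ℝ.seq (re w) n) (ℝ.seq (im w) n))
    (Real.pointwise λ n → solve 4 (λ a b c d → :- (a :* d :+ b :* c) :=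
        a :* (:- d) :+ (:- b) :* c) refl (ℝ.seq (re z) n) (ℝ.seq (im z) n) (ℝ.seq (re w) n) (ℝ.seq (im w) n))
    where
    open import Data.Rational.Solver
    open +-*-Solver

  ℤ-rawRing : RawRing _ _
  ℤ-rawRing = CommutativeRing.rawRing ℤ.+-*-commutativeRing

  ι-morphism : ℤ-rawRing ACR.-Raw-AlmostCommutative⟶ ACR.fromCommutativeRing Complex.commutativeRing
  ι-morphism = record
    { ⟦_⟧    = ι
    ; +-homo = ι-+
    ; *-homo = ι-*
    ; -‿homo = ι-neg
    ; 0-homo = ι-0
    ; 1-homo = ι-1
    }

  ι-≟ : ∀ k l → Maybe (ι k ≈ ι l)
  ι-≟ k l with k ℤ.≟ l
  ... | yes k≡l = just (≡⇒≈ (cong ι k≡l))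
  ... | no _    = nothing

  -- Coefficients are integers, because normalisation compares constants and equality on ℂ cannot be
  -- tested.
  module Solver =
    RingSolver ℤ-rawRing (ACR.fromCommutativeRing Complex.commutativeRing) ι-morphism ι-≟

  Invertible : ℂ → Set
  Invertible z = ∃[ w ] w * z ≈ 1ℂ

  private
    ∣_∣² : ℂ → ℝ
    ∣ z ∣² = re z R.* re z R.+ im z R.* im z

    conj-inverse : ∀ z → Real.Positive ∣ z ∣² → Invertible z
    conj-inverse z 0<r =
      let y , yr≈1 = Reals.positive-invertible 0<r
      in fromℝ y * conj z , (begin
        fromℝ y * conj z * z  ≈⟨ K.*-assoc (fromℝ y) (conj z) z ⟩
        fromℝ y * (conj z * z)  ≈⟨ K.*-congˡ (mk≈
          (Real.pointwise λ n → solve 2 (λ a b → a :* a :- (:- b) :* b :=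
              a :* a :+ b :* b) refl (ℝ.seq (re z) n) (ℝ.seq (im z) n))
          (Real.pointwise λ n → solve 2 (λ a b → a :* b :+ (:- b) :* a :=
              con 0ℚ) refl (ℝ.seq (re z) n) (ℝ.seq (im z) n))) ⟩
        fromℝ y * fromℝ ∣ z ∣²  ≈⟨ mk≈
          (Real.pointwise λ n → solve 2 (λ a b → a :* b :- con 0ℚ :* con 0ℚ :=
              a :* b) refl (ℝ.seq y n) (ℝ.seq ∣ z ∣² n))
          (Real.pointwise λ n → solve 2 (λ a b → a :* con 0ℚ :+ con 0ℚ :* b :=
              con 0ℚ) refl (ℝ.seq y n) (ℝ.seq ∣ z ∣² n)) ⟩
        fromℝ (y R.* ∣ z ∣²)  ≈⟨ mk≈ yr≈1 R.refl ⟩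
        1ℂ  ∎)
      where
      open import Data.Rational.Solver
      open +-*-Solver

  re-positive⇒invertible : ∀ {z} → Real.Positive (re z) → Invertible z
  re-positive⇒invertible {z} 0<re = conj-inverse z
    (Reals.Positive-+-square {re z R.* re z} (im z) (Reals.Positive-square {re z} 0<re))

  im-positive⇒invertible : ∀ {z} → Real.Positive (im z) → Invertible z
  im-positive⇒invertible {z} 0<im = conj-inverse z
    (Reals.Positive-resp-≈ (R.+-comm (im z R.* im z) (re z R.* re z))
      (Reals.Positive-+-square {im z R.* im z} (re z) (Reals.Positive-square {im z} 0<im)))

  neg-invertible : ∀ {z} → Invertible (- z) → Invertible z
  neg-invertible {z} (w , eq) = - w , K.trans (solve 2 (λ w z → :- w :* z := w :* :- z) K.refl w z) eq
    where
    open Solver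

  invertible-resp-≈ : ∀ {z w} → z ≈ w → Invertible z → Invertible w
  invertible-resp-≈ z≈w (v , eq) = v , K.trans (K.*-congˡ (K.sym z≈w)) eq

  -- A part of `z` that is positive or negative makes |z|² positive and `z` invertible, so neither
  -- part has a sign and `null-or-apart` applies. This is how claims `z ≈ 0ℂ` are later reached from
  -- contradictions.
  null-or-invertible : ∀ z → ¬ Invertible z → z ≈ 0ℂ
  null-or-invertible z ¬inv = mk≈
    (Reals.null-or-apart (re z) (λ p → ¬inv (re-positive⇒invertible p))
      (λ p → ¬inv (neg-invertible (re-positive⇒invertible p))))
    (Reals.null-or-apart (im z) (λ p → ¬inv (im-positive⇒invertible p))
      (λ p → ¬inv (neg-invertible (im-positive⇒invertible p))))

  cancel : ∀ {z} w → Invertible z → z * w ≈ 0ℂ → w ≈ 0ℂ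
  cancel {z} w (v , vz≈1) zw≈0 = begin
    w  ≈⟨ K.*-identityˡ w ⟨
    1ℂ * w  ≈⟨ K.*-congʳ vz≈1 ⟨
    v * z * w  ≈⟨ K.*-assoc v z w ⟩
    v * (z * w)  ≈⟨ K.*-congˡ zw≈0 ⟩
    v * 0ℂ  ≈⟨ K.zeroʳ v ⟩
    0ℂ  ∎

  1≉0 : ¬ (1ℂ ≈ 0ℂ)
  1≉0 (mk≈ 1≈0 _) = let N , small = Real.null 1≈0 1ℚ (ℚ.positive⁻¹ 1ℚ) in
    ℚ.<-irrefl refl (small (ℕ.≤-refl {N}))

  ι-positive : ∀ n → Invertible (ι (+ suc n))
  ι-positive n = re-positive⇒invertible (Reals.Positive-fromℚ (0<suc/1 n))

  ι-nonzero : ∀ {k} → k ≢ + 0 → Invertible (ι k)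
  ι-nonzero {+ zero}     k≢0 = contradiction refl k≢0
  ι-nonzero {+ suc n}    _   = ι-positive n
  ι-nonzero { -[1+ n ]}  _   = neg-invertible (invertible-resp-≈ (ι-neg -[1+ n ]) (ι-positive n))

  invertible⇒≉0 : ∀ {z} → Invertible z → ¬ (z ≈ 0ℂ)
  invertible⇒≉0 {z} (w , wz≈1) z≈0 = 1≉0 (K.trans (K.sym wz≈1)
    (K.trans (K.*-congˡ z≈0) (K.zeroʳ w)))

  *-invertible : ∀ {z w} → Invertible z → Invertible w → Invertible (z * w)
  *-invertible {z} {w} (z′ , p) (w′ , q) = z′ * w′ , (begin
    z′ * w′ * (z * w)
      ≈⟨ solve 4 (λ z z′ w w′ → z′ :* w′ :* (z :* w) := (z′ :* z) :* (w′ :* w)) K.refl z z′ w w′ ⟩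
    (z′ * z) * (w′ * w)  ≈⟨ K.*-cong p q ⟩
    1ℂ * 1ℂ  ≈⟨ K.*-identityˡ 1ℂ ⟩
    1ℂ  ∎)
    where
    open Solver

  -- Either Re e > 0 or Re (1 - e) > 0 can be found; the factor concerned is invertible and cancels.
  idempotent-trivial : ∀ {e} → e * (1ℂ - e) ≈ 0ℂ → e ≈ 0ℂ ⊎ 1ℂ - e ≈ 0ℂ
  idempotent-trivial {e} eq with Reals.positive-or-below-1 (re e)
  ... | inj₁ 0<e   = inj₂ (cancel (1ℂ - e) (re-positive⇒invertible 0<e) eq)
  ... | inj₂ 0<1-e = inj₁ (cancel e (re-positive⇒invertible 0<1-e)
    (K.trans (K.*-comm (1ℂ - e) e) eq))

  -- With k(z − w) = 1, the number kz is idempotent, and idempotents can be decided to be 0 or 1.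
  zero-product : ∀ {z w} → Invertible (z - w) → z * w ≈ 0ℂ → z ≈ 0ℂ ⊎ w ≈ 0ℂ
  zero-product {z} {w} (k , eq) zw≈0 = split (idempotent-trivial idempotent)
    where
    open Solver
    1-kz : 1ℂ - k * z ≈ - (k * w)
    1-kz = begin
      1ℂ - k * z  ≈⟨ K.+-congʳ eq ⟨
      k * (z - w) - k * z  ≈⟨ solve 3 (λ k z w → k :* (z :- w) :- k :* z := :- (k :* w)) K.refl k z w ⟩
      - (k * w)  ∎
    idempotent : k * z * (1ℂ - k * z) ≈ 0ℂ
    idempotent = begin
      k * z * (1ℂ - k * z)  ≈⟨ K.*-congˡ 1-kz ⟩
      k * z * - (k * w)
        ≈⟨ solve 3 (λ k z w → k :* z :* :- (k :* w) := :- (k :* k) :* (z :* w)) K.refl k z w ⟩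
      - (k * k) * (z * w)  ≈⟨ K.*-congˡ zw≈0 ⟩
      - (k * k) * 0ℂ  ≈⟨ K.zeroʳ _ ⟩
      0ℂ  ∎
    absorb : ∀ v → k * v ≈ 0ℂ → v ≈ 0ℂ
    absorb v kv≈0 = cancel v (z - w , K.trans (K.*-comm (z - w) k) eq) kv≈0
    split : k * z ≈ 0ℂ ⊎ 1ℂ - k * z ≈ 0ℂ → z ≈ 0ℂ ⊎ w ≈ 0ℂ
    split (inj₁ kz≈0)   = inj₁ (absorb z kz≈0)
    split (inj₂ 1-kz≈0) = inj₂ (absorb w (begin
      k * w  ≈⟨ solve 1 (λ v → v := :- :- v) K.refl (k * w) ⟩
      - - (k * w)  ≈⟨ K.-‿cong 1-kz ⟨
      - (1ℂ - k * z)  ≈⟨ K.-‿cong 1-kz≈0 ⟩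
      - 0ℂ  ≈⟨ RingProperties.-0#≈0# K.ring ⟩
      0ℂ  ∎))

  difference-zero : ∀ {z w} → z - w ≈ 0ℂ → z ≈ w
  difference-zero {z} {w} = RingProperties.x∙y⁻¹≈ε⇒x≈y K.ring z w

-- Finite sums over ℂ and ℤ

module Sums where
  open Scalars
  open Complex using (_≈_; _+_; _*_; -_; 0ℂ; 1ℂ; conj)
  open K using (setoid)
  open import Relation.Binary.Reasoning.Setoid setoid
  private
    module Σ⁺ = CommutativeMonoidSum K.+-commutativeMonoid
    module Σ* = SemiringSum K.semiring

  ∑-cong : ∀ {n} {f g : Vector ℂ n} → (∀ i → f i ≈ g i) → ∑ f ≈ ∑ g
  ∑-cong = Σ⁺.sum-cong-≋

  ∑-+ : ∀ {n} (f g : Vector ℂ n) → ∑ (λ i → f i + g i) ≈ ∑ f + ∑ g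
  ∑-+ = Σ⁺.∑-distrib-+

  ∑-*ˡ : ∀ {n} c (f : Vector ℂ n) → c * ∑ f ≈ ∑ λ i → c * f i
  ∑-*ˡ = Σ*.*-distribˡ-sum

  ∑-*ʳ : ∀ {n} c (f : Vector ℂ n) → ∑ f * c ≈ ∑ λ i → f i * c
  ∑-*ʳ = Σ*.*-distribʳ-sum

  ∑-swap : ∀ {m n} (f : Fin m → Fin n → ℂ) → (∑ λ i → ∑ λ j → f i j) ≈ (∑ λ j → ∑ λ i → f i j)
  ∑-swap = Σ⁺.∑-comm

  ∑-permute : ∀ {m n} (f : Vector ℂ n) (π : Permutation m n) → ∑ f ≈ ∑ λ i → f (π ⟨$⟩ʳ i)
  ∑-permute = Σ⁺.∑-permute

  ∑-zero : ∀ {n} {f : Vector ℂ n} → (∀ i → f i ≈ 0ℂ) → ∑ f ≈ 0ℂ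
  ∑-zero {n} f≈0 = K.trans (∑-cong f≈0) (Σ⁺.sum-replicate-zero n)

  ∑-only : ∀ {n} {f : Vector ℂ n} j → (∀ i → i ≢ j → f i ≈ 0ℂ) → ∑ f ≈ f j
  ∑-only {suc n} zero f≈0 =
    K.trans (K.+-congˡ (∑-zero λ i → f≈0 (suc i) λ ())) (K.+-identityʳ _)
  ∑-only {suc n} (suc j) f≈0 = K.trans
    (K.+-cong (f≈0 zero λ ()) (∑-only j λ i i≢j → f≈0 (suc i) λ eq → i≢j (Fin.suc-injective eq)))
    (K.+-identityˡ _)

  conj-∑ : ∀ {n} (f : Vector ℂ n) → conj (∑ f) ≈ ∑ λ i → conj (f i)
  conj-∑ {zero}  f = conj-0
  conj-∑ {suc n} f = K.trans (conj-+ (f zero) _) (K.+-congˡ (conj-∑ λ i → f (suc i)))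

  -- The sum in which finite checks are evaluated; `ι-∑` transports them to ℂ.
  ∑ℤ : ∀ {n} → Vector ℤ n → ℤ
  ∑ℤ {zero}  f = 0ℤ
  ∑ℤ {suc n} f = f zero ℤ.+ ∑ℤ λ i → f (suc i)

  ι-∑ : ∀ {n} (f : Vector ℤ n) → ι (∑ℤ f) ≈ ∑ λ i → ι (f i)
  ι-∑ {zero}  f = ι-0
  ι-∑ {suc n} f = K.trans (ι-+ (f zero) _) (K.+-congˡ (ι-∑ λ i → f (suc i)))

  ι-∑* : ∀ {n} (f g : Vector ℤ n) → ι (∑ℤ λ i → f i ℤ.* g i) ≈ ∑ λ i → ι (f i) * ι (g i)
  ι-∑* f g = K.trans (ι-∑ λ i → f i ℤ.* g i) (∑-cong λ i → ι-* (f i) (g i))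

  δ : ∀ {n} → Fin n → Fin n → ℤ
  δ i j = if does (i Fin.≟ j) then 1ℤ else 0ℤ

  δ-same : ∀ {n} {i j : Fin n} → i ≡ j → δ i j ≡ 1ℤ
  δ-same {i = i} {j} eq = cong (if_then 1ℤ else 0ℤ) (dec-true (i Fin.≟ j) eq)

  δ-diff : ∀ {n} {i j : Fin n} → i ≢ j → δ i j ≡ 0ℤ
  δ-diff {i = i} {j} neq = cong (if_then 1ℤ else 0ℤ) (dec-false (i Fin.≟ j) neq)

  ∑-δ : ∀ {n} (f : Vector ℂ n) j → (∑ λ i → ι (δ i j) * f i) ≈ f j
  ∑-δ f j = K.trans
    (∑-only j λ i i≢j → K.trans (K.*-congʳ (K.trans (≡⇒≈ (cong ι (δ-diff i≢j))) ι-0)) (K.zeroˡ _))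
    (K.trans (K.*-congʳ (K.trans (≡⇒≈ (cong ι (δ-same {i = j} refl))) ι-1)) (K.*-identityˡ _))

  identityMatrix≈δ : ∀ {n} (i j : Fin n) → identityMatrix n i j ≈ ι (δ i j)
  identityMatrix≈δ i j with does (i Fin.≟ j)
  ... | true  = K.sym ι-1
  ... | false = K.sym ι-0

  δ-sym : ∀ {n} (i j : Fin n) → δ i j ≡ δ j i
  δ-sym i j with i Fin.≟ j
  ... | yes i≡j = sym (δ-same (sym i≡j))
  ... | no i≢j  = sym (δ-diff λ j≡i → i≢j (sym j≡i))

  𝕍-sum : ∀ {n k} (w : Fin k → Vector ℂ n) y → 𝕍.sum w y ≡ ∑ λ i → w i y
  𝕍-sum {k = zero}  w y = refl
  𝕍-sum {k = suc k} w y = cong (λ s → w zero y + s) (𝕍-sum (λ i → w (suc i)) y)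

  𝕄-sum : ∀ {n k} (M : Fin k → Matrix n) y z → 𝕄.sum M y z ≡ ∑ λ i → M i y z
  𝕄-sum {k = zero}  M y z = refl
  𝕄-sum {k = suc k} M y z = cong (λ s → M zero y z + s) (𝕄-sum (λ i → M (suc i)) y z)

-- Pairings, linear combinations and matrices acting on families of vectors

module LinearMaps where
  open Scalars
  open Sums
  open Complex using (_≈_; _+_; _*_; -_; 0ℂ; 1ℂ; conj)
  open import Relation.Binary.Reasoning.Setoid K.setoid

  infix 7 ⟪_,_⟫
  ⟪_,_⟫ : ∀ {n} → Vector ℂ n → Vector ℂ n → ℂ
  ⟪ u , v ⟫ = ∑ λ y → u y * v y

  ⟪⟫-congʳ : ∀ {n} (u : Vector ℂ n) {v w} → v 𝕍.≈ᴹ w → ⟪ u , v ⟫ ≈ ⟪ u , w ⟫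
  ⟪⟫-congʳ u v≈w = ∑-cong λ y → K.*-congˡ (v≈w y)

  -- The same vector as `linearCombination`, but summed coordinate by coordinate, where the lemmas
  -- on `∑` apply.
  combine : ∀ {n k} → (Fin k → Vector ℂ n) → Vector ℂ k → Vector ℂ n
  combine f c y = ∑ λ i → c i * f i y

  linearCombination≈combine : ∀ {n k} (f : Fin k → Vector ℂ n) c →
    𝕍.linearCombination c f 𝕍.≈ᴹ combine f c
  linearCombination≈combine f c y = ≡⇒≈ (𝕍-sum (λ i → c i 𝕍.*ₗ f i) y)

  combine-cong : ∀ {n k} (f : Fin k → Vector ℂ n) {c d} → c 𝕍.≈ᴹ d → combine f c 𝕍.≈ᴹ combine f d
  combine-cong f c≈d y = ∑-cong λ i → K.*-congʳ (c≈d i)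

  combine-zero : ∀ {n k} (f : Fin k → Vector ℂ n) {c} → c 𝕍.≈ᴹ 𝕍.0ᴹ → combine f c 𝕍.≈ᴹ 𝕍.0ᴹ
  combine-zero f c≈0 y = ∑-zero λ i → K.trans (K.*-congʳ (c≈0 i)) (K.zeroˡ _)

  combine-+ : ∀ {n k} (f : Fin k → Vector ℂ n) c d →
    combine f (c 𝕍.+ᴹ d) 𝕍.≈ᴹ combine f c 𝕍.+ᴹ combine f d
  combine-+ f c d y = K.trans (∑-cong λ i → K.distribʳ (f i y) (c i) (d i))
    (∑-+ (λ i → c i * f i y) (λ i → d i * f i y))

  combine-* : ∀ {n k} (f : Fin k → Vector ℂ n) a c →
    combine f (a 𝕍.*ₗ c) 𝕍.≈ᴹ a 𝕍.*ₗ combine f c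
  combine-* f a c y = K.trans (∑-cong λ i → K.*-assoc a (c i) (f i y))
    (K.sym (∑-*ˡ a λ i → c i * f i y))

  combine-only : ∀ {n k} (f : Fin k → Vector ℂ n) {c} j → (∀ i → i ≢ j → c i ≈ 0ℂ) →
    combine f c 𝕍.≈ᴹ c j 𝕍.*ₗ f j
  combine-only f j c≈0 y = ∑-only j λ i i≢j → K.trans (K.*-congʳ (c≈0 i i≢j)) (K.zeroˡ _)

  combine-unit : ∀ {n k} (f : Fin k → Vector ℂ n) j → combine f (λ i → ι (δ i j)) 𝕍.≈ᴹ f j
  combine-unit f j y = ∑-δ (λ i → f i y) j

  ·-congʳ : ∀ {n} (M : Matrix n) {u v} → u 𝕍.≈ᴹ v → M · u 𝕍.≈ᴹ M · v
  ·-congʳ M u≈v y = ⟪⟫-congʳ (M y) u≈v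

  ·-congˡ : ∀ {n} {M N : Matrix n} v → M 𝕄.≈ᴹ N → M · v 𝕍.≈ᴹ N · v
  ·-congˡ v M≈N y = ∑-cong λ z → K.*-congʳ (M≈N y z)

  ⟪⟫-∑ : ∀ {n k} (u : Vector ℂ n) (v : Fin k → Vector ℂ n) →
    ⟪ u , (λ y → ∑ λ i → v i y) ⟫ ≈ ∑ λ i → ⟪ u , v i ⟫
  ⟪⟫-∑ u v = K.trans (∑-cong λ y → ∑-*ˡ (u y) λ i → v i y) (∑-swap λ y i → u y * v i y)

  ⟪⟫-* : ∀ {n} (u : Vector ℂ n) c v → ⟪ u , c 𝕍.*ₗ v ⟫ ≈ c * ⟪ u , v ⟫
  ⟪⟫-* u c v = K.trans (∑-cong λ y → lemma (u y) c (v y)) (K.sym (∑-*ˡ c λ y → u y * v y))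
    where
    open Solver
    lemma : ∀ u c v → u * (c * v) ≈ c * (u * v)
    lemma = solve 3 (λ u c v → u :* (c :* v) := c :* (u :* v)) K.refl

  ⟪⟫-combine : ∀ {n k} (u : Vector ℂ n) (f : Fin k → Vector ℂ n) c →
    ⟪ u , combine f c ⟫ ≈ ∑ λ i → c i * ⟪ u , f i ⟫
  ⟪⟫-combine u f c = K.trans (⟪⟫-∑ u λ i → c i 𝕍.*ₗ f i) (∑-cong λ i → ⟪⟫-* u (c i) (f i))

  ·-∑ : ∀ {n k} (M : Matrix n) (v : Fin k → Vector ℂ n) →
    M · (λ y → ∑ λ i → v i y) 𝕍.≈ᴹ (λ y → ∑ λ i → (M · v i) y)
  ·-∑ M v y = ⟪⟫-∑ (M y) v

  ·-assoc : ∀ {n} (M N : Matrix n) v → (M ⊙ N) · v 𝕍.≈ᴹ M · (N · v)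
  ·-assoc M N v y = begin
    (∑ λ z → (∑ λ k → M y k * N k z) * v z)  ≈⟨ ∑-cong (λ z → ∑-*ʳ (v z) λ k → M y k * N k z) ⟩
    (∑ λ z → ∑ λ k → M y k * N k z * v z)  ≈⟨ ∑-swap (λ z k → M y k * N k z * v z) ⟩
    (∑ λ k → ∑ λ z → M y k * N k z * v z)
      ≈⟨ ∑-cong (λ k → ∑-cong λ z → K.*-assoc (M y k) (N k z) (v z)) ⟩
    (∑ λ k → ∑ λ z → M y k * (N k z * v z))  ≈⟨ ∑-cong (λ k → ∑-*ˡ (M y k) λ z → N k z * v z) ⟨
    (∑ λ k → M y k * ∑ λ z → N k z * v z)  ∎

  ·-unit : ∀ {n} (M : Matrix n) y z → (M · λ k → ι (δ k z)) y ≈ M y z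
  ·-unit M y z = K.trans (∑-cong λ k → K.*-comm (M y k) _) (∑-δ (M y) z)

  identity-· : ∀ {n} (v : Vector ℂ n) → identityMatrix n · v 𝕍.≈ᴹ v
  identity-· v y = K.trans
    (∑-cong λ z → K.*-congʳ (K.trans (identityMatrix≈δ y z) (≡⇒≈ (cong ι (δ-sym y z)))))
    (∑-δ v y)

  record ActsAs {n k} (M : Matrix n) (X : Matrix k) (f : Fin k → Vector ℂ n) : Set where
    constructor actsAs
    field
      maps : ∀ j → M · f j 𝕍.≈ᴹ combine f λ i → X i j

  open ActsAs public

  actsAs-combine : ∀ {n k} {M : Matrix n} {X : Matrix k} {f} → ActsAs M X f →
    ∀ c → M · combine f c 𝕍.≈ᴹ combine f (X · c)
  actsAs-combine {M = M} {X} {f} acts c y = begin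
    (M · combine f c) y  ≈⟨ ⟪⟫-combine (M y) f c ⟩
    (∑ λ j → c j * (M · f j) y)  ≈⟨ ∑-cong (λ j → K.*-congˡ (maps acts j y)) ⟩
    (∑ λ j → c j * ∑ λ i → X i j * f i y)  ≈⟨ ∑-cong (λ j → ∑-*ˡ (c j) λ i → X i j * f i y) ⟩
    (∑ λ j → ∑ λ i → c j * (X i j * f i y))  ≈⟨ ∑-swap (λ j i → c j * (X i j * f i y)) ⟩
    (∑ λ i → ∑ λ j → c j * (X i j * f i y))  ≈⟨ ∑-cong (λ i → ∑-cong λ j → lemma (c j) (X i j) (f i y)) ⟩
    (∑ λ i → ∑ λ j → X i j * c j * f i y)  ≈⟨ ∑-cong (λ i → ∑-*ʳ (f i y) λ j → X i j * c j) ⟨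
    combine f (X · c) y  ∎
    where
    open Solver
    lemma : ∀ c x v → c * (x * v) ≈ x * c * v
    lemma = solve 3 (λ c x v → c :* (x :* v) := x :* c :* v) K.refl

  actsAs-resp : ∀ {n k} {M : Matrix n} {X Y : Matrix k} {f} → X 𝕄.≈ᴹ Y → ActsAs M X f → ActsAs M Y f
  actsAs-resp {f = f} X≈Y acts .maps j y = K.trans (maps acts j y) (combine-cong f (λ i → X≈Y i j) y)

  actsAs-respˡ : ∀ {n k} {M N : Matrix n} {X : Matrix k} {f} → M 𝕄.≈ᴹ N → ActsAs M X f → ActsAs N X f
  actsAs-respˡ {f = f} M≈N acts .maps j y = K.trans (K.sym (·-congˡ (f j) M≈N y)) (maps acts j y)

  actsAs-1 : ∀ {n k} (f : Fin k → Vector ℂ n) → ActsAs (identityMatrix n) (λ i j → ι (δ i j)) f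
  actsAs-1 f .maps j y = K.trans (identity-· (f j) y) (K.sym (combine-unit f j y))

  actsAs-+ : ∀ {n k} {M N : Matrix n} {X Y : Matrix k} {f} →
    ActsAs M X f → ActsAs N Y f → ActsAs (M 𝕄.+ᴹ N) (X 𝕄.+ᴹ Y) f
  actsAs-+ {M = M} {N} {X} {Y} {f} p q .maps j y = begin
    ((M 𝕄.+ᴹ N) · f j) y  ≈⟨ ∑-cong (λ z → K.distribʳ (f j z) (M y z) (N y z)) ⟩
    (∑ λ z → M y z * f j z + N y z * f j z)  ≈⟨ ∑-+ (λ z → M y z * f j z) (λ z → N y z * f j z) ⟩
    (M · f j) y + (N · f j) y  ≈⟨ K.+-cong (maps p j y) (maps q j y) ⟩
    combine f (λ i → X i j) y + combine f (λ i → Y i j) y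
        ≈⟨ combine-+ f (λ i → X i j) (λ i → Y i j) y ⟨
    combine f (λ i → X i j + Y i j) y  ∎

  actsAs-* : ∀ {n k} c {M : Matrix n} {X : Matrix k} {f} → ActsAs M X f → ActsAs (c 𝕄.*ₗ M) (c 𝕄.*ₗ X) f
  actsAs-* c {M} {X} {f} p .maps j y = begin
    ((c 𝕄.*ₗ M) · f j) y  ≈⟨ ∑-cong (λ z → K.*-assoc c (M y z) (f j z)) ⟩
    (∑ λ z → c * (M y z * f j z))  ≈⟨ ∑-*ˡ c (λ z → M y z * f j z) ⟨
    c * (M · f j) y  ≈⟨ K.*-congˡ (maps p j y) ⟩
    c * combine f (λ i → X i j) y  ≈⟨ combine-* f c (λ i → X i j) y ⟨
    combine f (λ i → c * X i j) y  ∎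

  actsAs-⊙ : ∀ {n k} {M N : Matrix n} {X Y : Matrix k} {f} →
    ActsAs M X f → ActsAs N Y f → ActsAs (M ⊙ N) (X ⊙ Y) f
  actsAs-⊙ {M = M} {N} {X} {Y} {f} p q .maps j y = begin
    ((M ⊙ N) · f j) y  ≈⟨ ·-assoc M N (f j) y ⟩
    (M · (N · f j)) y  ≈⟨ ·-congʳ M (maps q j) y ⟩
    (M · combine f λ i → Y i j) y  ≈⟨ actsAs-combine p (λ i → Y i j) y ⟩
    combine f (λ i → (X ⊙ Y) i j) y  ∎

-- Integral block matrices, one block per module type

module Blocks where
  open Sums

  diam : ModuleType → ℕ
  diam I   = 3
  diam II  = 1
  diam III = 1

  dim : ModuleType → ℕ
  dim t = suc (diam t)

  endpt : ModuleType → ℕ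
  endpt I   = 0
  endpt II  = 1
  endpt III = 2

  kind : Fin 6 → ModuleType
  kind = I ▹ II ▹ II ▹ III ▹ III ▹ III ▹ ⟨⟩

  _≟ᵗ_ : DecidableEquality ModuleType
  I   ≟ᵗ I   = yes refl
  I   ≟ᵗ II  = no λ ()
  I   ≟ᵗ III = no λ ()
  II  ≟ᵗ I   = no λ ()
  II  ≟ᵗ II  = yes refl
  II  ≟ᵗ III = no λ ()
  III ≟ᵗ I   = no λ ()
  III ≟ᵗ II  = no λ ()
  III ≟ᵗ III = yes refl

  allTypes? : ∀ {P : ModuleType → Set} → (∀ t → Dec (P t)) → Dec (∀ t → P t)
  allTypes? P? = map′ (λ { (p , q , r) → λ { I → p ; II → q ; III → r } }) (λ f → f I , f II , f III)
    (P? I ×-dec P? II ×-dec P? III)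

  -- An integral element of Mat₄ × Mat₂ × Mat₂; blocks are indexed by type, not by summand, since
  -- isomorphic summands share theirs.
  Block : Set
  Block = ∀ t → Fin (dim t) → Fin (dim t) → ℤ

  rows : ∀ t → Vec (Vec ℕ (dim t)) (dim t)
  rows I =
      (0 ∷ 3 ∷ 0 ∷ 0 ∷ [])
    ∷ (1 ∷ 0 ∷ 2 ∷ 0 ∷ [])
    ∷ (0 ∷ 1 ∷ 0 ∷ 2 ∷ [])
    ∷ (0 ∷ 0 ∷ 3 ∷ 0 ∷ []) ∷ []
  rows II =
      (0 ∷ 2 ∷ [])
    ∷ (1 ∷ 0 ∷ []) ∷ []
  rows III =
      (0 ∷ 2 ∷ [])
    ∷ (1 ∷ 0 ∷ []) ∷ []

  adjacency : Block
  adjacency t i j = + lookup (lookup (rows t) i) j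

  atLevel : ℕ → ∀ t → Fin (dim t) → ℤ
  atLevel l t a = if does (endpt t ℕ.+ toℕ a ℕ.≟ l) then 1ℤ else 0ℤ

  level : ℕ → Block
  level l t i j = atLevel l t j ℤ.* δ i j

  -- By cases on both types, since `i` and `a` are comparable only once the types coincide;
  -- `unit-same` recovers the uniform formula.
  unit : ∀ t → Fin (dim t) → Fin (dim t) → Block
  unit I   a b I   i j = δ i a ℤ.* δ j b
  unit II  a b II  i j = δ i a ℤ.* δ j b
  unit III a b III i j = δ i a ℤ.* δ j b
  unit _   _ _ _   _ _ = 0ℤ

  unit-same : ∀ t a b i j → unit t a b t i j ≡ δ i a ℤ.* δ j b
  unit-same I   _ _ _ _ = refl
  unit-same II  _ _ _ _ = refl
  unit-same III _ _ _ _ = refl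

  infixr 8 _⊗_
  _⊗_ : Block → Block → Block
  (X ⊗ Y) t i j = ∑ℤ λ k → X t i k ℤ.* Y t k j

  power : ℕ → Block
  power zero    t i j = δ i j
  power (suc k) = adjacency ⊗ power k

  infixl 6 _⊖_
  _⊖_ : Block → Block → Block
  (X ⊖ Y) t i j = X t i j ℤ.+ -[1+ 0 ] ℤ.* Y t i j

  -- The product `level l ⊗ X ⊗ level m` in a form that evaluates without multiplying matrices;
  -- `restrict-entry` makes the connection.
  restrict : ℕ → ℕ → Block → Block
  restrict l m X t i j = if does (endpt t ℕ.+ toℕ i ℕ.≟ l)
    then (if does (endpt t ℕ.+ toℕ j ℕ.≟ m) then X t i j else 0ℤ) else 0ℤ

  -- The words in A and E* that single out one block entry: only type I is supported at
  -- level 0; after removing type I, only type II remains at level 1 and type III at level 3.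
  word : ∀ t → Fin (dim t) → Fin (dim t) → Block
  word I   a b = restrict (toℕ a) 0 (power (toℕ a)) ⊗ restrict 0 (toℕ b) (power (toℕ b))
  word II  a b = restrict (1 ℕ.+ toℕ a) 1 (power (toℕ a)) ⊗ (level 1 ⊖ unit I 1F 1F)
    ⊗ restrict 1 (1 ℕ.+ toℕ b) (power (toℕ b))
  word III a b = restrict (2 ℕ.+ toℕ a) 3 (power (1 ℕ.∸ toℕ a)) ⊗ (level 3 ⊖ unit I 3F 3F)
    ⊗ restrict 3 (2 ℕ.+ toℕ b) (power (1 ℕ.∸ toℕ b))

  private
    entry : ∀ {m} → Vec ℕ m → Fin m → ℤ
    entry v i = + lookup v i

  -- The products of entries of `adjacency` met along `word t a b`: for type I the subdiagonal 1, 1,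
  -- 3 down to `a` and the superdiagonal 3, 2, 2 up to `b`; for types II and III each superdiagonal
  -- step contributes 2.
  scale : ∀ t → Fin (dim t) → Fin (dim t) → ℤ
  scale I   a b = entry (1 ∷ 1 ∷ 1 ∷ 3 ∷ []) a ℤ.* entry (1 ∷ 3 ∷ 6 ∷ 12 ∷ []) b
  scale II  a b = entry (1 ∷ 2 ∷ []) b
  scale III a b = entry (2 ∷ 1 ∷ []) a

  scale≢0 : ∀ t a b → scale t a b ≢ 0ℤ
  scale≢0 = from-yes (allTypes? λ t → Fin.all? λ a → Fin.all? λ b → ¬? (scale t a b ℤ.≟ 0ℤ))

  word≡unit : ∀ t a b t′ i j → word t a b t′ i j ≡ scale t a b ℤ.* unit t a b t′ i j
  word≡unit = from-yes (allTypes? λ t → Fin.all? λ a → Fin.all? λ b → allTypes? λ t′ →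
    Fin.all? λ i → Fin.all? λ j → word t a b t′ i j ℤ.≟ scale t a b ℤ.* unit t a b t′ i j)

  Position : Set
  Position = Σ[ t ∈ ModuleType ] Fin (dim t) × Fin (dim t)

  position : Fin 24 → Position
  position i with splitAt 16 i
  ... | inj₁ p = I , remQuot 4 p
  ... | inj₂ q with splitAt 4 q
  ...   | inj₁ p = II , remQuot 2 p
  ...   | inj₂ p = III , remQuot 2 p

  index : Position → Fin 24
  index (I   , a , b) = Fin.combine a b ↑ˡ 8
  index (II  , a , b) = 16 ↑ʳ (Fin.combine a b ↑ˡ 4)
  index (III , a , b) = 16 ↑ʳ (4 ↑ʳ Fin.combine a b)

  index-position : ∀ i → index (position i) ≡ i
  index-position = from-yes (Fin.all? λ i → index (position i) Fin.≟ i)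

  position-index : ∀ p → position (index p) ≡ p
  position-index (I , a , b)
    rewrite Fin.splitAt-↑ˡ 16 (Fin.combine a b) 8 | Fin.remQuot-combine a b = refl
  position-index (II , a , b)
    rewrite Fin.splitAt-↑ʳ 16 8 (Fin.combine a b ↑ˡ 4) | Fin.splitAt-↑ˡ 4 (Fin.combine a b) 4
          | Fin.remQuot-combine a b = refl
  position-index (III , a , b)
    rewrite Fin.splitAt-↑ʳ 16 8 (4 ↑ʳ Fin.combine a b) | Fin.splitAt-↑ʳ 4 4 (Fin.combine a b)
          | Fin.remQuot-combine a b = refl

  unitAt : Position → Block
  unitAt (t , a , b) = unit t a b

  -- Reduces an entry of a combination of the 24 units to one coefficient, by `∑-δ`.
  unitAt-entry : ∀ i t a b → unitAt (position i) t a b ≡ δ i (index (t , a , b))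
  unitAt-entry = from-yes (Fin.all? λ i → allTypes? λ t → Fin.all? λ a → Fin.all? λ b →
    unitAt (position i) t a b ℤ.≟ δ i (index (t , a , b)))

-- Frames: adapted bases with dual vectors

module Frames where
  open Scalars
  open Sums
  open LinearMaps
  open Blocks
  open Complex using (_≈_; _+_; _*_; -_; 0ℂ; 1ℂ; conj)

  complexBlock : Block → ∀ t → Matrix (dim t)
  complexBlock X t i j = ι (X t i j)

  -- `dual`, `dual-≢` and `complete` say that pairing with `κ` gives coordinates for the union of
  -- the six families. The pairing `⟪_,_⟫` is bilinear, which is why orthogonality for the Hermitian
  -- product is a field of its own. All actions depend on α through `kind α` only.
  record Frame {n} {Γ : ConnectedGraph n} (Γ-dr : DistanceRegular Γ) (x : Fin n) : Set where
    open Terwilliger Γ-dr x using (A; E*)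
    field
      D≡3        : DistanceRegular.D Γ-dr ≡ 3
      b κ        : ∀ α → Fin (dim (kind α)) → Vector ℂ n
      dual       : ∀ α i j → ⟪ κ α i , b α j ⟫ ≈ ι (δ i j)
      dual-≢     : ∀ {α β} → α ≢ β → ∀ i j → ⟪ κ α i , b β j ⟫ ≈ 0ℂ
      complete   : ∀ v → v 𝕍.≈ᴹ λ y → ∑ λ α → combine (b α) (λ k → ⟪ κ α k , v ⟫) y
      A-acts     : ∀ α → ActsAs A (complexBlock adjacency (kind α)) (b α)
      E*-acts    : ∀ l α → ActsAs (E* l) (complexBlock (level l) (kind α)) (b α)
      orthogonal : ∀ {α β} → α ≢ β → ∀ i j → inner (b α i) (b β j) ≈ 0ℂ

  span : ∀ {n k} (f : Fin k → Vector ℂ n) {u} c → u 𝕍.≈ᴹ combine f c → 𝕍.Span f u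
  span f c eq = c , λ y → K.trans (eq y) (K.sym (linearCombination≈combine f c y))

  unspan : ∀ {n k} (f : Fin k → Vector ℂ n) {u} (p : 𝕍.Span f u) → u 𝕍.≈ᴹ combine f (proj₁ p)
  unspan f (c , eq) y = K.trans (eq y) (linearCombination≈combine f c y)

  span-isSubspace : ∀ {n k} (f : Fin k → Vector ℂ n) → 𝕍.IsSubspace (𝕍.Span f)
  span-isSubspace f = record
    { ∈-resp-≈ = λ u≈v (c , eq) → c , λ y → K.trans (K.sym (u≈v y)) (eq y)
    ; 0∈       = span f 𝕍.0ᴹ λ y → K.sym (combine-zero f (λ _ → K.refl) y)
    ; +-closed = λ p q → span f (proj₁ p 𝕍.+ᴹ proj₁ q) λ y → K.trans
        (K.+-cong (unspan f p y) (unspan f q y))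
        (K.sym (combine-+ f (proj₁ p) (proj₁ q) y))
    ; *-closed = λ a p → span f (a 𝕍.*ₗ proj₁ p) λ y → K.trans
        (K.*-congˡ (unspan f p y)) (K.sym (combine-* f a (proj₁ p) y))
    }

  span-member : ∀ {n k} (f : Fin k → Vector ℂ n) j → 𝕍.Span f (f j)
  span-member f j = span f (λ i → ι (δ i j)) λ y → K.sym (combine-unit f j y)

  level-entry : ∀ l t (c : Vector ℂ (dim t)) i →
    (∑ λ j → ι (level l t i j) * c j) ≈ ι (atLevel l t i) * c i
  level-entry l t c i = begin
    (∑ λ j → ι (level l t i j) * c j)  ≈⟨ ∑-cong (λ j → lemma j) ⟩
    (∑ λ j → ι (δ j i) * (ι (atLevel l t j) * c j))  ≈⟨ ∑-δ (λ j → ι (atLevel l t j) * c j) i ⟩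
    ι (atLevel l t i) * c i  ∎
    where
    open import Relation.Binary.Reasoning.Setoid K.setoid
    open Solver
    rearrange : ∀ p q c → p * q * c ≈ q * (p * c)
    rearrange = solve 3 (λ p q c → p :* q :* c := q :* (p :* c)) K.refl
    lemma : ∀ j → ι (level l t i j) * c j ≈ ι (δ j i) * (ι (atLevel l t j) * c j)
    lemma j = begin
      ι (level l t i j) * c j  ≈⟨ K.*-congʳ (ι-* (atLevel l t j) (δ i j)) ⟩
      ι (atLevel l t j) * ι (δ i j) * c j
        ≡⟨ cong (λ k → ι (atLevel l t j) * ι k * c j) (δ-sym i j) ⟩
      ι (atLevel l t j) * ι (δ j i) * c j  ≈⟨ rearrange _ _ _ ⟩
      ι (δ j i) * (ι (atLevel l t j) * c j)  ∎

  restrict-entry : ∀ l m X t i j →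
    (complexBlock (level l) t ⊙ complexBlock X t ⊙ complexBlock (level m) t) i j ≈ ι (restrict l m X t i j)
  restrict-entry l m X t i j = begin
    (∑ λ k → ι (level l t i k) * (∑ λ h → ι (X t k h) * ι (level m t h j)))
      ≈⟨ level-entry l t (λ k → ∑ λ h → ι (X t k h) * ι (level m t h j)) i ⟩
    ι (atLevel l t i) * (∑ λ h → ι (X t i h) * ι (level m t h j))
      ≈⟨ K.*-congˡ (∑-cong λ h → lemma h) ⟩
    ι (atLevel l t i) * (∑ λ h → ι (δ h j) * (ι (X t i h) * ι (atLevel m t j)))
      ≈⟨ K.*-congˡ (∑-δ (λ h → ι (X t i h) * ι (atLevel m t j)) j) ⟩
    ι (atLevel l t i) * (ι (X t i j) * ι (atLevel m t j))
      ≈⟨ cases ⟩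
    ι (restrict l m X t i j) ∎
    where
    open import Relation.Binary.Reasoning.Setoid K.setoid
    open Solver
    rearrange : ∀ p q c → c * (p * q) ≈ q * (c * p)
    rearrange = solve 3 (λ p q c → c :* (p :* q) := q :* (c :* p)) K.refl
    lemma : ∀ h → ι (X t i h) * ι (level m t h j) ≈ ι (δ h j) * (ι (X t i h) * ι (atLevel m t j))
    lemma h = K.trans (K.*-congˡ (ι-* (atLevel m t j) (δ h j))) (rearrange _ _ _)
    cases : ι (atLevel l t i) * (ι (X t i j) * ι (atLevel m t j)) ≈ ι (restrict l m X t i j)
    cases with does (endpt t ℕ.+ toℕ i ℕ.≟ l) | does (endpt t ℕ.+ toℕ j ℕ.≟ m)
    ... | true  | true  = K.trans (K.*-cong ι-1 (K.*-congˡ ι-1))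
      (K.trans (K.*-identityˡ _) (K.*-identityʳ _))
    ... | true  | false = K.trans
      (K.*-congˡ (K.trans (K.*-congˡ ι-0) (K.zeroʳ _)))
      (K.trans (K.zeroʳ _) (K.sym ι-0))
    ... | false | _     = K.trans (K.*-congʳ ι-0) (K.trans (K.zeroˡ _) (K.sym ι-0))

-- The algebra T acting in coordinates

module FrameTheory {n : ℕ} {Γ : ConnectedGraph n} {Γ-dr : DistanceRegular Γ} {x : Fin n}
                   (F : Frames.Frame Γ-dr x) where
  open Scalars
  open Sums
  open LinearMaps
  open Blocks
  open Frames
  open Frame F
  open Terwilliger Γ-dr x
  open Complex using (_≈_; _+_; _*_; -_; 0ℂ; 1ℂ; conj)
  open import Relation.Binary.Reasoning.Setoid K.setoid

  D : ℕ
  D = DistanceRegular.D Γ-dr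

  W : Fin 6 → Subset-V
  W α = 𝕍.Span (b α)

  coord : ∀ α → Vector ℂ n → Vector ℂ (dim (kind α))
  coord α v k = ⟪ κ α k , v ⟫

  coord-cong : ∀ α {u v} → u 𝕍.≈ᴹ v → coord α u 𝕍.≈ᴹ coord α v
  coord-cong α u≈v k = ⟪⟫-congʳ (κ α k) u≈v

  coord-combine : ∀ α c → coord α (combine (b α) c) 𝕍.≈ᴹ c
  coord-combine α c k = begin
    ⟪ κ α k , combine (b α) c ⟫  ≈⟨ ⟪⟫-combine (κ α k) (b α) c ⟩
    (∑ λ j → c j * ⟪ κ α k , b α j ⟫)  ≈⟨ ∑-cong (λ j → K.trans (K.*-congˡ (dual α k j))
        (K.trans (K.*-comm (c j) (ι (δ k j))) (≡⇒≈ (cong (λ d → ι d * c j) (δ-sym k j))))) ⟩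
    (∑ λ j → ι (δ j k) * c j)  ≈⟨ ∑-δ c k ⟩
    c k  ∎

  coord-combine-≢ : ∀ {α β} → α ≢ β → ∀ c → coord α (combine (b β) c) 𝕍.≈ᴹ 𝕍.0ᴹ
  coord-combine-≢ {α} {β} α≢β c k = K.trans (⟪⟫-combine (κ α k) (b β) c)
    (∑-zero λ j → K.trans (K.*-congˡ (dual-≢ α≢β k j)) (K.zeroʳ (c j)))

  assemble : (∀ α → Vector ℂ (dim (kind α))) → Vector ℂ n
  assemble c y = ∑ λ α → combine (b α) (c α) y

  assemble-coord : ∀ v → v 𝕍.≈ᴹ assemble (λ α → coord α v)
  assemble-coord = complete

  assemble-cong : ∀ {c d} → (∀ α → c α 𝕍.≈ᴹ d α) → assemble c 𝕍.≈ᴹ assemble d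
  assemble-cong c≈d y = ∑-cong λ α → combine-cong (b α) (c≈d α) y

  coord-assemble : ∀ c α → coord α (assemble c) 𝕍.≈ᴹ c α
  coord-assemble c α k = begin
    ⟪ κ α k , assemble c ⟫  ≈⟨ ⟪⟫-∑ (κ α k) (λ β → combine (b β) (c β)) ⟩
    (∑ λ β → coord α (combine (b β) (c β)) k)
      ≈⟨ ∑-only α (λ β β≢α → coord-combine-≢ (λ eq → β≢α (sym eq)) (c β) k) ⟩
    coord α (combine (b α) (c α)) k  ≈⟨ coord-combine α (c α) k ⟩
    c α k  ∎

  combine-injective : ∀ α {c d} → combine (b α) c 𝕍.≈ᴹ combine (b α) d → c 𝕍.≈ᴹ d
  combine-injective α {c} {d} eq k = K.trans (K.sym (coord-combine α c k))
    (K.trans (coord-cong α eq k) (coord-combine α d k))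

  combine-nonzero : ∀ α {c} → combine (b α) c 𝕍.≈ᴹ 𝕍.0ᴹ → c 𝕍.≈ᴹ 𝕍.0ᴹ
  combine-nonzero α eq = combine-injective α λ y → K.trans (eq y)
    (K.sym (combine-zero (b α) (λ _ → K.refl) y))

  b≉0 : ∀ α i → ¬ (b α i 𝕍.≈ᴹ 𝕍.0ᴹ)
  b≉0 α i eq = 1≉0 (begin
    1ℂ  ≈⟨ ι-1 ⟨
    ι 1ℤ  ≡⟨ cong ι (δ-same {i = i} refl) ⟨
    ι (δ i i)  ≈⟨ combine-nonzero α {λ j → ι (δ j i)} (λ y → K.trans (combine-unit (b α) i y) (eq y)) i ⟩
    0ℂ  ∎)

  W-isBasis : ∀ α → 𝕍.IsBasis (W α) (b α)
  W-isBasis α = record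
    { members     = span-member (b α)
    ; independent = λ c eq → combine-nonzero α λ y →
        K.trans (K.sym (linearCombination≈combine (b α) c y)) (eq y)
    ; spanning    = λ p → p
    }

  Acts : Matrix n → (∀ t → Matrix (dim t)) → Set
  Acts M X = ∀ α → ActsAs M (X (kind α)) (b α)

  acts-assemble : ∀ {M X} → Acts M X → ∀ c → M · assemble c 𝕍.≈ᴹ assemble λ α → X (kind α) · c α
  acts-assemble {M} acts c y = K.trans (·-∑ M (λ α → combine (b α) (c α)) y)
    (∑-cong λ α → actsAs-combine (acts α) (c α) y)

  acts-coord : ∀ {M X} → Acts M X → ∀ α v → coord α (M · v) 𝕍.≈ᴹ X (kind α) · coord α v
  acts-coord {M} {X} acts α v k = begin
    coord α (M · v) k  ≈⟨ coord-cong α (·-congʳ M (assemble-coord v)) k ⟩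
    coord α (M · assemble λ α → coord α v) k
      ≈⟨ coord-cong α (acts-assemble {M} {X} acts (λ α → coord α v)) k ⟩
    coord α (assemble λ α → X (kind α) · coord α v) k
      ≈⟨ coord-assemble (λ α → X (kind α) · coord α v) α k ⟩
    (X (kind α) · coord α v) k  ∎

  -- The families span V, so the blocks determine the values on unit vectors, which are the columns.
  -- This is the injectivity of the map from T to the blocks.
  acts-unique : ∀ {M N X} → Acts M X → Acts N X → M 𝕄.≈ᴹ N
  acts-unique {M} {N} {X} p q y z = begin
    M y z  ≈⟨ ·-unit M y z ⟨
    (M · e) y  ≈⟨ ·-congʳ M (assemble-coord e) y ⟩
    (M · assemble λ α → coord α e) y  ≈⟨ acts-assemble {M} {X} p (λ α → coord α e) y ⟩
    assemble (λ α → X (kind α) · coord α e) y  ≈⟨ acts-assemble {N} {X} q (λ α → coord α e) y ⟨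
    (N · assemble λ α → coord α e) y  ≈⟨ ·-congʳ N (assemble-coord e) y ⟨
    (N · e) y  ≈⟨ ·-unit N y z ⟩
    N y z  ∎
    where
    e : Vector ℂ n
    e k = ι (δ k z)

  -- One block per type suffices for the generators, and the closure operations of `T` preserve
  -- this.
  T-acts : ∀ {M} → T M → ∃ (Acts M)
  T-acts A∈              = complexBlock adjacency , A-acts
  T-acts (E*∈ {l} _)     = complexBlock (level l) , E*-acts l
  T-acts 1∈              = (λ t i j → ι (δ i j)) , λ α → actsAs-1 (b α)
  T-acts (+-closed p q)  =
    let X , X-acts = T-acts p
        Y , Y-acts = T-acts q
    in (λ t → X t 𝕄.+ᴹ Y t) , λ α → actsAs-+ (X-acts α) (Y-acts α)
  T-acts (*-closed c p)  =
    let X , X-acts = T-acts p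
    in (λ t → c 𝕄.*ₗ X t) , λ α → actsAs-* c (X-acts α)
  T-acts (⊙-closed p q)  =
    let X , X-acts = T-acts p
        Y , Y-acts = T-acts q
    in (λ t → X t ⊙ Y t) , λ α → actsAs-⊙ (X-acts α) (Y-acts α)
  T-acts (∈-resp-≈ M≈N p) =
    let X , X-acts = T-acts p
    in X , λ α → actsAs-respˡ M≈N (X-acts α)

  W-isModule : ∀ α → IsModule (W α)
  W-isModule α = record
    { isSubspace = span-isSubspace (b α)
    ; T-closed   = λ {B} B∈T p → let X , X-acts = T-acts B∈T in
        span (b α) (X (kind α) · proj₁ p) λ y → K.trans (·-congʳ B (unspan (b α) p) y)
          (actsAs-combine (X-acts α) (proj₁ p) y)
    }

  record Realised (X : Block) : Set where
    field
      matrix : Matrix n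
      member : T matrix
      acts   : Acts matrix (complexBlock X)

  open Realised public

  realised-resp : ∀ {X Y} → (∀ t i j → X t i j ≡ Y t i j) → Realised X → Realised Y
  realised-resp eq p = record
    { matrix = matrix p
    ; member = member p
    ; acts   = λ α → actsAs-resp (λ i j → ≡⇒≈ (cong ι (eq (kind α) i j))) (acts p α)
    }

  realised-⊗ : ∀ {X Y} → Realised X → Realised Y → Realised (X ⊗ Y)
  realised-⊗ {X} {Y} p q = record
    { matrix = matrix p ⊙ matrix q
    ; member = ⊙-closed (member p) (member q)
    ; acts   = λ α → actsAs-resp
        (λ i j → K.sym (ι-∑* (X (kind α) i) λ k → Y (kind α) k j))
        (actsAs-⊙ (acts p α) (acts q α))
    }

  realised-⊖ : ∀ {X Y} → Realised X → Realised Y → Realised (X ⊖ Y)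
  realised-⊖ {X} {Y} p q = record
    { matrix = matrix p 𝕄.+ᴹ ι -[1+ 0 ] 𝕄.*ₗ matrix q
    ; member = +-closed (member p) (*-closed (ι -[1+ 0 ]) (member q))
    ; acts   = λ α → actsAs-resp
        (λ i j → K.sym (K.trans (ι-+ (X (kind α) i j) (-[1+ 0 ] ℤ.* Y (kind α) i j))
          (K.+-congˡ (ι-* -[1+ 0 ] (Y (kind α) i j)))))
        (actsAs-+ (acts p α) (actsAs-* (ι -[1+ 0 ]) (acts q α)))
    }

  -- Division by an integer takes place in T, over ℂ, so a word need only give its unit up to a
  -- nonzero factor.
  realised-unscale : ∀ {k X} → k ≢ 0ℤ → Realised (λ t i j → k ℤ.* X t i j) → Realised X
  realised-unscale {k} {X} k≢0 p = record
    { matrix = c 𝕄.*ₗ matrix p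
    ; member = *-closed c (member p)
    ; acts   = λ α → actsAs-resp
        (λ i j → begin
          c * ι (k ℤ.* X (kind α) i j)  ≈⟨ K.*-congˡ (ι-* k (X (kind α) i j)) ⟩
          c * (ι k * ι (X (kind α) i j))  ≈⟨ K.*-assoc c (ι k) (ι (X (kind α) i j)) ⟨
          c * ι k * ι (X (kind α) i j)  ≈⟨ K.*-congʳ (proj₂ (ι-nonzero k≢0)) ⟩
          1ℂ * ι (X (kind α) i j)  ≈⟨ K.*-identityˡ (ι (X (kind α) i j)) ⟩
          ι (X (kind α) i j)  ∎)
        (actsAs-* c (acts p α))
    }
    where
    c = proj₁ (ι-nonzero k≢0)

  realised-level : ∀ {l} → l ℕ.≤ 3 → Realised (level l)
  realised-level {l} l≤3 = record
    { matrix = E* l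
    ; member = E*∈ (subst (l ℕ.≤_) (sym D≡3) l≤3)
    ; acts   = E*-acts l
    }

  realised-adjacency : Realised adjacency
  realised-adjacency = record { matrix = A ; member = A∈ ; acts = A-acts }

  realised-power : ∀ k → Realised (power k)
  realised-power zero    = record
    { matrix = identityMatrix n
    ; member = 1∈
    ; acts   = λ α → actsAs-1 (b α)
    }
  realised-power (suc k) =
    realised-⊗ realised-adjacency (realised-power k)

  realised-restrict : ∀ {l m X} → l ℕ.≤ 3 → m ℕ.≤ 3 → Realised X → Realised (restrict l m X)
  realised-restrict {l} {m} {X} l≤3 m≤3 p =
    let L = realised-level l≤3
        R = realised-level m≤3
    in record
    { matrix = matrix L ⊙ matrix p ⊙ matrix R
    ; member = ⊙-closed (member L) (⊙-closed (member p) (member R))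
    ; acts   = λ α → actsAs-resp (restrict-entry l m X (kind α))
        (actsAs-⊙ (acts L α) (actsAs-⊙ (acts p α) (acts R α)))
    }

  realised-word⇒unit : ∀ t a b → Realised (word t a b) → Realised (unit t a b)
  realised-word⇒unit t a b p = realised-unscale (scale≢0 t a b)
    (realised-resp (word≡unit t a b) p)

  -- The derivation follows the shape of `word`. Type I comes first, because its diagonal units are
  -- subtracted in the words of the other types.
  realised-unit : ∀ t a b → Realised (unit t a b)
  realised-unit I a b = realised-word⇒unit I a b (realised-⊗
    (realised-restrict (Fin.toℕ≤pred[n] a) ℕ.z≤n (realised-power (toℕ a)))
    (realised-restrict ℕ.z≤n (Fin.toℕ≤pred[n] b) (realised-power (toℕ b))))
  realised-unit II a b = realised-word⇒unit II a b (realised-⊗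
    (realised-restrict (a≤ a) (ℕ.s≤s ℕ.z≤n) (realised-power (toℕ a)))
    (realised-⊗ (realised-⊖ (realised-level (ℕ.s≤s ℕ.z≤n)) (realised-unit I 1F 1F))
      (realised-restrict (ℕ.s≤s ℕ.z≤n) (a≤ b) (realised-power (toℕ b)))))
    where
    a≤ : ∀ (a : Fin 2) → 1 ℕ.+ toℕ a ℕ.≤ 3
    a≤ a = ℕ.≤-trans (ℕ.s≤s (Fin.toℕ≤pred[n] a)) (ℕ.n≤1+n 2)
  realised-unit III a b = realised-word⇒unit III a b (realised-⊗
    (realised-restrict (a≤ a) ℕ.≤-refl (realised-power (1 ℕ.∸ toℕ a)))
    (realised-⊗ (realised-⊖ (realised-level ℕ.≤-refl) (realised-unit I 3F 3F))
      (realised-restrict ℕ.≤-refl (a≤ b) (realised-power (1 ℕ.∸ toℕ b)))))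
    where
    a≤ : ∀ (a : Fin 2) → 2 ℕ.+ toℕ a ℕ.≤ 3
    a≤ a = ℕ.s≤s (ℕ.s≤s (Fin.toℕ≤pred[n] a))

-- Irreducibility, isomorphism classes, listed data and dimension

module Subsets where
  ∈-tabulate : ∀ {n} {P : Fin n → Set} (P? : ∀ i → Dec (P i)) i → i ∈ tabulate (λ j → does (P? j)) ⇔ P i
  ∈-tabulate P? i = mk⇔
    (λ i∈ → holds (≡.trans (sym (Vec.lookup∘tabulate (λ j → does (P? j)) i)) (Vec.[]=⇒lookup i∈)))
    (λ p → Vec.lookup⇒[]= i _ (≡.trans (Vec.lookup∘tabulate (λ j → does (P? j)) i) (dec-true (P? i) p)))
    where
    holds : does (P? i) ≡ true → _
    holds eq with P? i
    holds refl | yes p = p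

module Modules {n : ℕ} {Γ : ConnectedGraph n} {Γ-dr : DistanceRegular Γ} {x : Fin n}
                (F : Frames.Frame Γ-dr x) where
  open Scalars
  open Sums
  open LinearMaps
  open Blocks
  open Frames
  open Frame F
  open FrameTheory F
  open Terwilliger Γ-dr x hiding (+-closed; *-closed)
  open Complex using (_≈_; _+_; _*_; -_; 0ℂ; 1ℂ; conj)
  open import Relation.Binary.Reasoning.Setoid K.setoid

  block-unit : ∀ t a b c i → (complexBlock (unit t a b) t · c) i ≈ c b * ι (δ i a)
  block-unit t a b c i = begin
    (∑ λ j → ι (unit t a b t i j) * c j)  ≈⟨ ∑-cong (λ j → lemma j) ⟩
    (∑ λ j → ι (δ j b) * (c j * ι (δ i a)))  ≈⟨ ∑-δ (λ j → c j * ι (δ i a)) b ⟩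
    c b * ι (δ i a)  ∎
    where
    open Solver
    rearrange : ∀ p q c → p * q * c ≈ q * (c * p)
    rearrange = solve 3 (λ p q c → p :* q :* c := q :* (c :* p)) K.refl
    lemma : ∀ j → ι (unit t a b t i j) * c j ≈ ι (δ j b) * (c j * ι (δ i a))
    lemma j = begin
      ι (unit t a b t i j) * c j  ≡⟨ cong (λ k → ι k * c j) (unit-same t a b i j) ⟩
      ι (δ i a ℤ.* δ j b) * c j  ≈⟨ K.*-congʳ (ι-* (δ i a) (δ j b)) ⟩
      ι (δ i a) * ι (δ j b) * c j  ≈⟨ rearrange (ι (δ i a)) (ι (δ j b)) (c j) ⟩
      ι (δ j b) * (c j * ι (δ i a))  ∎

  -- The unit at (a, k) reads coordinate `k` and writes it at `a`; a vector whose coordinate `k` is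
  -- invertible therefore generates every basis vector.
  unit-combine : ∀ α a k c →
    matrix (realised-unit (kind α) a k) · combine (b α) c 𝕍.≈ᴹ c k 𝕍.*ₗ b α a
  unit-combine α a k c y = begin
    (matrix (realised-unit t a k) · combine (b α) c) y
      ≈⟨ actsAs-combine (acts (realised-unit t a k) α) c y ⟩
    combine (b α) (complexBlock (unit t a k) t · c) y  ≈⟨ combine-cong (b α) (block-unit t a k c) y ⟩
    combine (b α) (c k 𝕍.*ₗ λ i → ι (δ i a)) y  ≈⟨ combine-* (b α) (c k) (λ i → ι (δ i a)) y ⟩
    c k * combine (b α) (λ i → ι (δ i a)) y  ≈⟨ K.*-congˡ (combine-unit (b α) a y) ⟩
    c k * b α a y  ∎
    where t = kind α

  sum-closed : ∀ {W′ : Subset-V} → 𝕍.IsSubspace W′ → ∀ {k} (v : Fin k → Vector ℂ n) →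
    (∀ i → W′ (v i)) → W′ (𝕍.sum v)
  sum-closed W′-sub {zero}  v v∈ = 𝕍.IsSubspace.0∈ W′-sub
  sum-closed W′-sub {suc k} v v∈ = 𝕍.IsSubspace.+-closed W′-sub (v∈ zero)
    (sum-closed W′-sub (λ i → v (suc i)) (λ i → v∈ (suc i)))

  irreducible : ∀ α → Irreducible (W α)
  irreducible α = record
    { isModule = W-isModule α
    ; nonzero  = b α zero , span-member (b α) zero , b≉0 α zero
    ; minimal  = minimal
    }
    where
    t = kind α
    minimal : ∀ {W′} → IsModule W′ → 𝕍.Nonzero W′ → ¬ (W′ ⊂ W α)
    -- An invertible coordinate of `v` would force `W′` to contain `W α`. Hence no coordinate is
    -- invertible, all of them vanish, and `v` is zero.
    minimal {W′} W′-module (v , v∈W′ , v≉0) (W′⊆W , W⊈W′) = v≉0 λ y → K.trans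
      (unspan (b α) v∈W y)
      (combine-zero (b α) (λ k → null-or-invertible (c k) λ inv → W⊈W′ (W⊆W′ k inv)) y)
      where
      open IsModule W′-module
      open 𝕍.IsSubspace isSubspace using (*-closed) renaming (∈-resp-≈ to resp)
      v∈W = W′⊆W v∈W′
      c = proj₁ v∈W
      W⊆W′ : ∀ k → Invertible (c k) → W α ⊆ W′
      W⊆W′ k (w , wc≈1) {u} (d , u≈) = resp (λ y → K.sym (u≈ y))
        (sum-closed isSubspace (λ j → d j 𝕍.*ₗ b α j) λ j → *-closed (d j)
          (resp (λ y → begin
            w * (matrix (realised-unit t j k) · v) y
              ≈⟨ K.*-congˡ (·-congʳ (matrix (realised-unit t j k)) (unspan (b α) v∈W) y) ⟩
            w * (matrix (realised-unit t j k) · combine (b α) c) y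
              ≈⟨ K.*-congˡ (unit-combine α j k c y) ⟩
            w * (c k * b α j y)  ≈⟨ K.*-assoc w (c k) (b α j y) ⟨
            w * c k * b α j y  ≈⟨ K.*-congʳ wc≈1 ⟩
            1ℂ * b α j y  ≈⟨ K.*-identityˡ (b α j y) ⟩
            b α j y  ∎)
            (*-closed w (T-closed (member (realised-unit t j k)) v∈W′))))

  -- Isomorphism classes

  -- Coordinates are kept and the basis is exchanged. The premise `joint` supplies one family of
  -- blocks for both sides, so the exchange commutes with T; injectivity makes the result
  -- independent of the chosen coordinates.
  isomorphic : ∀ {s t} → s ≡ t → (f : Fin (dim s) → Vector ℂ n) (g : Fin (dim t) → Vector ℂ n) →
    (∀ {c d} → combine f c 𝕍.≈ᴹ combine f d → c 𝕍.≈ᴹ d) →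
    (∀ {c d} → combine g c 𝕍.≈ᴹ combine g d → c 𝕍.≈ᴹ d) →
    (∀ {M} → T M → Σ[ X ∈ (∀ t → Matrix (dim t)) ] ActsAs M (X s) f × ActsAs M (X t) g) →
    Isomorphic (𝕍.Span f) (𝕍.Span g)
  isomorphic {s} refl f g f-injective g-injective joint = record
    { to        = λ (u , c , eq) → combine g c , span g c λ y → K.refl
    ; from      = λ (u , c , eq) → combine f c , span f c λ y → K.refl
    ; to-cong   = λ {(u , p)} {(v , q)} u≈v → combine-cong g (f-injective {proj₁ p} {proj₁ q} λ y →
        K.trans (K.sym (unspan f p y)) (K.trans (u≈v y) (unspan f q y)))
    ; from-cong = λ {(u , p)} {(v , q)} u≈v → combine-cong f (g-injective {proj₁ p} {proj₁ q} λ y →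
        K.trans (K.sym (unspan g p y)) (K.trans (u≈v y) (unspan g q y)))
    ; to-from   = λ (v , p) y → K.sym (unspan g p y)
    ; from-to   = λ (v , p) y → K.sym (unspan f p y)
    ; additive  = λ p q r y → K.trans
        (combine-cong g (f-injective {proj₁ r} {proj₁ p 𝕍.+ᴹ proj₁ q} λ y → K.trans (K.sym (unspan f r y))
          (K.trans (K.+-cong (unspan f p y) (unspan f q y))
            (K.sym (combine-+ f (proj₁ p) (proj₁ q) y)))) y)
        (combine-+ g (proj₁ p) (proj₁ q) y)
    ; scalar    = λ a p q y → K.trans
        (combine-cong g (f-injective {proj₁ q} {a 𝕍.*ₗ proj₁ p} λ y → K.trans (K.sym (unspan f q y))
          (K.trans (K.*-congˡ (unspan f p y))
            (K.sym (combine-* f a (proj₁ p) y)))) y)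
        (combine-* g a (proj₁ p) y)
    ; commutes  = λ {B} B∈T p q y → let X , X-f , X-g = joint B∈T in K.trans
        (combine-cong g (f-injective {proj₁ q} {X s · proj₁ p} λ y → K.trans (K.sym (unspan f q y))
          (K.trans (·-congʳ B (unspan f p) y) (actsAs-combine X-f (proj₁ p) y))) y)
        (K.sym (actsAs-combine X-g (proj₁ p) y))
    }

  module _ {W₁ W₂ : Subset-V} (φ : Isomorphic W₁ W₂) (W₁-module : IsModule W₁) where
    open Isomorphic φ
    open IsModule W₁-module
    open 𝕍.IsSubspace isSubspace using (*-closed)

    private
      to-≈0 : ∀ {v} (p : W₁ v) → v 𝕍.≈ᴹ 𝕍.0ᴹ → proj₁ (to (v , p)) 𝕍.≈ᴹ 𝕍.0ᴹ
      to-≈0 {v} p v≈0 y = begin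
        proj₁ (to (v , p)) y  ≈⟨ to-cong (λ z → K.trans (v≈0 z) (K.sym (K.zeroˡ (v z)))) y ⟩
        proj₁ (to (_ , *-closed 0ℂ p)) y  ≈⟨ scalar 0ℂ p (*-closed 0ℂ p) y ⟩
        0ℂ * proj₁ (to (v , p)) y  ≈⟨ K.zeroˡ _ ⟩
        0ℂ  ∎

    -- The image of w = Ew is E applied to an element of `W₂`, hence zero, and `from` carries this
    -- back to `w`.
    not-killed-left : ∀ {E} → T E → (∀ {v} → W₂ v → E · v 𝕍.≈ᴹ 𝕍.0ᴹ) →
      ∀ {w} → W₁ w → E · w 𝕍.≈ᴹ w → w 𝕍.≈ᴹ 𝕍.0ᴹ
    not-killed-left {E} E∈T kill {w} p Ew≈w y = begin
      w y  ≈⟨ from-to (w , p) y ⟨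
      proj₁ (from (to (w , p))) y  ≈⟨ from-cong to-w≈to-0 y ⟩
      proj₁ (from (to (_ , *-closed 0ℂ p))) y  ≈⟨ from-to (_ , *-closed 0ℂ p) y ⟩
      0ℂ * w y  ≈⟨ K.zeroˡ (w y) ⟩
      0ℂ  ∎
      where
      -- Linearity is recorded for `to`, not for `from`. Zero is therefore written as the image of
      -- `0ℂ` times `w`, which `from-to` takes back.
      to-w≈to-0 : proj₁ (to (w , p)) 𝕍.≈ᴹ proj₁ (to (_ , *-closed 0ℂ p))
      to-w≈to-0 z = begin
        proj₁ (to (w , p)) z
          ≈⟨ to-cong {(w , p)} {(E · w , T-closed E∈T p)} (λ i → K.sym (Ew≈w i)) z ⟩
        proj₁ (to (E · w , T-closed E∈T p)) z  ≈⟨ commutes E∈T p (T-closed E∈T p) z ⟩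
        (E · proj₁ (to (w , p))) z  ≈⟨ kill (proj₂ (to (w , p))) z ⟩
        0ℂ  ≈⟨ to-≈0 (*-closed 0ℂ p) (λ i → K.zeroˡ (w i)) z ⟨
        proj₁ (to (_ , *-closed 0ℂ p)) z  ∎

    not-killed-right : ∀ {E} → T E → (∀ {v} → W₁ v → E · v 𝕍.≈ᴹ 𝕍.0ᴹ) →
      ∀ {w} → W₂ w → E · w 𝕍.≈ᴹ w → w 𝕍.≈ᴹ 𝕍.0ᴹ
    not-killed-right {E} E∈T kill {w} q Ew≈w y = begin
      w y  ≈⟨ Ew≈w y ⟨
      (E · w) y  ≈⟨ ·-congʳ E (to-from (w , q)) y ⟨
      (E · proj₁ (to (u , p))) y  ≈⟨ commutes E∈T p (T-closed E∈T p) y ⟨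
      proj₁ (to (E · u , T-closed E∈T p)) y  ≈⟨ to-≈0 (T-closed E∈T p) (kill p) y ⟩
      0ℂ  ∎
      where
      u = proj₁ (from (w , q))
      p = proj₂ (from (w , q))

  atLevel-at : ∀ {l} t a → endpt t ℕ.+ toℕ a ≡ l → atLevel l t a ≡ 1ℤ
  atLevel-at {l} t a eq = cong (if_then 1ℤ else 0ℤ) (dec-true (endpt t ℕ.+ toℕ a ℕ.≟ l) eq)

  atLevel-off : ∀ {l} t a → endpt t ℕ.+ toℕ a ≢ l → atLevel l t a ≡ 0ℤ
  atLevel-off {l} t a neq = cong (if_then 1ℤ else 0ℤ) (dec-false (endpt t ℕ.+ toℕ a ℕ.≟ l) neq)

  E*-combine : ∀ l α c →
    E* l · combine (b α) c 𝕍.≈ᴹ combine (b α) λ a → ι (atLevel l (kind α) a) * c a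
  E*-combine l α c y = K.trans (actsAs-combine (E*-acts l α) c y)
    (combine-cong (b α) (level-entry l (kind α) c) y)

  E*-fixes : ∀ {l} α a → endpt (kind α) ℕ.+ toℕ a ≡ l → E* l · b α a 𝕍.≈ᴹ b α a
  E*-fixes {l} α a eq y = begin
    (E* l · b α a) y  ≈⟨ maps (E*-acts l α) a y ⟩
    combine (b α) (λ i → ι (atLevel l t a ℤ.* δ i a)) y
      ≈⟨ combine-cong (b α) (λ i → ≡⇒≈ (cong ι (≡.trans (cong (ℤ._* δ i a) (atLevel-at t a eq)) (ℤ.*-identityˡ (δ i a))))) y ⟩
    combine (b α) (λ i → ι (δ i a)) y  ≈⟨ combine-unit (b α) a y ⟩
    b α a y  ∎
    where t = kind α

  E*-kills : ∀ {l} α → (∀ a → endpt (kind α) ℕ.+ toℕ a ≢ l) → ∀ {v} → W α v → E* l · v 𝕍.≈ᴹ 𝕍.0ᴹ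
  E*-kills {l} α off {v} v∈W y = begin
    (E* l · v) y  ≈⟨ ·-congʳ (E* l) (unspan (b α) v∈W) y ⟩
    (E* l · combine (b α) (proj₁ v∈W)) y  ≈⟨ E*-combine l α (proj₁ v∈W) y ⟩
    combine (b α) (λ a → ι (atLevel l (kind α) a) * proj₁ v∈W a) y  ≈⟨ combine-zero (b α) (λ a → K.trans
      (K.*-congʳ (K.trans (≡⇒≈ (cong ι (atLevel-off (kind α) a (off a)))) ι-0)) (K.zeroˡ (proj₁ v∈W a))) y ⟩
    0ℂ  ∎

  E*∈T : ∀ {l} → l ℕ.≤ 3 → T (E* l)
  E*∈T {l} l≤3 = E*∈ (subst (l ℕ.≤_) (sym D≡3) l≤3)

  levels : ∀ t → ℕ → Set
  levels t l = Σ[ a ∈ Fin (dim t) ] endpt t ℕ.+ toℕ a ≡ l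

  levels? : ∀ t l → Dec (levels t l)
  levels? t l = Fin.any? λ a → endpt t ℕ.+ toℕ a ℕ.≟ l

  -- A level on which exactly one of the two types lives, so that the corresponding `E*` kills one
  -- module and fixes a basis vector of the other.
  Separated : (s t : ModuleType) → Set
  Separated s t = Σ[ l ∈ ℕ ] l ℕ.≤ 3 ×
    (levels s l × (∀ a → endpt t ℕ.+ toℕ {dim t} a ≢ l) ⊎
     (∀ a → endpt s ℕ.+ toℕ {dim s} a ≢ l) × levels t l)

  -- Type I alone is nonzero at level 0, and type III is zero at level 1.
  separating-level : ∀ s t → s ≢ t → Separated s t
  separating-level I   I   s≢t = contradiction refl s≢t
  separating-level II  II  s≢t = contradiction refl s≢t
  separating-level III III s≢t = contradiction refl s≢t
  separating-level I   II  _   = 0 , ℕ.z≤n , inj₁ ((0F , refl) , λ _ ())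
  separating-level I   III _   = 0 , ℕ.z≤n , inj₁ ((0F , refl) , λ _ ())
  separating-level II  I   _   = 0 , ℕ.z≤n , inj₂ ((λ _ ()) , (0F , refl))
  separating-level II  III _   = 1 , ℕ.s≤s ℕ.z≤n , inj₁ ((0F , refl) , λ _ ())
  separating-level III I   _   = 0 , ℕ.z≤n , inj₂ ((λ _ ()) , (0F , refl))
  separating-level III II  _   = 1 , ℕ.s≤s ℕ.z≤n , inj₂ ((λ _ ()) , (0F , refl))

  isomorphic⇔ : ∀ α β → Isomorphic (W α) (W β) ⇔ kind α ≡ kind β
  isomorphic⇔ α β = mk⇔ same-kind λ eq → isomorphic eq (b α) (b β)
    (combine-injective α) (combine-injective β)
    (λ M∈T → let X , X-acts = T-acts M∈T in X , X-acts α , X-acts β)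
    where
    same-kind : Isomorphic (W α) (W β) → kind α ≡ kind β
    same-kind φ = decidable-stable (kind α ≟ᵗ kind β) λ neq → separated (separating-level (kind α) (kind β) neq)
      where
      separated : ¬ Separated (kind α) (kind β)
      separated (l , l≤3 , inj₁ ((a , at) , off)) = b≉0 α a
        (not-killed-left φ (W-isModule α) (E*∈T l≤3) (E*-kills β off) (span-member (b α) a) (E*-fixes α a at))
      separated (l , l≤3 , inj₂ (off , (a , at))) = b≉0 β a
        (not-killed-right φ (W-isModule α) (E*∈T l≤3) (E*-kills α off) (span-member (b β) a) (E*-fixes β a at))

  multiplicity : ∀ α → MultiplicityIn W (W α) Subset.∣ tabulate (λ β → does (kind β ≟ᵗ kind α)) ∣
  multiplicity α = tabulate (λ β → does (kind β ≟ᵗ kind α)) , (λ β → mk⇔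
    (λ β∈ → Equivalence.from (isomorphic⇔ β α) (Equivalence.to (Subsets.∈-tabulate (λ β → kind β ≟ᵗ kind α) β) β∈))
    (λ φ → Equivalence.from (Subsets.∈-tabulate (λ β → kind β ≟ᵗ kind α) β) (Equivalence.to (isomorphic⇔ β α) φ)))
    , refl

  nonzero⇔level : ∀ α l → 𝕍.Nonzero (E* l ⟨ W α ⟩) ⇔ levels (kind α) l
  nonzero⇔level α l = mk⇔ ⇒ ⇐
    where
    ⇒ : 𝕍.Nonzero (E* l ⟨ W α ⟩) → levels (kind α) l
    ⇒ (v , (w , w∈W , v≈) , v≉0) = decidable-stable (levels? (kind α) l) λ ¬p → v≉0 λ y →
      K.trans (v≈ y) (E*-kills α (λ a eq → ¬p (a , eq)) w∈W y)
    ⇐ : levels (kind α) l → 𝕍.Nonzero (E* l ⟨ W α ⟩)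
    ⇐ (a , at) = b α a , (b α a , span-member (b α) a , λ y → K.sym (E*-fixes α a at y)) , b≉0 α a

  -- Within one summand distinct indices have distinct levels, so `E*` keeps a single coordinate.
  level-isBasis : ∀ α a → 𝕍.IsBasis (E* (endpt (kind α) ℕ.+ toℕ a) ⟨ W α ⟩) {1} (λ _ → b α a)
  level-isBasis α a = record
    { members     = λ _ → b α a , span-member (b α) a , λ y → K.sym (E*-fixes α a refl y)
    ; independent = λ { c eq 0F → begin
        c 0F  ≈⟨ K.*-identityʳ (c 0F) ⟨
        c 0F * 1ℂ  ≈⟨ K.*-congˡ ι-1 ⟨
        c 0F * ι 1ℤ  ≡⟨ cong (λ k → c 0F * ι k) (δ-same {i = a} refl) ⟨
        c 0F * ι (δ a a)  ≈⟨ combine-nonzero α {c 0F 𝕍.*ₗ λ i → ι (δ i a)} (λ y → begin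
          combine (b α) (c 0F 𝕍.*ₗ λ i → ι (δ i a)) y  ≈⟨ combine-* (b α) (c 0F) (λ i → ι (δ i a)) y ⟩
          c 0F * combine (b α) (λ i → ι (δ i a)) y  ≈⟨ K.*-congˡ (combine-unit (b α) a y) ⟩
          c 0F * b α a y  ≈⟨ K.+-identityʳ (c 0F * b α a y) ⟨
          c 0F * b α a y + 0ℂ  ≈⟨ eq y ⟩
          0ℂ  ∎) a ⟩
        0ℂ  ∎ }
    ; spanning    = λ {u} (w , w∈W , u≈) →
        let c = proj₁ w∈W
            d = λ i → ι (atLevel l t i) * c i
        in span {k = 1} (λ _ → b α a) (λ _ → d a) λ y → begin
          u y  ≈⟨ u≈ y ⟩
          (E* l · w) y  ≈⟨ ·-congʳ (E* l) (unspan (b α) w∈W) y ⟩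
          (E* l · combine (b α) c) y  ≈⟨ E*-combine l α c y ⟩
          combine (b α) d y  ≈⟨ combine-only (b α) {d} a (λ i i≢a → K.trans
              (K.*-congʳ (K.trans (≡⇒≈ (cong ι (atLevel-off t i λ eq →
              i≢a (Fin.toℕ-injective (ℕ.+-cancelˡ-≡ (endpt t) (toℕ i) (toℕ a) eq))))) ι-0))
              (K.zeroˡ (c i))) y ⟩
          d a * b α a y  ≈⟨ K.+-identityʳ (d a * b α a y) ⟨
          d a * b α a y + 0ℂ  ∎
    }
    where
    t = kind α
    l = endpt t ℕ.+ toℕ a

  -- The diameter `D` equals 3 only propositionally; with `d` generalised, matching on the equation
  -- lets the subset evaluate.
  levels-count : ∀ {d} → d ≡ 3 → ∀ t →
    Subset.∣ tabulate {suc d} (λ i → does (levels? t (toℕ i))) ∣ ≡ suc (diam t)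
  levels-count refl I   = refl
  levels-count refl II  = refl
  levels-count refl III = refl

  level≤3 : ∀ t (a : Fin (dim t)) → endpt t ℕ.+ toℕ a ℕ.≤ 3
  level≤3 = from-yes (allTypes? λ t → Fin.all? λ (a : Fin (dim t)) → endpt t ℕ.+ toℕ a ℕ.≤? 3)

  endpoint≤D : ∀ t (a : Fin (dim t)) → endpt t ℕ.+ toℕ a ℕ.≤ D
  endpoint≤D t a = subst (endpt t ℕ.+ toℕ a ℕ.≤_) (sym D≡3) (level≤3 t a)

  hasData : ∀ α → HasData (W α) (endpt (kind α)) (dim (kind α)) (diam (kind α))
    (replicate (dim (kind α)) 1) (b α) (fromRows (rows (kind α)))
  hasData α = record
    { endpoint    = record
      { r≤D     = subst (ℕ._≤ D) (ℕ.+-identityʳ (endpt t)) (endpoint≤D t zero)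
      ; nonzero = Equivalence.from (nonzero⇔level α (endpt t)) (zero , ℕ.+-identityʳ (endpt t))
      ; minimal = λ {i} i<r nonzero → let a , at = Equivalence.to (nonzero⇔level α i) nonzero in
          ℕ.<⇒≱ i<r (subst (endpt t ℕ.≤_) at (ℕ.m≤m+n (endpt t) (toℕ a)))
      }
    ; dimension   = b α , W-isBasis α
    ; diameter    = tabulate (λ i → does (levels? t (toℕ i))) , (λ i → mk⇔
        (λ i∈ → Equivalence.from (nonzero⇔level α (toℕ i)) (Equivalence.to (∈-levels i) i∈))
        (λ p → Equivalence.from (∈-levels i) (Equivalence.to (nonzero⇔level α (toℕ i)) p)))
        , levels-count D≡3 t
    ; hasShape    = λ i → subst (𝕍.HasDimension (E* (endpt t ℕ.+ toℕ i) ⟨ W α ⟩))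
        (sym (Vec.lookup-replicate i 1)) ((λ _ → b α i) , level-isBasis α i)
    ; isPureBasis = record
      { isBasis    = W-isBasis α
      ; support    = λ i → endpt t ℕ.+ toℕ i
      ; support≤D  = endpoint≤D t
      ; pure       = λ i → (b α i , _ , λ y → K.sym (E*-fixes α i refl y)) , b≉0 α i
      ; increasing = λ i≤j → ℕ.+-monoʳ-≤ (endpt t) i≤j
      }
    ; represents  = λ j y → K.trans (maps (A-acts α) j y)
        (K.sym (≡⇒≈ (𝕍-sum (λ i → complexBlock adjacency t i j 𝕍.*ₗ b α i) y)))
    }
    where
    t = kind α
    ∈-levels : ∀ i → i ∈ tabulate {suc D} (λ i → does (levels? t (toℕ i))) ⇔ levels t (toℕ i)
    ∈-levels = Subsets.∈-tabulate (λ i → levels? t (toℕ i))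

  orthogonalDirectSum : OrthogonalDirectSum W
  orthogonalDirectSum = record
    { directSum  = record
      { decompose = λ v → (λ α → combine (b α) (coord α v)) ,
          (λ α → span (b α) (coord α v) λ y → K.refl) ,
          λ y → K.trans (assemble-coord v y)
            (K.sym (≡⇒≈ (𝕍-sum (λ α → combine (b α) (coord α v)) y)))
      ; unique    = λ {w} {w′} w∈ w′∈ eq α y → K.trans (unspan (b α) (w∈ α) y) (K.trans
          (combine-cong (b α) (coordinates w∈ w′∈ eq α) y) (K.sym (unspan (b α) (w′∈ α) y)))
      }
    ; orthogonal = λ {α} {β} α≢β {u} {v} u∈ v∈ → inner-zero α≢β u∈ v∈
    }
    where
    sum-assemble : ∀ {w} (w∈ : ∀ α → W α (w α)) → 𝕍.sum w 𝕍.≈ᴹ assemble (λ α → proj₁ (w∈ α))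
    sum-assemble {w} w∈ y = K.trans (≡⇒≈ (𝕍-sum w y)) (∑-cong λ α → unspan (b α) (w∈ α) y)
    coordinates : ∀ {w w′} (w∈ : ∀ α → W α (w α)) (w′∈ : ∀ α → W α (w′ α)) →
      𝕍.sum w 𝕍.≈ᴹ 𝕍.sum w′ → ∀ α → proj₁ (w∈ α) 𝕍.≈ᴹ proj₁ (w′∈ α)
    coordinates w∈ w′∈ eq α k = begin
      proj₁ (w∈ α) k  ≈⟨ coord-assemble (λ α → proj₁ (w∈ α)) α k ⟨
      coord α (assemble (λ α → proj₁ (w∈ α))) k
        ≈⟨ coord-cong α (λ y → K.trans (K.sym (sum-assemble w∈ y))
          (K.trans (eq y) (sum-assemble w′∈ y))) k ⟩
      coord α (assemble (λ α → proj₁ (w′∈ α))) k  ≈⟨ coord-assemble (λ α → proj₁ (w′∈ α)) α k ⟩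
      proj₁ (w′∈ α) k  ∎
    inner-zero : ∀ {α β} → α ≢ β → ∀ {u v} → W α u → W β v → inner u v ≈ 0ℂ
    inner-zero {α} {β} α≢β {u} {v} u∈ v∈ = begin
      (∑ λ y → u y * conj (v y))  ≈⟨ ∑-cong (λ y → K.*-comm (u y) (conj (v y))) ⟩
      ⟪ (λ y → conj (v y)) , u ⟫  ≈⟨ ⟪⟫-congʳ (λ y → conj (v y)) (unspan (b α) u∈) ⟩
      ⟪ (λ y → conj (v y)) , combine (b α) c ⟫  ≈⟨ ⟪⟫-combine (λ y → conj (v y)) (b α) c ⟩
      (∑ λ i → c i * ⟪ (λ y → conj (v y)) , b α i ⟫)
        ≈⟨ ∑-zero (λ i → K.trans (K.*-congˡ (left i)) (K.zeroʳ (c i))) ⟩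
      0ℂ  ∎
      where
      c = proj₁ u∈
      d = proj₁ v∈
      conj-v : ∀ y → conj (v y) ≈ ∑ λ j → conj (d j) * conj (b β j y)
      conj-v y = K.trans (conj-cong (unspan (b β) v∈ y)) (K.trans
        (conj-∑ λ j → d j * b β j y) (∑-cong λ j → conj-* (d j) (b β j y)))
      left : ∀ i → ⟪ (λ y → conj (v y)) , b α i ⟫ ≈ 0ℂ
      left i = begin
        ⟪ (λ y → conj (v y)) , b α i ⟫  ≈⟨ ∑-cong (λ y → K.*-comm (conj (v y)) (b α i y)) ⟩
        ⟪ b α i , (λ y → conj (v y)) ⟫  ≈⟨ ⟪⟫-congʳ (b α i) conj-v ⟩
        ⟪ b α i , combine (λ j y → conj (b β j y)) (λ j → conj (d j)) ⟫
          ≈⟨ ⟪⟫-combine (b α i) (λ j y → conj (b β j y)) (λ j → conj (d j)) ⟩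
        (∑ λ j → conj (d j) * inner (b α i) (b β j))
          ≈⟨ ∑-zero (λ j → K.trans (K.*-congˡ (orthogonal α≢β i j)) (K.zeroʳ (conj (d j)))) ⟩
        0ℂ  ∎

  -- The dimension of T

  unitMatrix : Fin 24 → Matrix n
  unitMatrix i = let t , a , b = position i in matrix (realised-unit t a b)

  fromEntriesAt : (Fin 24 → ℂ) → ∀ t → Matrix (dim t)
  fromEntriesAt c t a b = c (index (t , a , b))

  -- The entries of the blocks are the coefficients themselves, arranged by `index`. Independence
  -- and spanning both read off from this, the latter with `acts-unique`.
  combination-acts : ∀ c → Acts (𝕄.linearCombination c unitMatrix) (fromEntriesAt c)
  combination-acts c α = actsAs λ j y → begin
    (𝕄.linearCombination c unitMatrix · b α j) y
      ≈⟨ ∑-cong (λ z → K.*-congʳ (≡⇒≈ (𝕄-sum (λ i → c i 𝕄.*ₗ unitMatrix i) y z))) ⟩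
    (∑ λ z → (∑ λ i → c i * unitMatrix i y z) * b α j z)
      ≈⟨ ∑-cong (λ z → ∑-*ʳ (b α j z) λ i → c i * unitMatrix i y z) ⟩
    (∑ λ z → ∑ λ i → c i * unitMatrix i y z * b α j z)
      ≈⟨ ∑-swap (λ z i → c i * unitMatrix i y z * b α j z) ⟩
    (∑ λ i → ((c i 𝕄.*ₗ unitMatrix i) · b α j) y)
      ≈⟨ ∑-cong (λ i → maps (actsAs-* (c i) (unit-acts i)) j y) ⟩
    (∑ λ i → ∑ λ k → c i * X i k j * b α k y)
      ≈⟨ ∑-swap (λ i k → c i * X i k j * b α k y) ⟩
    (∑ λ k → ∑ λ i → c i * X i k j * b α k y)
      ≈⟨ ∑-cong (λ k → ∑-*ʳ (b α k y) λ i → c i * X i k j) ⟨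
    combine (b α) (λ k → ∑ λ i → c i * X i k j) y
      ≈⟨ combine-cong (b α) (λ k → entry k j) y ⟩
    combine (b α) (λ k → fromEntriesAt c t k j) y ∎
    where
    t = kind α
    X : Fin 24 → Matrix (dim t)
    X i = complexBlock (unitAt (position i)) t
    unit-acts : ∀ i → ActsAs (unitMatrix i) (X i) (b α)
    unit-acts i = acts (let t , a , b = position i in realised-unit t a b) α
    entry : ∀ k j → (∑ λ i → c i * X i k j) ≈ c (index (t , k , j))
    entry k j = K.trans
      (∑-cong λ i → K.trans (K.*-comm (c i) (X i k j))
        (K.*-congʳ (≡⇒≈ (cong ι (unitAt-entry i t k j)))))
      (∑-δ c (index (t , k , j)))

  T-hasDimension : 𝕄.HasDimension T 24
  T-hasDimension = unitMatrix , record
    { members     = λ i → member (let t , a , b = position i in realised-unit t a b)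
    ; independent = λ c eq i → K.trans (≡⇒≈ (cong c (sym (index-position i))))
        (entry-zero c eq (position i))
    ; spanning    = λ {M} M∈T →
        let X , X-acts = T-acts M∈T
            c = λ i → let t , a , b = position i in X t a b
        in c , acts-unique {X = X} X-acts (λ α → actsAs-resp
             (λ k j → ≡⇒≈ (cong (λ p → let t , a , b = p in X t a b) (position-index (kind α , k , j))))
             (combination-acts c α))
    }
    where
    block-zero : ∀ c → 𝕄.linearCombination c unitMatrix 𝕄.≈ᴹ 𝕄.0ᴹ →
      ∀ α k j → c (index (kind α , k , j)) ≈ 0ℂ
    block-zero c eq α k j = combine-nonzero α {λ i → fromEntriesAt c (kind α) i j} (λ y → K.trans
      (K.sym (maps (combination-acts c α) j y))
      (∑-zero λ z → K.trans (K.*-congʳ (eq y z)) (K.zeroˡ (b α j z)))) k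
    entry-zero : ∀ c → 𝕄.linearCombination c unitMatrix 𝕄.≈ᴹ 𝕄.0ᴹ → ∀ p → c (index p) ≈ 0ℂ
    -- Summands 0, 1 and 3 serve as representatives of the three types.
    entry-zero c eq (I   , k , j) = block-zero c eq 0F k j
    entry-zero c eq (II  , k , j) = block-zero c eq 1F k j
    entry-zero c eq (III , k , j) = block-zero c eq 3F k j

-- Eigenvalues and eigenvectors of the blocks

module Spectra where
  open Scalars
  open Sums
  open Blocks
  open Frames using (complexBlock)
  open Complex using (_≈_; _+_; _*_; -_; 0ℂ; 1ℂ)
  open K using (_-_)
  open Solver
  open import Relation.Binary.Reasoning.Setoid K.setoid

  root2 three : ℂ
  root2 = Complex.fromℝ SquareRootOf2.√2
  three = ι (+ 3)

  root2² : root2 * root2 ≈ ι (+ 2)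
  root2² = Complex.mk≈
    (Real.≈-trans (Real.pointwise λ n → lemma₁ (ℝ.seq SquareRootOf2.√2 n)) SquareRootOf2.√2²≈2)
    (Real.pointwise λ n → lemma₂ (ℝ.seq SquareRootOf2.√2 n))
    where
    open import Data.Rational.Base as ℚ using (0ℚ)
    open import Data.Rational.Solver
    module S = +-*-Solver
    lemma₁ : ∀ s → s ℚ.* s ℚ.- 0ℚ ℚ.* 0ℚ ≡ s ℚ.* s
    lemma₁ = S.solve 1 (λ s → s S.:* s S.:- S.con 0ℚ S.:* S.con 0ℚ S.:= s S.:* s) refl
    lemma₂ : ∀ s → s ℚ.* 0ℚ ℚ.+ 0ℚ ℚ.* s ≡ 0ℚ
    lemma₂ = S.solve 1 (λ s → s S.:* S.con 0ℚ S.:+ S.con 0ℚ S.:* s S.:= S.con 0ℚ) refl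

  neg-square : ∀ z → - z * - z ≈ z * z
  neg-square = solve 1 (λ z → :- z :* :- z := z :* z) K.refl

  ι-injective-≢ : ∀ k l → k ℤ.- l ≢ 0ℤ → ¬ (ι k ≈ ι l)
  ι-injective-≢ k l k-l≢0 eq = invertible⇒≉0 (ι-nonzero k-l≢0) (begin
    ι (k ℤ.- l)  ≈⟨ K.trans (ι-+ k (ℤ.- l)) (K.+-congˡ (ι-neg l)) ⟩
    ι k - ι l  ≈⟨ K.+-congʳ eq ⟩
    ι l - ι l  ≈⟨ K.-‿inverseʳ (ι l) ⟩
    0ℂ  ∎)

  -- Passing to squares turns a comparison with an irrational number into one of integers.
  squares-distinct : ∀ {z w} k l → z * z ≈ ι k → w * w ≈ ι l → k ℤ.- l ≢ 0ℤ → ¬ (z ≈ w)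
  squares-distinct k l z² w² k-l≢0 z≈w = ι-injective-≢ k l k-l≢0
    (K.trans (K.sym z²) (K.trans (K.*-cong z≈w z≈w) w²))

  three² : three * three ≈ ι (+ 9)
  three² = K.sym (ι-* (+ 3) (+ 3))

  -three² : - three * - three ≈ ι (+ 9)
  -three² = K.trans (neg-square three) three²

  -root2² : - root2 * - root2 ≈ ι (+ 2)
  -root2² = K.trans (neg-square root2) root2²

  square-invertible : ∀ {z} k → k ≢ 0ℤ → z * z ≈ ι k → Invertible z
  square-invertible {z} k k≢0 z² =
    let w , wk≈1 = ι-nonzero k≢0
    in w * z , K.trans (K.*-assoc w z z) (K.trans (K.*-congˡ z²) wk≈1)

  opposites : ∀ z → z - - z ≈ ι (+ 2) * z
  opposites = solve 1 (λ z → z :- :- z := con (+ 2) :* z) K.refl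

  opposite-invertible : ∀ {z} k → k ≢ 0ℤ → z * z ≈ ι k → Invertible (z - - z)
  opposite-invertible {z} k k≢0 z² = invertible-resp-≈ (K.sym (opposites z))
    (*-invertible (ι-positive 1) (square-invertible k k≢0 z²))

  opposites-distinct : ∀ {z} k → k ≢ 0ℤ → z * z ≈ ι k → ¬ (z ≈ - z)
  opposites-distinct {z} k k≢0 z² eq = invertible⇒≉0 (opposite-invertible k k≢0 z²)
    (K.trans (K.+-congʳ eq) (K.-‿inverseʳ (- z)))

  -- The factors θ + z and θ - z differ by 2z, which is invertible, so `zero-product` decides
  -- between them.
  square-roots : ∀ {θ z} k → k ≢ 0ℤ → z * z ≈ ι k → θ * θ - ι k ≈ 0ℂ → θ ≈ z ⊎ θ ≈ - z
  square-roots {θ} {z} k k≢0 z² eq = split (zero-product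
    (invertible-resp-≈ (solve 2 (λ θ z → z :- :- z :=
        (θ :- :- z) :- (θ :- z)) K.refl θ z) (opposite-invertible k k≢0 z²)) product)
    where
    expand : ∀ θ z → (θ - - z) * (θ - z) ≈ θ * θ - z * z
    expand = solve 2 (λ θ z → (θ :- :- z) :* (θ :- z) := θ :* θ :- z :* z) K.refl
    product : (θ - - z) * (θ - z) ≈ 0ℂ
    product = K.trans (expand θ z) (K.trans (K.+-congˡ (K.-‿cong z²)) eq)
    split : θ - - z ≈ 0ℂ ⊎ θ - z ≈ 0ℂ → θ ≈ z ⊎ θ ≈ - z
    split (inj₁ p) = inj₂ (difference-zero p)
    split (inj₂ p) = inj₁ (difference-zero p)

  -- `P` is the characteristic polynomial of the block of type I, `P₁` that of the other two blocks.
  P₁ P₂ P : ℂ → ℂ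
  P₁ θ = θ * θ - ι (+ 2)
  P₂ θ = θ * θ - ι (+ 9)
  P θ  = P₁ θ * P₂ θ

  -- The two factors differ by the constant 7.
  P-roots : ∀ θ → P θ ≈ 0ℂ → P₁ θ ≈ 0ℂ ⊎ P₂ θ ≈ 0ℂ
  P-roots θ = zero-product (invertible-resp-≈ (solve 1 (λ θ → con (+ 7) :=
      (θ :* θ :- con (+ 2)) :- (θ :* θ :- con (+ 9))) K.refl θ) (ι-positive 6))

  -- The candidate eigenvectors, obtained by solving (block − θ) c = 0 upwards from the last coordinate.
  eigenvector : ∀ t → ℂ → Vector ℂ (dim t)
  eigenvector I   θ = (θ * θ * θ - ι (+ 8) * θ) ▹ (θ * θ - ι (+ 6)) ▹ θ ▹ ι (+ 3) ▹ ⟨⟩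
  eigenvector II  θ = θ ▹ ι (+ 1) ▹ ⟨⟩
  eigenvector III θ = θ ▹ ι (+ 1) ▹ ⟨⟩

  characteristic : ModuleType → ℂ → ℂ
  characteristic I   = P
  characteristic II  = P₁
  characteristic III = P₁

  lastEntry : ∀ t → Fin (dim t)
  lastEntry I   = 3F
  lastEntry II  = 1F
  lastEntry III = 1F

  -- Stored one lower to fit `ι-positive`. For type I the last coordinate is 3 and not 1, which
  -- keeps the others free of fractions.
  pivot : ModuleType → ℕ
  pivot I   = 2
  pivot II  = 0
  pivot III = 0

  Eigen : ∀ t → ℂ → Vector ℂ (dim t) → Set
  Eigen t θ = Eigenspace (complexBlock adjacency t) θ

  private
    row₄ : ∀ {n} → ℕ → ℕ → ℕ → ℕ → (p q r s : Polynomial n) → Polynomial n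
    -- Copies how `∑` unfolds on a row, vanishing terms and the final zero included, so that solved
    -- identities match the eigenvalue equations.
    row₄ j k l m p q r s = con (+ j) :* p :+ (con (+ k) :* q :+ (con (+ l) :* r :+ (con (+ m) :* s :+ con (+ 0))))

    row₂ : ∀ {n} → ℕ → ℕ → (p q : Polynomial n) → Polynomial n
    row₂ j k p q = con (+ j) :* p :+ (con (+ k) :* q :+ con (+ 0))

    cubic quadratic : ∀ {n} → Polynomial n → Polynomial n
    cubic p     = p :* p :* p :- con (+ 8) :* p
    quadratic p = p :* p :- con (+ 6)

    zero-difference : ∀ {z w} → z ≈ w → z - w ≈ 0ℂ
    zero-difference {z} {w} = RingProperties.x≈y⇒x∙y⁻¹≈ε K.ring

  module _ (θ : ℂ) where
    private
      module I₄ (c : Vector ℂ 4) (eq : Eigen I θ c) where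
        c0 = c 0F
        c1 = c 1F
        c2 = c 2F
        c3 = c 3F
        e0 : ι (+ 3) * c1 ≈ θ * c0
        e0 = K.trans (solve 4 (λ c0 c1 c2 c3 → con (+ 3) :* c1 :=
            row₄ 0 3 0 0 c0 c1 c2 c3) K.refl c0 c1 c2 c3) (eq 0F)
        e1 : c0 + ι (+ 2) * c2 ≈ θ * c1
        e1 = K.trans (solve 4 (λ c0 c1 c2 c3 → c0 :+ con (+ 2) :* c2 :=
            row₄ 1 0 2 0 c0 c1 c2 c3) K.refl c0 c1 c2 c3) (eq 1F)
        e2 : c1 + ι (+ 2) * c3 ≈ θ * c2
        e2 = K.trans (solve 4 (λ c0 c1 c2 c3 → c1 :+ con (+ 2) :* c3 :=
            row₄ 0 1 0 2 c0 c1 c2 c3) K.refl c0 c1 c2 c3) (eq 2F)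
        e3 : ι (+ 3) * c2 ≈ θ * c3
        e3 = K.trans (solve 4 (λ c0 c1 c2 c3 → con (+ 3) :* c2 :=
            row₄ 0 0 3 0 c0 c1 c2 c3) K.refl c0 c1 c2 c3) (eq 3F)
        f1 : ι (+ 3) * c1 ≈ c3 * (θ * θ - ι (+ 6))
        f1 = begin
          ι (+ 3) * c1
            ≈⟨ solve 2 (λ c1 c3 → con (+ 3) :* c1 :=
                con (+ 3) :* (c1 :+ con (+ 2) :* c3) :- con (+ 6) :* c3) K.refl c1 c3 ⟩
          ι (+ 3) * (c1 + ι (+ 2) * c3) - ι (+ 6) * c3  ≈⟨ K.+-congʳ (K.*-congˡ e2) ⟩
          ι (+ 3) * (θ * c2) - ι (+ 6) * c3
            ≈⟨ solve 3 (λ θ c2 c3 → con (+ 3) :* (θ :* c2) :- con (+ 6) :* c3 :=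
                θ :* (con (+ 3) :* c2) :- con (+ 6) :* c3) K.refl θ c2 c3 ⟩
          θ * (ι (+ 3) * c2) - ι (+ 6) * c3  ≈⟨ K.+-congʳ (K.*-congˡ e3) ⟩
          θ * (θ * c3) - ι (+ 6) * c3
            ≈⟨ solve 2 (λ θ c3 → θ :* (θ :* c3) :- con (+ 6) :* c3 := c3 :* quadratic θ) K.refl θ c3 ⟩
          c3 * (θ * θ - ι (+ 6))  ∎
        f0 : ι (+ 3) * c0 ≈ c3 * (θ * θ * θ - ι (+ 8) * θ)
        f0 = begin
          ι (+ 3) * c0
            ≈⟨ solve 2 (λ c0 c2 → con (+ 3) :* c0 :=
                con (+ 3) :* (c0 :+ con (+ 2) :* c2) :- con (+ 2) :* (con (+ 3) :* c2)) K.refl c0 c2 ⟩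
          ι (+ 3) * (c0 + ι (+ 2) * c2) - ι (+ 2) * (ι (+ 3) * c2)
            ≈⟨ K.+-cong (K.*-congˡ e1) (K.-‿cong (K.*-congˡ e3)) ⟩
          ι (+ 3) * (θ * c1) - ι (+ 2) * (θ * c3)
            ≈⟨ solve 3 (λ θ c1 c3 → con (+ 3) :* (θ :* c1) :- con (+ 2) :* (θ :* c3) :=
                θ :* (con (+ 3) :* c1) :- con (+ 2) :* (θ :* c3)) K.refl θ c1 c3 ⟩
          θ * (ι (+ 3) * c1) - ι (+ 2) * (θ * c3)  ≈⟨ K.+-congʳ (K.*-congˡ f1) ⟩
          θ * (c3 * (θ * θ - ι (+ 6))) - ι (+ 2) * (θ * c3)
            ≈⟨ solve 2 (λ θ c3 → θ :* (c3 :* quadratic θ) :- con (+ 2) :* (θ :* c3) :=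
                c3 :* cubic θ) K.refl θ c3 ⟩
          c3 * (θ * θ * θ - ι (+ 8) * θ)  ∎
        -- Rows 1 to 3 were spent on expressing 3c0 and 3c1 through c3. Row 0 is the remaining
        -- consistency condition, and after substitution it is P(θ) c3 = 0.
        P-zero : P θ * c3 ≈ 0ℂ
        P-zero = begin
          P θ * c3
            ≈⟨ solve 2 (λ θ c3 → (θ :* θ :- con (+ 2)) :* (θ :* θ :- con (+ 9)) :* c3 :=
                θ :* (c3 :* cubic θ) :- con (+ 3) :* (c3 :* quadratic θ)) K.refl θ c3 ⟩
          θ * (c3 * (θ * θ * θ - ι (+ 8) * θ)) - ι (+ 3) * (c3 * (θ * θ - ι (+ 6)))
            ≈⟨ K.+-cong (K.*-congˡ f0) (K.-‿cong (K.*-congˡ f1)) ⟨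
          θ * (ι (+ 3) * c0) - ι (+ 3) * (ι (+ 3) * c1)
            ≈⟨ K.+-congˡ (K.-‿cong (K.*-congˡ e0)) ⟩
          θ * (ι (+ 3) * c0) - ι (+ 3) * (θ * c0)
            ≈⟨ solve 2 (λ θ c0 → θ :* (con (+ 3) :* c0) :- con (+ 3) :* (θ :* c0) := con (+ 0)) K.refl θ c0 ⟩
          0ℂ ∎

      module II₂ (c : Vector ℂ 2) (eq : Eigen II θ c) where
        c0 = c 0F
        c1 = c 1F
        e0 : ι (+ 2) * c1 ≈ θ * c0
        e0 = K.trans (solve 2 (λ c0 c1 → con (+ 2) :* c1 := row₂ 0 2 c0 c1) K.refl c0 c1) (eq 0F)
        e1 : c0 ≈ θ * c1
        e1 = K.trans (solve 2 (λ c0 c1 → c0 := row₂ 1 0 c0 c1) K.refl c0 c1) (eq 1F)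
        P-zero : P₁ θ * c1 ≈ 0ℂ
        P-zero = begin
          P₁ θ * c1
            ≈⟨ solve 2 (λ θ c1 → (θ :* θ :- con (+ 2)) :* c1 :=
                θ :* (θ :* c1) :- con (+ 2) :* c1) K.refl θ c1 ⟩
          θ * (θ * c1) - ι (+ 2) * c1  ≈⟨ K.+-cong (K.*-congˡ (K.sym e1)) (K.-‿cong e0) ⟩
          θ * c0 - θ * c0  ≈⟨ K.-‿inverseʳ (θ * c0) ⟩
          0ℂ  ∎
        f0 : ι (+ 1) * c0 ≈ c1 * θ
        f0 = K.trans (K.*-identityˡ c0) (K.trans e1 (K.*-comm θ c1))

    characteristic-zero : ∀ t c → Eigen t θ c → characteristic t θ * c (lastEntry t) ≈ 0ℂ
    characteristic-zero I   c eq = I₄.P-zero c eq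
    characteristic-zero II  c eq = II₂.P-zero c eq
    characteristic-zero III c eq = II₂.P-zero c eq

    -- The last coordinate of the candidate eigenvector is the integer 1 + pivot t.
    proportional : ∀ t c → Eigen t θ c → ∀ i →
      ι (+ suc (pivot t)) * c i ≈ c (lastEntry t) * eigenvector t θ i
    proportional I   c eq 0F = I₄.f0 c eq
    proportional I   c eq 1F = I₄.f1 c eq
    proportional I   c eq 2F = K.trans (I₄.e3 c eq) (K.*-comm θ (c 3F))
    proportional I   c eq 3F = K.*-comm (ι (+ 3)) (c 3F)
    proportional II  c eq 0F = II₂.f0 c eq
    proportional II  c eq 1F = K.*-comm (ι (+ 1)) (c 1F)
    proportional III c eq 0F = II₂.f0 c eq
    proportional III c eq 1F = K.*-comm (ι (+ 1)) (c 1F)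

    eigenvector-last : ∀ t → eigenvector t θ (lastEntry t) ≡ ι (+ suc (pivot t))
    eigenvector-last I   = refl
    eigenvector-last II  = refl
    eigenvector-last III = refl

    private
      first-row : characteristic II θ ≈ 0ℂ → (complexBlock adjacency II · eigenvector II θ) 0F ≈ θ * θ
      first-row P₁≈0 = begin
        (complexBlock adjacency II · eigenvector II θ) 0F
          ≈⟨ solve 1 (λ θ → row₂ 0 2 θ (con (+ 1)) := θ :* θ :+ :- (θ :* θ :- con (+ 2))) K.refl θ ⟩
        θ * θ + - P₁ θ  ≈⟨ K.+-congˡ (K.-‿cong P₁≈0) ⟩
        θ * θ + - 0ℂ  ≈⟨ solve 1 (λ θ → θ :* θ :+ :- con (+ 0) := θ :* θ) K.refl θ ⟩
        θ * θ  ∎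
      second-row : ∀ θ → ι (+ 1) * θ + (ι (+ 0) * ι (+ 1) + ι (+ 0)) ≈ θ * ι (+ 1)
      second-row = solve 1 (λ θ → row₂ 1 0 θ (con (+ 1)) := θ :* con (+ 1)) K.refl

    eigenvector-eigen : ∀ t → characteristic t θ ≈ 0ℂ → Eigen t θ (eigenvector t θ)
    eigenvector-eigen I P≈0 0F = begin
      (complexBlock adjacency I · eigenvector I θ) 0F
        ≈⟨ solve 1 (λ θ → row₄ 0 3 0 0 (cubic θ) (quadratic θ) θ (con (+ 3)) :=
            θ :* cubic θ :+ :- ((θ :* θ :- con (+ 2)) :* (θ :* θ :- con (+ 9)))) K.refl θ ⟩
      θ * (θ * θ * θ - ι (+ 8) * θ) + - P θ  ≈⟨ K.+-congˡ (K.-‿cong P≈0) ⟩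
      θ * (θ * θ * θ - ι (+ 8) * θ) + - 0ℂ
        ≈⟨ solve 1 (λ z → z :+ :- con (+ 0) := z) K.refl (θ * (θ * θ * θ - ι (+ 8) * θ)) ⟩
      θ * (θ * θ * θ - ι (+ 8) * θ)  ∎
    eigenvector-eigen I P≈0 1F = solve 1 (λ θ → row₄ 1 0 2 0 (cubic θ) (quadratic θ) θ (con (+ 3)) :=
        θ :* quadratic θ) K.refl θ
    eigenvector-eigen I P≈0 2F = solve 1 (λ θ → row₄ 0 1 0 2 (cubic θ) (quadratic θ) θ (con (+ 3)) :=
        θ :* θ) K.refl θ
    eigenvector-eigen I P≈0 3F = solve 1 (λ θ → row₄ 0 0 3 0 (cubic θ) (quadratic θ) θ (con (+ 3)) :=
        θ :* con (+ 3)) K.refl θ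
    eigenvector-eigen II  P≈0 0F = first-row P≈0
    eigenvector-eigen II  P≈0 1F = second-row θ
    eigenvector-eigen III P≈0 0F = first-row P≈0
    eigenvector-eigen III P≈0 1F = second-row θ

    eigen-multiple : ∀ t c → Eigen t θ c → Σ[ a ∈ ℂ ] ∀ i → c i ≈ a * eigenvector t θ i
    eigen-multiple t c eq = w * c (lastEntry t) , λ i → begin
      c i  ≈⟨ K.*-identityˡ (c i) ⟨
      1ℂ * c i  ≈⟨ K.*-congʳ (proj₂ inv) ⟨
      w * ι (+ suc (pivot t)) * c i  ≈⟨ K.*-assoc w (ι (+ suc (pivot t))) (c i) ⟩
      w * (ι (+ suc (pivot t)) * c i)  ≈⟨ K.*-congˡ (proportional t c eq i) ⟩
      w * (c (lastEntry t) * eigenvector t θ i)  ≈⟨ K.*-assoc w (c (lastEntry t)) (eigenvector t θ i) ⟨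
      w * c (lastEntry t) * eigenvector t θ i  ∎
      where
      inv = ι-positive (pivot t)
      w = proj₁ inv

    eigen-zero : ∀ t c → Eigen t θ c → c (lastEntry t) ≈ 0ℂ → c 𝕍.≈ᴹ 𝕍.0ᴹ
    eigen-zero t c eq last≈0 i = cancel (c i) (ι-positive (pivot t)) (K.trans (proportional t c eq i)
      (K.trans (K.*-congʳ last≈0) (K.zeroˡ (eigenvector t θ i))))

    scalar-zero : ∀ t a → (∀ i → a * eigenvector t θ i ≈ 0ℂ) → a ≈ 0ℂ
    scalar-zero t a eq = cancel a (ι-positive (pivot t)) (K.trans
      (K.*-comm (ι (+ suc (pivot t))) a)
      (K.trans (K.*-congˡ (≡⇒≈ (≡.sym (eigenvector-last t)))) (eq (lastEntry t))))

    eigen-isBasis : ∀ t → characteristic t θ ≈ 0ℂ →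
      𝕍.IsBasis (Eigen t θ) {1} (λ _ → eigenvector t θ)
    eigen-isBasis t χ≈0 = record
      { members     = λ _ → eigenvector-eigen t χ≈0
      ; independent = λ { c eq 0F → scalar-zero t (c 0F) λ i →
          K.trans (K.sym (K.+-identityʳ (c 0F * eigenvector t θ i))) (eq i) }
      ; spanning    = λ {c} eigen → let a , eq = eigen-multiple t c eigen in (λ _ → a) , λ i →
          K.trans (eq i) (K.sym (K.+-identityʳ (a * eigenvector t θ i)))
      }

    -- The characteristic polynomial of every block divides P.
    P-annihilates : ∀ t c → Eigen t θ c → P θ * c (lastEntry t) ≈ 0ℂ
    P-annihilates I   c eq = characteristic-zero I c eq
    P-annihilates II  c eq = begin
      P₁ θ * P₂ θ * c 1F  ≈⟨ solve 3 (λ p q c → p :* q :* c := q :* (p :* c)) K.refl (P₁ θ) (P₂ θ) (c 1F) ⟩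
      P₂ θ * (P₁ θ * c 1F)  ≈⟨ K.*-congˡ (characteristic-zero II c eq) ⟩
      P₂ θ * 0ℂ  ≈⟨ K.zeroʳ (P₂ θ) ⟩
      0ℂ  ∎
    P-annihilates III c eq = P-annihilates II c eq

    -- From P₁ = P₂ + 7. Hence a root of `P₂` is no eigenvalue of the blocks of types II and III.
    characteristic-invertible : P₂ θ ≈ 0ℂ → Invertible (P₁ θ)
    characteristic-invertible P₂≈0 = invertible-resp-≈ (begin
      ι (+ 7)  ≈⟨ K.+-identityˡ (ι (+ 7)) ⟨
      0ℂ + ι (+ 7)  ≈⟨ K.+-congʳ P₂≈0 ⟨
      P₂ θ + ι (+ 7)
        ≈⟨ solve 1 (λ θ → θ :* θ :- con (+ 9) :+ con (+ 7) := θ :* θ :- con (+ 2)) K.refl θ ⟩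
      P₁ θ  ∎) (ι-positive 6)

    characteristic-of-P₁ : ∀ t → P₁ θ ≈ 0ℂ → characteristic t θ ≈ 0ℂ
    characteristic-of-P₁ I   P₁≈0 = K.trans (K.*-congʳ P₁≈0) (K.zeroˡ (P₂ θ))
    characteristic-of-P₁ II  P₁≈0 = P₁≈0
    characteristic-of-P₁ III P₁≈0 = P₁≈0

    characteristic-of-P₂ : P₂ θ ≈ 0ℂ → P θ ≈ 0ℂ
    characteristic-of-P₂ P₂≈0 = K.trans (K.*-congˡ P₂≈0) (K.zeroʳ (P₁ θ))

    P₁-root : P₁ θ ≈ 0ℂ → θ ≈ root2 ⊎ θ ≈ - root2
    P₁-root = square-roots (+ 2) (λ ()) root2²

    P₂-root : P₂ θ ≈ 0ℂ → θ ≈ three ⊎ θ ≈ - three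
    P₂-root = square-roots (+ 9) (λ ()) three²

  P₁-root2 : P₁ root2 ≈ 0ℂ
  P₁-root2 = zero-difference root2²

  P₁--root2 : P₁ (- root2) ≈ 0ℂ
  P₁--root2 = zero-difference -root2²

  P₂-three : P₂ three ≈ 0ℂ
  P₂-three = zero-difference three²

  P₂--three : P₂ (- three) ≈ 0ℂ
  P₂--three = zero-difference -three²

  spectrum : ℕ → ℕ → List (ℂ × ℕ)
  spectrum k l = (three , k) ∷ (root2 , l) ∷ (- root2 , l) ∷ (- three , k) ∷ []

  Distinct : List (ℂ × ℕ) → Set
  Distinct = AllPairs (λ (θ , _) (η , _) → ¬ (θ ≈ η))

  spectrum-distinct : ∀ k l → Distinct (spectrum k l)
  spectrum-distinct k l =
      (squares-distinct (+ 9) (+ 2) three² root2² (λ ()) ∷ squares-distinct (+ 9) (+ 2) three² -root2² (λ ())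
        ∷ opposites-distinct (+ 9) (λ ()) three² ∷ [])
    ∷ (opposites-distinct (+ 2) (λ ()) root2² ∷ squares-distinct (+ 2) (+ 9) root2² -three² (λ ()) ∷ [])
    ∷ (squares-distinct (+ 2) (+ 9) -root2² -three² (λ ()) ∷ [])
    ∷ [] ∷ []

  P-root∈spectrum : ∀ k l θ → P θ ≈ 0ℂ → Any (λ (η , _) → θ ≈ η) (spectrum k l)
  P-root∈spectrum k l θ Pθ≈0 = locate (P-roots θ Pθ≈0)
    where
    locate₁ : θ ≈ root2 ⊎ θ ≈ - root2 → Any (λ (η , _) → θ ≈ η) (spectrum k l)
    locate₁ (inj₁ eq) = there (here eq)
    locate₁ (inj₂ eq) = there (there (here eq))
    locate₂ : θ ≈ three ⊎ θ ≈ - three → Any (λ (η , _) → θ ≈ η) (spectrum k l)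
    locate₂ (inj₁ eq) = here eq
    locate₂ (inj₂ eq) = there (there (there (here eq)))
    locate : P₁ θ ≈ 0ℂ ⊎ P₂ θ ≈ 0ℂ → Any (λ (η , _) → θ ≈ η) (spectrum k l)
    locate (inj₁ P₁≈0) = locate₁ (P₁-root θ P₁≈0)
    locate (inj₂ P₂≈0) = locate₂ (P₂-root θ P₂≈0)

  block-I-spectrum : HasSpectrum (complexBlock adjacency I) (spectrum 1 1)
  block-I-spectrum = record
    { distinct       = spectrum-distinct 1 1
    ; multiplicities =
        basis three (characteristic-of-P₂ three P₂-three) ∷ basis root2 (characteristic-of-P₁ root2 I P₁-root2)
        ∷ basis (- root2) (characteristic-of-P₁ (- root2) I P₁--root2) ∷ basis (- three) (characteristic-of-P₂ (- three) P₂--three) ∷ []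
    ; complete       = λ θ (v , eigen , v≉0) → P-root∈spectrum 1 1 θ (null-or-invertible (P θ) λ inv →
        v≉0 (eigen-zero θ I v eigen (cancel (v 3F) inv (characteristic-zero θ I v eigen))))
    }
    where
    basis : ∀ θ → P θ ≈ 0ℂ → 𝕍.HasDimension (Eigen I θ) 1
    basis θ Pθ≈0 = (λ _ → eigenvector I θ) , eigen-isBasis θ I Pθ≈0

  block-II-spectrum : HasSpectrum (complexBlock adjacency II) ((root2 , 1) ∷ (- root2 , 1) ∷ [])
  block-II-spectrum = record
    { distinct       = (opposites-distinct (+ 2) (λ ()) root2² ∷ []) ∷ [] ∷ []
    ; multiplicities = basis root2 P₁-root2 ∷ basis (- root2) P₁--root2 ∷ []
    ; complete       = λ θ (v , eigen , v≉0) → locate (P₁-root θ (null-or-invertible (P₁ θ) λ inv →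
        v≉0 (eigen-zero θ II v eigen (cancel (v 1F) inv (characteristic-zero θ II v eigen)))))
    }
    where
    basis : ∀ θ → P₁ θ ≈ 0ℂ → 𝕍.HasDimension (Eigen II θ) 1
    basis θ P₁≈0 = (λ _ → eigenvector II θ) , eigen-isBasis θ II P₁≈0
    locate : ∀ {θ} → θ ≈ root2 ⊎ θ ≈ - root2 → Any (λ (η , _) → θ ≈ η) ((root2 , 1) ∷ (- root2 , 1) ∷ [])
    locate (inj₁ eq) = here eq
    locate (inj₂ eq) = there (here eq)

-- The spectrum of the adjacency matrix

module AdjacencySpectrum {n : ℕ} {Γ : ConnectedGraph n} {Γ-dr : DistanceRegular Γ} {x : Fin n}
                         (F : Frames.Frame Γ-dr x) where
  open Scalars
  open Sums
  open LinearMaps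
  open Blocks
  open Spectra
  open Frames
  open Frame F
  open FrameTheory F
  open Complex using (_≈_; _+_; _*_; -_; 0ℂ; 1ℂ)
  open import Relation.Binary.Reasoning.Setoid K.setoid

  A : Matrix n
  A = adjacencyMatrix Γ

  coord-eigen : ∀ θ {v} → Eigenspace A θ v → ∀ α → Eigen (kind α) θ (coord α v)
  coord-eigen θ {v} Av≈θv α i = begin
    (complexBlock adjacency (kind α) · coord α v) i
      ≈⟨ acts-coord {A} {complexBlock adjacency} A-acts α v i ⟨
    coord α (A · v) i  ≈⟨ coord-cong α Av≈θv i ⟩
    coord α (θ 𝕍.*ₗ v) i  ≈⟨ ⟪⟫-* (κ α i) θ v ⟩
    θ * coord α v i  ∎

  combine-eigen : ∀ θ α c → Eigen (kind α) θ c → Eigenspace A θ (combine (b α) c)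
  combine-eigen θ α c eigen y = begin
    (A · combine (b α) c) y  ≈⟨ actsAs-combine (A-acts α) c y ⟩
    combine (b α) (complexBlock adjacency (kind α) · c) y  ≈⟨ combine-cong (b α) eigen y ⟩
    combine (b α) (θ 𝕍.*ₗ c) y  ≈⟨ combine-* (b α) θ c y ⟩
    θ * combine (b α) c y  ∎

  eigenvectorIn : ∀ θ → Fin 6 → Vector ℂ n
  eigenvectorIn θ α = combine (b α) (eigenvector (kind α) θ)

  assemble-eigenvectors : ∀ θ (c : Vector ℂ 6) →
    𝕍.linearCombination c (eigenvectorIn θ) 𝕍.≈ᴹ assemble (λ α → c α 𝕍.*ₗ eigenvector (kind α) θ)
  assemble-eigenvectors θ c y = K.trans (linearCombination≈combine (eigenvectorIn θ) c y)
    (∑-cong λ α → K.sym (combine-* (b α) (c α) (eigenvector (kind α) θ) y))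

  -- A root of `P₁` is a simple eigenvalue of every block, so each summand contributes exactly one
  -- dimension.
  all-blocks-basis : ∀ θ → P₁ θ ≈ 0ℂ → 𝕍.IsBasis (Eigenspace A θ) (eigenvectorIn θ)
  all-blocks-basis θ P₁≈0 = record
    { members     = λ α → combine-eigen θ α (eigenvector (kind α) θ)
        (eigenvector-eigen θ (kind α) (characteristic-of-P₁ θ (kind α) P₁≈0))
    ; independent = λ c eq α → scalar-zero θ (kind α) (c α) λ i → begin
        c α * eigenvector (kind α) θ i
          ≈⟨ coord-assemble (λ α → c α 𝕍.*ₗ eigenvector (kind α) θ) α i ⟨
        coord α (assemble (λ α → c α 𝕍.*ₗ eigenvector (kind α) θ)) i
          ≈⟨ coord-cong α (assemble-eigenvectors θ c) i ⟨
        coord α (𝕍.linearCombination c (eigenvectorIn θ)) i  ≈⟨ coord-cong α eq i ⟩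
        coord α 𝕍.0ᴹ i  ≈⟨ ∑-zero (λ z → K.zeroʳ (κ α i z)) ⟩
        0ℂ  ∎
    ; spanning    = λ {v} eigen →
        let multiple = λ α → eigen-multiple θ (kind α) (coord α v) (coord-eigen θ eigen α)
            c = λ α → proj₁ (multiple α)
        in c , λ y → begin
          v y  ≈⟨ assemble-coord v y ⟩
          assemble (λ α → coord α v) y  ≈⟨ assemble-cong (λ α → proj₂ (multiple α)) y ⟩
          assemble (λ α → c α 𝕍.*ₗ eigenvector (kind α) θ) y  ≈⟨ assemble-eigenvectors θ c y ⟨
          𝕍.linearCombination c (eigenvectorIn θ) y  ∎
    }

  eigen-trivial : ∀ θ → P₂ θ ≈ 0ℂ → ∀ t → t ≢ I → ∀ c → Eigen t θ c → c 𝕍.≈ᴹ 𝕍.0ᴹ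
  eigen-trivial θ P₂≈0 I   t≢I c eigen = contradiction refl t≢I
  eigen-trivial θ P₂≈0 II  t≢I c eigen = eigen-zero θ II c eigen
    (cancel (c 1F) (characteristic-invertible θ P₂≈0) (characteristic-zero θ II c eigen))
  eigen-trivial θ P₂≈0 III t≢I c eigen = eigen-zero θ III c eigen
    (cancel (c 1F) (characteristic-invertible θ P₂≈0) (characteristic-zero θ III c eigen))

  kind≢I : ∀ {α} → α ≢ 0F → kind α ≢ I
  kind≢I {0F} α≢0 _ = α≢0 refl
  kind≢I {1F} _ ()
  kind≢I {2F} _ ()
  kind≢I {3F} _ ()
  kind≢I {4F} _ ()
  kind≢I {5F} _ ()

  -- At a root of `P₂` the coordinates of an eigenvector in the five small summands vanish; only the
  -- simple eigenvalue of the first block remains.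
  first-block-basis : ∀ θ → P₂ θ ≈ 0ℂ → 𝕍.IsBasis (Eigenspace A θ) {1} (λ _ → eigenvectorIn θ 0F)
  first-block-basis θ P₂≈0 = record
    { members     = λ _ → combine-eigen θ 0F (eigenvector I θ)
        (eigenvector-eigen θ I (characteristic-of-P₂ θ P₂≈0))
    ; independent = λ { c eq 0F → scalar-zero θ I (c 0F) (combine-nonzero 0F {c 0F 𝕍.*ₗ eigenvector I θ} λ y → begin
        combine (b 0F) (c 0F 𝕍.*ₗ eigenvector I θ) y  ≈⟨ combine-* (b 0F) (c 0F) (eigenvector I θ) y ⟩
        c 0F * eigenvectorIn θ 0F y  ≈⟨ K.+-identityʳ (c 0F * eigenvectorIn θ 0F y) ⟨
        c 0F * eigenvectorIn θ 0F y + 0ℂ  ≈⟨ eq y ⟩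
        0ℂ  ∎) }
    ; spanning    = λ {v} eigen →
        let a , multiple = eigen-multiple θ I (coord 0F v) (coord-eigen θ eigen 0F)
        in (λ _ → a) , λ y → begin
          v y  ≈⟨ assemble-coord v y ⟩
          assemble (λ α → coord α v) y  ≈⟨ ∑-only 0F (λ α α≢0 → combine-zero (b α)
              (eigen-trivial θ P₂≈0 (kind α) (kind≢I α≢0) (coord α v) (coord-eigen θ eigen α)) y) ⟩
          combine (b 0F) (coord 0F v) y  ≈⟨ combine-cong (b 0F) multiple y ⟩
          combine (b 0F) (a 𝕍.*ₗ eigenvector I θ) y  ≈⟨ combine-* (b 0F) a (eigenvector I θ) y ⟩
          a * eigenvectorIn θ 0F y  ≈⟨ K.+-identityʳ (a * eigenvectorIn θ 0F y) ⟨
          a * eigenvectorIn θ 0F y + 0ℂ  ∎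
    }

  A-spectrum : HasSpectrum A (spectrum 1 6)
  A-spectrum = record
    { distinct       = spectrum-distinct 1 6
    ; multiplicities =
          ((λ _ → eigenvectorIn three 0F) , first-block-basis three P₂-three)
        ∷ (eigenvectorIn root2 , all-blocks-basis root2 P₁-root2)
        ∷ (eigenvectorIn (- root2) , all-blocks-basis (- root2) P₁--root2)
        ∷ ((λ _ → eigenvectorIn (- three) 0F) , first-block-basis (- three) P₂--three)
        ∷ []
    ; complete       = λ θ (v , eigen , v≉0) → P-root∈spectrum 1 6 θ (null-or-invertible (P θ) λ inv →
        v≉0 λ y → K.trans (assemble-coord v y) (∑-zero λ α → combine-zero (b α)
          (eigen-zero θ (kind α) (coord α v) (coord-eigen θ eigen α)
            (cancel (coord α v (lastEntry (kind α))) inv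
              (P-annihilates θ (kind α) (coord α v) (coord-eigen θ eigen α)))) y))
    }

-- The labelled model and its integer identities

-- The Heawood graph seen from a vertex o: o is adjacent to the three u i, and u (s k) to
-- y k false and y k true.  The vertex z p q at distance 3 is adjacent to y 0 p, y 1 q and
-- one of y 2 false, y 2 true; the parity ε of these choices depends on the labelling.
module Model where
  open Sums
  open Blocks

  data Label : Set where
    o : Label
    u : Fin 3 → Label
    y : Fin 3 → Bool → Label
    z : Bool → Bool → Label

  layer : Label → ℕ
  layer o       = 0
  layer (u _)   = 1
  layer (y _ _) = 2
  layer (z _ _) = 3

  label : Fin 14 → Label
  label = lookup
    (o ∷ u 0F ∷ u 1F ∷ u 2F
    ∷ y 0F false ∷ y 0F true ∷ y 1F false ∷ y 1F true ∷ y 2F false ∷ y 2F true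
    ∷ z false false ∷ z false true ∷ z true false ∷ z true true ∷ [])

  code : Bool → Fin 3 → Bool → Bool → Bool
  code ε 0F p q = p
  code ε 1F p q = q
  code ε 2F p q = ε xor (p xor q)

  _==_ : Bool → Bool → Bool
  true  == b = b
  false == b = not b

  module _ (s : Vec (Fin 3) 3) (ε : Bool) where

    adjacent : Label → Label → Bool
    adjacent o       (u _)   = true
    adjacent (u _)   o       = true
    adjacent (u i)   (y k _) = does (lookup s k Fin.≟ i)
    adjacent (y k _) (u i)   = does (lookup s k Fin.≟ i)
    adjacent (y k b) (z p q) = code ε k p q == b
    adjacent (z p q) (y k b) = code ε k p q == b
    adjacent _       _       = false

    sign : Bool → ℤ
    sign false = 1ℤ
    sign true  = -[1+ 0 ]

    -- Index 1 is the image of index 0 under the adjacency: `y k _` sees `u (s k)` alone in layer 1,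
    -- and the value at `o` is zero because the coefficients used below sum to zero.
    seed₁ : Vec ℤ 3 → Fin 2 → Label → ℤ
    seed₁ a 0F (u i)   = lookup a i
    seed₁ a 1F (y k _) = lookup a (lookup s k)
    seed₁ a _  _       = 0ℤ

    -- Index 1 is again the image: at `u i` the opposite signs of a pair cancel, and `z p q` sees
    -- exactly one member of pair `m`, the one given by `code`.
    seed₂ : Fin 3 → Fin 2 → Label → ℤ
    seed₂ m 0F (y k b) = if does (k Fin.≟ m) then sign b else 0ℤ
    seed₂ m 1F (z p q) = sign (code ε m p q)
    seed₂ m _  _       = 0ℤ

    basis : ∀ α → Fin (dim (kind α)) → Label → ℤ
    basis 0F i l = if does (layer l ℕ.≟ toℕ i) then 1ℤ else 0ℤ
    basis 1F = seed₁ (1ℤ ∷ -[1+ 0 ] ∷ 0ℤ ∷ [])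
    basis 2F = seed₁ (1ℤ ∷ 1ℤ ∷ -[1+ 1 ] ∷ [])
    basis 3F = seed₂ 0F
    basis 4F = seed₂ 1F
    basis 5F = seed₂ 2F

    -- 12 divided by the squared norm.
    weight : ∀ α → Fin (dim (kind α)) → ℤ
    weight 0F = lookup (+ 12 ∷ + 4 ∷ + 2 ∷ + 3 ∷ [])
    weight 1F = lookup (+ 6 ∷ + 3 ∷ [])
    weight 2F = lookup (+ 2 ∷ + 1 ∷ [])
    weight 3F = lookup (+ 6 ∷ + 3 ∷ [])
    weight 4F = lookup (+ 6 ∷ + 3 ∷ [])
    weight 5F = lookup (+ 6 ∷ + 3 ∷ [])

    gram : ∀ α → Fin (dim (kind α)) → ∀ β → Fin (dim (kind β)) → ℤ
    gram α i β j = ∑ℤ λ m → basis α i (label m) ℤ.* basis β j (label m)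

    neighbourSum : ∀ α → Fin (dim (kind α)) → Label → ℤ
    neighbourSum α j l = ∑ℤ λ m → (if adjacent l (label m) then 1ℤ else 0ℤ) ℤ.* basis α j (label m)

    record Valid : Set where
      field
        norms      : ∀ α i j → weight α i ℤ.* gram α i α j ≡ + 12 ℤ.* δ i j
        orthogonal : ∀ α β → α ≢ β → ∀ i j → gram α i β j ≡ 0ℤ
        complete   : ∀ l m → (∑ℤ λ α → ∑ℤ λ i → (weight α i ℤ.* basis α i (label m)) ℤ.* basis α i (label l))
                       ≡ + 12 ℤ.* δ m l
        neighbour-sums : ∀ α j l → neighbourSum α j (label l) ≡
                       ∑ℤ λ i → adjacency (kind α) i j ℤ.* basis α i (label l)
        layered    : ∀ α j l → endpt (kind α) ℕ.+ toℕ j ≢ layer (label l) → basis α j (label l) ≡ 0ℤ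

    valid? : Dec Valid
    valid? = map′ (λ (p , q , r , t , v) → record
        { norms = p ; orthogonal = q ; complete = r ; neighbour-sums = t ; layered = v })
      (λ v → let open Valid v in norms , orthogonal , complete , neighbour-sums , layered)
      ((Fin.all? λ α → Fin.all? λ i → Fin.all? λ j → weight α i ℤ.* gram α i α j ℤ.≟ + 12 ℤ.* δ i j)
      ×-dec (Fin.all? λ α → Fin.all? λ β → ¬? (α Fin.≟ β) →-dec
        Fin.all? λ i → Fin.all? λ j → gram α i β j ℤ.≟ 0ℤ)
      ×-dec (Fin.all? λ l → Fin.all? λ m →
        (∑ℤ λ α → ∑ℤ λ i → (weight α i ℤ.* basis α i (label m)) ℤ.* basis α i (label l)) ℤ.≟ + 12 ℤ.* δ m l)
      ×-dec (Fin.all? λ α → Fin.all? λ j → Fin.all? λ l → neighbourSum α j (label l) ℤ.≟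
        ∑ℤ λ i → adjacency (kind α) i j ℤ.* basis α i (label l))
      ×-dec (Fin.all? λ α → Fin.all? λ j → Fin.all? λ l →
        ¬? (endpt (kind α) ℕ.+ toℕ j ℕ.≟ layer (label l)) →-dec basis α j (label l) ℤ.≟ 0ℤ))

  -- Decided by evaluation. The triple is quantified inside the decision and ε is split first, which
  -- leaves closed terms for `from-yes`.
  all-valid : ∀ ε s₀ s₁ s₂ → s₀ ≢ s₁ → s₀ ≢ s₂ → s₁ ≢ s₂ → Valid (s₀ ∷ s₁ ∷ s₂ ∷ []) ε
  all-valid ε = go ε
    where
    all? : ∀ ε → Dec (∀ s₀ s₁ s₂ → s₀ ≢ s₁ → s₀ ≢ s₂ → s₁ ≢ s₂ → Valid (s₀ ∷ s₁ ∷ s₂ ∷ []) ε)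
    all? ε = Fin.all? λ s₀ → Fin.all? λ s₁ → Fin.all? λ s₂ →
      ¬? (s₀ Fin.≟ s₁) →-dec ¬? (s₀ Fin.≟ s₂) →-dec ¬? (s₁ Fin.≟ s₂) →-dec valid? (s₀ ∷ s₁ ∷ s₂ ∷ []) ε
    go : ∀ ε s₀ s₁ s₂ → s₀ ≢ s₁ → s₀ ≢ s₂ → s₁ ≢ s₂ → Valid (s₀ ∷ s₁ ∷ s₂ ∷ []) ε
    go false = from-yes (all? false)
    go true  = from-yes (all? true)

-- Counting with finite enumerations

module Counting where
  -- Pigeonhole principle: punching out a missed value would inject `Fin (suc n)` into `Fin n`.
  injective⇒surjective : ∀ {n} (f : Fin n → Fin n) → Injective _≡_ _≡_ f → ∀ j → ∃[ i ] f i ≡ j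
  injective⇒surjective {suc n} f f-injective j = decidable-stable (Fin.any? λ i → f i Fin.≟ j) λ missed →
    let j≢f = λ i eq → missed (i , sym eq)
    in ℕ.1+n≰n (Fin.injective⇒≤ {f = λ i → punchOut (j≢f i)} λ {i} {k} eq →
         f-injective (Fin.punchOut-injective (j≢f i) (j≢f k) eq))

  record Enum {n} (P : Pred (Fin n) 0ℓ) (k : ℕ) : Set where
    field
      elem      : Fin k → Fin n
      sound     : ∀ i → P (elem i)
      injective : Injective _≡_ _≡_ elem
      complete  : ∀ {w} → P w → ∃[ i ] elem i ≡ w

  open Enum public

  private
    lookup-injective : ∀ {n} {l : List (Fin n)} → Unique l → Injective _≡_ _≡_ (List.lookup l)
    lookup-injective (_ ∷ _)  {zero}  {zero}  _  = refl
    lookup-injective (x∉ ∷ _) {zero}  {suc j} eq = contradiction eq (All.lookup x∉ (∈-lookup j))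
    lookup-injective (x∉ ∷ _) {suc i} {zero}  eq = contradiction (sym eq) (All.lookup x∉ (∈-lookup i))
    lookup-injective (_ ∷ l!) {suc i} {suc j} eq = cong suc (lookup-injective l! eq)

  enum : ∀ {n} {P : Pred (Fin n) 0ℓ} (P? : Decidable P) → Enum P (length (filter P? (allFin n)))
  enum {n} P? = record
    { elem      = List.lookup (filter P? (allFin n))
    ; sound     = λ i → proj₂ (∈-filter⁻ P? {xs = allFin n} (∈-lookup i))
    ; injective = lookup-injective (Unique.filter⁺ P? (Unique.allFin⁺ n))
    ; complete  = λ {w} Pw → let w∈ = ∈-filter⁺ P? (∈-allFin w) Pw in
        Any.index w∈ , sym (Any.lookup-index w∈)
    }

  -- The positions of the `f i` in the enumeration form an injective self-map of `Fin k`, which is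
  -- surjective.
  exhaust : ∀ {n k} {P : Pred (Fin n) 0ℓ} → Enum P k → (f : Fin k → Fin n) → (∀ i → P (f i)) →
    Injective _≡_ _≡_ f → ∀ {w} → P w → ∃[ i ] f i ≡ w
  exhaust E f Pf f-injective Pw =
    let j , elem-j = complete E Pw
        i , i↦j = injective⇒surjective (λ i → proj₁ (complete E (Pf i))) index-injective j
    in i , trans (sym (proj₂ (complete E (Pf i)))) (trans (cong (elem E) i↦j) elem-j)
    where
    index-injective : Injective _≡_ _≡_ (λ i → proj₁ (complete E (Pf i)))
    index-injective {i} {j} eq = f-injective (trans (sym (proj₂ (complete E (Pf i))))
      (trans (cong (elem E) eq) (proj₂ (complete E (Pf j)))))

  at-most-one : ∀ {n} {P : Pred (Fin n) 0ℓ} → Enum P 1 → ∀ {v w} → P v → P w → v ≡ w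
  at-most-one E {v} Pv Pw = proj₂ (exhaust E (λ _ → v) (λ _ → Pv) (λ { {0F} {0F} _ → refl }) Pw)

  at-most-two : ∀ {n} {P : Pred (Fin n) 0ℓ} → Enum P 2 → ∀ {v₁ v₂ v₃} → v₁ ≢ v₂ →
    P v₁ → P v₂ → P v₃ → v₁ ≡ v₃ ⊎ v₂ ≡ v₃
  at-most-two E {v₁} {v₂} v₁≢v₂ P₁ P₂ P₃ = locate (exhaust E f (λ { 0F → P₁ ; 1F → P₂ }) f-injective P₃)
    where
    f = v₁ ▹ v₂ ▹ ⟨⟩
    f-injective : Injective _≡_ _≡_ f
    f-injective {0F} {0F} _  = refl
    f-injective {0F} {1F} eq = contradiction eq v₁≢v₂
    f-injective {1F} {0F} eq = contradiction (sym eq) v₁≢v₂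
    f-injective {1F} {1F} _  = refl
    locate : ∀ {v₃} → (∃[ i ] f i ≡ v₃) → v₁ ≡ v₃ ⊎ v₂ ≡ v₃
    locate (0F , eq) = inj₁ eq
    locate (1F , eq) = inj₂ eq

  at-most-three : ∀ {n} {P : Pred (Fin n) 0ℓ} → Enum P 3 → ∀ {v₁ v₂ v₃ v₄} → v₁ ≢ v₂ → v₁ ≢ v₃ → v₂ ≢ v₃ →
    P v₁ → P v₂ → P v₃ → P v₄ → v₁ ≡ v₄ ⊎ v₂ ≡ v₄ ⊎ v₃ ≡ v₄
  at-most-three E {v₁} {v₂} {v₃} v₁≢v₂ v₁≢v₃ v₂≢v₃ P₁ P₂ P₃ P₄ =
    locate (exhaust E f (λ { 0F → P₁ ; 1F → P₂ ; 2F → P₃ }) f-injective P₄)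
    where
    f = v₁ ▹ v₂ ▹ v₃ ▹ ⟨⟩
    f-injective : Injective _≡_ _≡_ f
    f-injective {0F} {0F} _  = refl
    f-injective {0F} {1F} eq = contradiction eq v₁≢v₂
    f-injective {0F} {2F} eq = contradiction eq v₁≢v₃
    f-injective {1F} {0F} eq = contradiction (sym eq) v₁≢v₂
    f-injective {1F} {1F} _  = refl
    f-injective {1F} {2F} eq = contradiction eq v₂≢v₃
    f-injective {2F} {0F} eq = contradiction (sym eq) v₁≢v₃
    f-injective {2F} {1F} eq = contradiction (sym eq) v₂≢v₃
    f-injective {2F} {2F} _  = refl
    locate : ∀ {v₄} → (∃[ i ] f i ≡ v₄) → v₁ ≡ v₄ ⊎ v₂ ≡ v₄ ⊎ v₃ ≡ v₄
    locate (0F , eq) = inj₁ eq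
    locate (1F , eq) = inj₂ (inj₁ eq)
    locate (2F , eq) = inj₂ (inj₂ eq)

-- From the intersection array to a labelling of the vertices

module Geometry {n : ℕ} {Γ : ConnectedGraph n} (Γ-dr : DistanceRegular Γ)
  (array : DistanceRegular.intersectionArray Γ-dr ≡ (3 ∷ 2 ∷ 2 ∷ [] , 1 ∷ 1 ∷ 3 ∷ [])) where
  open ConnectedGraph Γ
  open DistanceRegular Γ-dr
  open Counting

  D≡3 : D ≡ 3
  D≡3 = trans (sym (trans (List.length-map b (upTo D)) (List.length-upTo D)))
    (cong (λ a → length (proj₁ a)) array)

  private
    bs : map b (upTo 3) ≡ 3 ∷ 2 ∷ 2 ∷ []
    bs = subst (λ k → map b (upTo k) ≡ 3 ∷ 2 ∷ 2 ∷ []) D≡3 (cong proj₁ array)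

    cs : map (λ i → c (suc i)) (upTo 3) ≡ 1 ∷ 1 ∷ 3 ∷ []
    cs = subst (λ k → map (λ i → c (suc i)) (upTo k) ≡ 1 ∷ 1 ∷ 3 ∷ []) D≡3 (cong proj₂ array)

  b₀≡3 : p 0 1 1 ≡ 3
  b₀≡3 = List.∷-injectiveˡ bs

  b₁≡2 : p 1 1 2 ≡ 2
  b₁≡2 = List.∷-injectiveˡ (List.∷-injectiveʳ bs)

  b₂≡2 : p 2 1 3 ≡ 2
  b₂≡2 = List.∷-injectiveˡ (List.∷-injectiveʳ (List.∷-injectiveʳ bs))

  c₁≡1 : p 1 1 0 ≡ 1
  c₁≡1 = List.∷-injectiveˡ cs

  c₂≡1 : p 2 1 1 ≡ 1
  c₂≡1 = List.∷-injectiveˡ (List.∷-injectiveʳ cs)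

  c₃≡3 : p 3 1 2 ≡ 3
  c₃≡3 = List.∷-injectiveˡ (List.∷-injectiveʳ (List.∷-injectiveʳ cs))

  private
    reverse : ∀ {k v w} → Walk Adj k v w → Walk Adj k w v
    reverse walk = subst (λ k → Walk Adj k _ _) (ℕ.+-identityʳ _) (onto walk [])
      where
      onto : ∀ {k l v w t} → Walk Adj k v w → Walk Adj l v t → Walk Adj (k ℕ.+ l) w t
      onto [] acc = acc
      onto {suc k} {l} {w = w} {t} (a ∷ walk) acc = subst (λ m → Walk Adj m w t) (ℕ.+-suc k l) (onto walk (adj-sym a ∷ acc))

  d-sym : ∀ v w → d v w ≡ d w v
  d-sym v w = ℕ.≤-antisym (d-minimal (reverse (d-attained w v))) (d-minimal (reverse (d-attained v w)))

  d-refl : ∀ v → d v v ≡ 0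
  d-refl v = ℕ.n≤0⇒n≡0 (d-minimal [])

  d≡0⇒≡ : ∀ {v w} → d v w ≡ 0 → v ≡ w
  d≡0⇒≡ {v} {w} eq = trivial (subst (λ k → Walk Adj k v w) eq (d-attained v w))
    where
    trivial : ∀ {v w} → Walk Adj 0 v w → v ≡ w
    trivial [] = refl

  d≡1⇒adj : ∀ {v w} → d v w ≡ 1 → Adj v w
  d≡1⇒adj {v} {w} eq = step (subst (λ k → Walk Adj k v w) eq (d-attained v w))
    where
    step : ∀ {v w} → Walk Adj 1 v w → Adj v w
    step (a ∷ []) = a

  adj⇒d≡1 : ∀ {v w} → Adj v w → d v w ≡ 1
  adj⇒d≡1 {v} {w} a = ℕ.≤-antisym (d-minimal (a ∷ [])) (ℕ.n≢0⇒n>0 λ eq → adj-irrefl (d≡0⇒≡ eq) a)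

  private
    count : ∀ {h i j k} → h ℕ.≤ 3 → i ℕ.≤ 3 → j ℕ.≤ 3 → p h i j ≡ k → ∀ {v w} → d v w ≡ h →
      Enum (λ t → d v t ≡ i × d w t ≡ j) k
    count {h} {i} {j} h≤3 i≤3 j≤3 eq {v} {w} dvw =
      subst (Enum _) (trans (intersection (≤D h≤3) (≤D i≤3) (≤D j≤3) dvw) eq)
        (enum λ t → (d v t ℕ.≟ i) ×-dec (d w t ℕ.≟ j))
      where
      ≤D : ∀ {k} → k ℕ.≤ 3 → k ℕ.≤ D
      ≤D {k} = subst (k ℕ.≤_) (sym D≡3)

    0≤3 : 0 ℕ.≤ 3
    0≤3 = ℕ.z≤n

    1≤3 : 1 ℕ.≤ 3
    1≤3 = ℕ.s≤s ℕ.z≤n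

    2≤3 : 2 ℕ.≤ 3
    2≤3 = ℕ.s≤s (ℕ.s≤s ℕ.z≤n)

  -- The valency is b₀, that is `p 0 1 1` at the pair (v, v); this accounts for the doubled
  -- condition.
  neighbours : ∀ v → Enum (λ t → d v t ≡ 1 × d v t ≡ 1) 3
  neighbours v = count 0≤3 1≤3 1≤3 b₀≡3 (d-refl v)

  module _ {x v : Fin n} where

    up₁ : d x v ≡ 1 → Enum (λ t → d v t ≡ 1 × d x t ≡ 2) 2
    up₁ eq = count 1≤3 1≤3 2≤3 b₁≡2 (trans (d-sym v x) eq)

    up₂ : d x v ≡ 2 → Enum (λ t → d v t ≡ 1 × d x t ≡ 3) 2
    up₂ eq = count 2≤3 1≤3 ℕ.≤-refl b₂≡2 (trans (d-sym v x) eq)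

    down₁ : d x v ≡ 1 → Enum (λ t → d v t ≡ 1 × d x t ≡ 0) 1
    down₁ eq = count 1≤3 1≤3 0≤3 c₁≡1 (trans (d-sym v x) eq)

    down₂ : d x v ≡ 2 → Enum (λ t → d v t ≡ 1 × d x t ≡ 1) 1
    down₂ eq = count 2≤3 1≤3 1≤3 c₂≡1 (trans (d-sym v x) eq)

    down₃ : d x v ≡ 3 → Enum (λ t → d v t ≡ 1 × d x t ≡ 2) 3
    down₃ eq = count ℕ.≤-refl 1≤3 2≤3 c₃≡3 (trans (d-sym v x) eq)

  d≤3 : ∀ v w → d v w ℕ.≤ 3
  d≤3 v w = subst (d v w ℕ.≤_) D≡3 (d≤D v w)

  -- Γ is bipartite: cᵢ + bᵢ = 3 leaves no neighbour on the same level.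
  level-step : ∀ {x v w} → Adj v w → d x w ≡ suc (d x v) ⊎ suc (d x w) ≡ d x v
  level-step {x} {v} {w} a = step (d x v) refl (d≤3 x v)
    where
    a₁ : d v w ≡ 1 × d v w ≡ 1
    a₁ = adj⇒d≡1 a , adj⇒d≡1 a
    middle : ∀ h → Enum (λ t → d v t ≡ 1 × d x t ≡ h) 1 → Enum (λ t → d v t ≡ 1 × d x t ≡ suc (suc h)) 2 →
      d x w ≡ suc (suc h) ⊎ suc (d x w) ≡ suc h
    middle h down up = locate (at-most-three (neighbours v)
      (down≢up 0F) (down≢up 1F) (λ eq → contradiction (injective up eq) λ ())
      (twice (proj₁ (sound down 0F))) (twice (proj₁ (sound up 0F))) (twice (proj₁ (sound up 1F))) a₁)
      where
      twice : ∀ {t} → d v t ≡ 1 → d v t ≡ 1 × d v t ≡ 1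
      twice eq = eq , eq
      down≢up : ∀ i → elem down 0F ≢ elem up i
      down≢up i eq = ℕ.<⇒≢ (ℕ.m≤n+m (suc h) 1)
        (trans (sym (proj₂ (sound down 0F))) (trans (cong (d x) eq) (proj₂ (sound up i))))
      locate : elem down 0F ≡ w ⊎ elem up 0F ≡ w ⊎ elem up 1F ≡ w → d x w ≡ suc (suc h) ⊎ suc (d x w) ≡ suc h
      locate (inj₁ eq)        = inj₂ (cong suc (trans (cong (d x) (sym eq)) (proj₂ (sound down 0F))))
      locate (inj₂ (inj₁ eq)) = inj₁ (trans (cong (d x) (sym eq)) (proj₂ (sound up 0F)))
      locate (inj₂ (inj₂ eq)) = inj₁ (trans (cong (d x) (sym eq)) (proj₂ (sound up 1F)))
    step : ∀ h → d x v ≡ h → h ℕ.≤ 3 → d x w ≡ suc h ⊎ suc (d x w) ≡ h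
    step 0 eq _ = inj₁ (trans (cong (λ t → d t w) (d≡0⇒≡ eq)) (adj⇒d≡1 a))
    step 1 eq _ = middle 0 (down₁ eq) (up₁ eq)
    step 2 eq _ = middle 1 (down₂ eq) (up₂ eq)
    step 3 eq _ =
      let down = down₃ eq
          i , elem≡w = exhaust (neighbours v) (elem down)
            (λ i → proj₁ (sound down i) , proj₁ (sound down i)) (injective down) a₁
      in inj₂ (cong suc (trans (cong (d x) (sym elem≡w)) (proj₂ (sound down i))))
    step (suc (suc (suc (suc _)))) _ (ℕ.s≤s (ℕ.s≤s (ℕ.s≤s ())))

  -- Seen from `v`, the vertex `v′` is one level away from the neighbour `w`, hence at distance 0 or
  -- 2. It is not `v`, and at distance 2 common neighbours are unique as c₂ = 1.
  no-square : ∀ {v v′ w w′} → v ≢ v′ → w ≢ w′ → Adj v w → Adj v w′ → Adj v′ w → Adj v′ w′ → ⊥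
  no-square {v} {v′} {w} {w′} v≢v′ w≢w′ vw vw′ v′w v′w′ = w≢w′ (at-most-one
    (count 2≤3 1≤3 1≤3 c₂≡1 dvv′) (adj⇒d≡1 vw , adj⇒d≡1 v′w) (adj⇒d≡1 vw′ , adj⇒d≡1 v′w′))
    where
    two : d v v′ ≡ suc 1 ⊎ suc (d v v′) ≡ 1 → d v v′ ≡ 2
    two (inj₁ eq) = eq
    two (inj₂ eq) = contradiction (d≡0⇒≡ (ℕ.suc-injective eq)) v≢v′
    dvv′ : d v v′ ≡ 2
    dvv′ = two (subst (λ k → d v v′ ≡ suc k ⊎ suc (d v v′) ≡ k) (adj⇒d≡1 vw) (level-step {v} (adj-sym v′w)))

  module Labelling (x : Fin n) (U : Fin 3 → Fin n) (Y′ : Fin 6 → Fin n)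
    (U-orders : OrdersSphere Γ 1 x U) (Y-orders : OrdersSphere Γ 2 x Y′)
    (common₀ : CommonNeighbourIn₁ Γ x (Y′ 0F) (Y′ 1F))
    (common₁ : CommonNeighbourIn₁ Γ x (Y′ 2F) (Y′ 3F))
    (common₂ : CommonNeighbourIn₁ Γ x (Y′ 4F) (Y′ 5F)) where
    open OrdersSphere
    open Model

    side : Fin 3 → Bool → Fin 6
    side 0F false = 0F
    side 0F true  = 1F
    side 1F false = 2F
    side 1F true  = 3F
    side 2F false = 4F
    side 2F true  = 5F

    unside : Fin 6 → Fin 3 × Bool
    unside 0F = 0F , false
    unside 1F = 0F , true
    unside 2F = 1F , false
    unside 3F = 1F , true
    unside 4F = 2F , false
    unside 5F = 2F , true

    unside-side : ∀ k b → unside (side k b) ≡ (k , b)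
    unside-side 0F false = refl
    unside-side 0F true  = refl
    unside-side 1F false = refl
    unside-side 1F true  = refl
    unside-side 2F false = refl
    unside-side 2F true  = refl

    side-unside : ∀ j → side (proj₁ (unside j)) (proj₂ (unside j)) ≡ j
    side-unside 0F = refl
    side-unside 1F = refl
    side-unside 2F = refl
    side-unside 3F = refl
    side-unside 4F = refl
    side-unside 5F = refl

    Y : Fin 3 → Bool → Fin n
    Y k b = Y′ (side k b)

    Y-injective : ∀ {k b k′ b′} → Y k b ≡ Y k′ b′ → (k , b) ≡ (k′ , b′)
    Y-injective {k} {b} {k′} {b′} eq = trans (sym (unside-side k b))
      (trans (cong unside (injective Y-orders eq)) (unside-side k′ b′))

    dU : ∀ i → d x (U i) ≡ 1
    dU i = Equivalence.from (covers U-orders (U i)) (i , refl)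

    dY : ∀ k b → d x (Y k b) ≡ 2
    dY k b = Equivalence.from (covers Y-orders (Y k b)) (side k b , refl)

    U-covers : ∀ {v} → d x v ≡ 1 → ∃[ i ] U i ≡ v
    U-covers {v} = Equivalence.to (covers U-orders v)

    Y-covers : ∀ {v} → d x v ≡ 2 → Σ[ k ∈ Fin 3 ] Σ[ b ∈ Bool ] Y k b ≡ v
    Y-covers {v} eq =
      let j , Y′j≡v = Equivalence.to (covers Y-orders v) eq
      in proj₁ (unside j) , proj₂ (unside j) , trans (cong Y′ (side-unside j)) Y′j≡v

    centre : ∀ k → ∃[ i ] ∀ b → Adj (U i) (Y k b)
    centre k =
      let w , dxw , a , a′ = common k
          i , Ui≡w = U-covers dxw
      in i , λ { false → subst (λ t → Adj t (Y k false)) (sym Ui≡w) a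
               ; true  → subst (λ t → Adj t (Y k true)) (sym Ui≡w) a′ }
      where
      common : ∀ k → CommonNeighbourIn₁ Γ x (Y k false) (Y k true)
      common 0F = common₀
      common 1F = common₁
      common 2F = common₂

    s : Fin 3 → Fin 3
    s k = proj₁ (centre k)

    U-Y : ∀ k b → Adj (U (s k)) (Y k b)
    U-Y k = proj₂ (centre k)

    U-unique : ∀ {i k b} → Adj (U i) (Y k b) → s k ≡ i
    U-unique {i} {k} {b} a = injective U-orders (at-most-one (down₂ (dY k b))
      (adj⇒d≡1 (adj-sym (U-Y k b)) , dU (s k)) (adj⇒d≡1 (adj-sym a) , dU i))

    -- The b₁ = 2 upper neighbours of `U (s k)` are already the two members of pair `k`.
    s-injective : ∀ k k′ → k ≢ k′ → s k ≢ s k′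
    s-injective k k′ k≢k′ eq = absurd (at-most-two (up₁ (dU (s k)))
      (λ eq → contradiction (,-injectiveʳ (Y-injective {k} {false} {k} {true} eq)) λ ())
      (adj⇒d≡1 (U-Y k false) , dY k false) (adj⇒d≡1 (U-Y k true) , dY k true)
      (adj⇒d≡1 (subst (λ i → Adj (U i) (Y k′ false)) (sym eq) (U-Y k′ false)) , dY k′ false))
      where
      absurd : Y k false ≡ Y k′ false ⊎ Y k true ≡ Y k′ false → ⊥
      absurd (inj₁ eq) = k≢k′ (,-injectiveˡ (Y-injective {k} {false} {k′} {false} eq))
      absurd (inj₂ eq) = k≢k′ (,-injectiveˡ (Y-injective {k} {true} {k′} {false} eq))

    -- Otherwise both members of pair `k` would form a square with `U (s k)` and `v`.
    bit-unique : ∀ {v} → d x v ≡ 3 → ∀ k {b b′} → Adj (Y k b) v → Adj (Y k b′) v → b ≡ b′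
    bit-unique {v} dxv k {b} {b′} a a′ = decidable-stable (b Bool.≟ b′) λ b≢b′ →
      no-square {Y k b} {Y k b′} {U (s k)} {v}
        (λ eq → b≢b′ (,-injectiveʳ (Y-injective {k} {b} {k} {b′} eq)))
        (λ eq → contradiction (trans (sym (dU (s k))) (trans (cong (d x) eq) dxv)) λ ())
        (adj-sym (U-Y k b)) a (adj-sym (U-Y k b′)) a′

    -- By `bit-unique` the c₃ = 3 lower neighbours of `v` lie in different pairs, so they meet all
    -- three pairs.
    bit : ∀ {v} → d x v ≡ 3 → ∀ k → Σ[ b ∈ Bool ] Adj (Y k b) v
    bit {v} dxv k =
      let i , eq = injective⇒surjective pair pair-injective k
      in proj₁ (proj₂ (Y-of i)) , subst (λ k → Adj (Y k (proj₁ (proj₂ (Y-of i)))) v) eq (adjacent-Y i)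
      where
      E = down₃ dxv
      Y-of : ∀ i → Σ[ k ∈ Fin 3 ] Σ[ b ∈ Bool ] Y k b ≡ elem E i
      Y-of i = Y-covers (proj₂ (sound E i))
      pair : Fin 3 → Fin 3
      pair i = proj₁ (Y-of i)
      adjacent-Y : ∀ i → Adj (Y (pair i) (proj₁ (proj₂ (Y-of i)))) v
      adjacent-Y i = subst (λ t → Adj t v) (sym (proj₂ (proj₂ (Y-of i))))
        (adj-sym (d≡1⇒adj (proj₁ (sound E i))))
      pair-injective : Injective _≡_ _≡_ pair
      pair-injective {i} {j} eq = injective E (trans (sym (proj₂ (proj₂ (Y-of i))))
        (trans (cong₂ Y eq (bit-unique dxv (pair j) (subst (λ k → Adj (Y k _) v) eq (adjacent-Y i)) (adjacent-Y j)))
          (proj₂ (proj₂ (Y-of j)))))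

    -- Two vertices with two common neighbours would span a square.
    determined : ∀ {v v′} → d x v ≡ 3 → d x v′ ≡ 3 → ∀ {k b k′ b′} → k ≢ k′ →
      Adj (Y k b) v → Adj (Y k′ b′) v → Adj (Y k b) v′ → Adj (Y k′ b′) v′ → v ≡ v′
    determined {v} {v′} dxv dxv′ {k} {b} {k′} {b′} k≢k′ a₁ a₂ a₃ a₄ = decidable-stable (v Fin.≟ v′) λ v≢v′ →
      no-square v≢v′ (λ eq → k≢k′ (,-injectiveˡ (Y-injective {k} {b} {k′} {b′} eq)))
        (adj-sym a₁) (adj-sym a₂) (adj-sym a₃) (adj-sym a₄)

    -- `Y 0F p` has b₂ = 2 neighbours at distance 3 from `x`. By `determined` their bits in pair 1
    -- differ, so one of these bits is `q`.
    corner : ∀ p q → Σ[ v ∈ Fin n ] d x v ≡ 3 × Adj (Y 0F p) v × Adj (Y 1F q) v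
    corner p q = choose (proj₁ (bit₁ 0F) Bool.≟ q)
      where
      E = up₂ (dY 0F p)
      bit₁ : ∀ i → Σ[ b ∈ Bool ] Adj (Y 1F b) (elem E i)
      bit₁ i = bit (proj₂ (sound E i)) 1F
      adjacent₀ : ∀ i → Adj (Y 0F p) (elem E i)
      adjacent₀ i = d≡1⇒adj (proj₁ (sound E i))
      bits-differ : proj₁ (bit₁ 0F) ≢ proj₁ (bit₁ 1F)
      bits-differ eq = contradiction (injective E {0F} {1F} (determined (proj₂ (sound E 0F)) (proj₂ (sound E 1F))
        {0F} {p} {1F} {proj₁ (bit₁ 1F)} (λ ())
        (adjacent₀ 0F) (subst (λ b → Adj (Y 1F b) (elem E 0F)) eq (proj₂ (bit₁ 0F)))
        (adjacent₀ 1F) (proj₂ (bit₁ 1F)))) λ ()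
      other : ∀ {b b′ q : Bool} → b ≢ b′ → b ≢ q → b′ ≡ q
      other {false} {false} b≢b′ _   = contradiction refl b≢b′
      other {false} {true}  {false} _ b≢q = contradiction refl b≢q
      other {false} {true}  {true}  _ _   = refl
      other {true}  {true}  b≢b′ _   = contradiction refl b≢b′
      other {true}  {false} {true}  _ b≢q = contradiction refl b≢q
      other {true}  {false} {false} _ _   = refl
      choose : Dec (proj₁ (bit₁ 0F) ≡ q) → Σ[ v ∈ Fin n ] d x v ≡ 3 × Adj (Y 0F p) v × Adj (Y 1F q) v
      choose (yes eq) = elem E 0F , proj₂ (sound E 0F) , adjacent₀ 0F ,
        subst (λ b → Adj (Y 1F b) (elem E 0F)) eq (proj₂ (bit₁ 0F))
      choose (no neq) = elem E 1F , proj₂ (sound E 1F) , adjacent₀ 1F ,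
        subst (λ b → Adj (Y 1F b) (elem E 1F)) (other bits-differ neq) (proj₂ (bit₁ 1F))

    Z : Bool → Bool → Fin n
    Z p q = proj₁ (corner p q)

    dZ : ∀ p q → d x (Z p q) ≡ 3
    dZ p q = proj₁ (proj₂ (corner p q))

    Y-Z₀ : ∀ p q → Adj (Y 0F p) (Z p q)
    Y-Z₀ p q = proj₁ (proj₂ (proj₂ (corner p q)))

    Y-Z₁ : ∀ p q → Adj (Y 1F q) (Z p q)
    Y-Z₁ p q = proj₂ (proj₂ (proj₂ (corner p q)))

    third : Bool → Bool → Bool
    third p q = proj₁ (bit (dZ p q) 2F)

    Y-Z₂ : ∀ p q → Adj (Y 2F (third p q)) (Z p q)
    Y-Z₂ p q = proj₂ (bit (dZ p q) 2F)

    -- With equal third bits, `Z false q` and `Z true q` would share neighbours in pairs 1 and 2 and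
    -- coincide, although their bits in pair 0 differ.
    third-flipˡ : ∀ q → third true q ≡ not (third false q)
    third-flipˡ q = Bool.¬-not λ eq → contradiction
      (bit-unique (dZ true q) 0F {true} {false} (Y-Z₀ true q) (subst (Adj (Y 0F false))
        (determined (dZ false q) (dZ true q) {1F} {q} {2F} {third true q} (λ ())
          (Y-Z₁ false q) (subst (λ b → Adj (Y 2F b) (Z false q)) (sym eq) (Y-Z₂ false q))
          (Y-Z₁ true q) (Y-Z₂ true q))
        (Y-Z₀ false q))) λ ()

    third-flipʳ : ∀ p → third p true ≡ not (third p false)
    third-flipʳ p = Bool.¬-not λ eq → contradiction
      (bit-unique (dZ p true) 1F {true} {false} (Y-Z₁ p true) (subst (Adj (Y 1F false))
        (determined (dZ p false) (dZ p true) {0F} {p} {2F} {third p true} (λ ())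
          (Y-Z₀ p false) (subst (λ b → Adj (Y 2F b) (Z p false)) (sym eq) (Y-Z₂ p false))
          (Y-Z₀ p true) (Y-Z₂ p true))
        (Y-Z₁ p false))) λ ()

    ε : Bool
    ε = third false false

    -- Flipping either argument flips `third`, so it is an affine function of the two bits and its
    -- value at (false, false) fixes it.
    third-code : ∀ p q → third p q ≡ code ε 2F p q
    third-code p q = parity p q (third-flipˡ false) (third-flipʳ false) (third-flipʳ true)
      where
      parity : ∀ p q → third true false ≡ not ε → third false true ≡ not ε → third true true ≡ not (third true false) →
        third p q ≡ ε xor (p xor q)
      parity false false _ _ _ = sym (Bool.xor-identityʳ ε)
      parity false true  _ f _ = trans f (sym (Bool.xor-comm ε true))
      parity true  false t _ _ = trans t (sym (Bool.xor-comm ε true))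
      parity true  true  t _ r = trans r (trans (cong not t) (trans (Bool.not-involutive ε) (sym (Bool.xor-identityʳ ε))))

    Y-Z : ∀ k p q → Adj (Y k (code ε k p q)) (Z p q)
    Y-Z 0F p q = Y-Z₀ p q
    Y-Z 1F p q = Y-Z₁ p q
    Y-Z 2F p q = subst (λ b → Adj (Y 2F b) (Z p q)) (third-code p q) (Y-Z₂ p q)

    place : Label → Fin n
    place o       = x
    place (u i)   = U i
    place (y k b) = Y k b
    place (z p q) = Z p q

    d-place : ∀ l → d x (place l) ≡ layer l
    d-place o       = d-refl x
    d-place (u i)   = dU i
    d-place (y k b) = dY k b
    d-place (z p q) = dZ p q

    sᵛ : Vec (Fin 3) 3
    sᵛ = s 0F ∷ s 1F ∷ s 2F ∷ []

    lookup-sᵛ : ∀ k → lookup sᵛ k ≡ s k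
    lookup-sᵛ 0F = refl
    lookup-sᵛ 1F = refl
    lookup-sᵛ 2F = refl

    private
      ==-complete : ∀ {b b′} → b ≡ b′ → b == b′ ≡ true
      ==-complete {true}  refl = refl
      ==-complete {false} refl = refl

      ==-sound : ∀ b b′ → b == b′ ≡ true → b ≡ b′
      ==-sound true  true  _ = refl
      ==-sound false false _ = refl

      does-sound : ∀ {P : Set} (P? : Dec P) → does P? ≡ true → P
      does-sound (yes p) _ = p

      levels-differ : ∀ {l m} → Adj (place l) (place m) → layer m ≡ suc (layer l) ⊎ suc (layer m) ≡ layer l
      levels-differ {l} {m} a = subst₂ (λ h k → k ≡ suc h ⊎ suc k ≡ h) (d-place l) (d-place m) (level-step {x} a)

      same-layer : ∀ {h} → ¬ (h ≡ suc h ⊎ suc h ≡ h)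
      same-layer (inj₁ eq) = ℕ.1+n≢n (sym eq)
      same-layer (inj₂ eq) = ℕ.1+n≢n eq

      two-apart : ∀ {h} → ¬ (suc (suc h) ≡ suc h ⊎ suc (suc (suc h)) ≡ h)
      two-apart (inj₁ eq) = ℕ.1+n≢n eq
      two-apart {h} (inj₂ eq) = ℕ.m≢1+n+m h {2} (sym eq)

      three-apart : ∀ {h} → ¬ (suc (suc (suc h)) ≡ suc h ⊎ suc (suc (suc (suc h))) ≡ h)
      three-apart {h} (inj₁ eq) = ℕ.m≢1+n+m (suc h) {1} (sym eq)
      three-apart {h} (inj₂ eq) = ℕ.m≢1+n+m h {3} (sym eq)

    place-adjacent : ∀ l m → adjacent sᵛ ε l m ≡ true → Adj (place l) (place m)
    place-adjacent o (u i) _ = d≡1⇒adj (dU i)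
    place-adjacent (u i) o _ = adj-sym (d≡1⇒adj (dU i))
    place-adjacent (u i) (y k b) eq =
      subst (λ i → Adj (U i) (Y k b)) (trans (sym (lookup-sᵛ k)) (does-sound (lookup sᵛ k Fin.≟ i) eq)) (U-Y k b)
    place-adjacent (y k b) (u i) eq = adj-sym
      (subst (λ i → Adj (U i) (Y k b)) (trans (sym (lookup-sᵛ k)) (does-sound (lookup sᵛ k Fin.≟ i) eq)) (U-Y k b))
    place-adjacent (y k b) (z p q) eq =
      subst (λ b → Adj (Y k b) (Z p q)) (==-sound (code ε k p q) b eq) (Y-Z k p q)
    place-adjacent (z p q) (y k b) eq = adj-sym
      (subst (λ b → Adj (Y k b) (Z p q)) (==-sound (code ε k p q) b eq) (Y-Z k p q))

    adjacent-place : ∀ l m → Adj (place l) (place m) → adjacent sᵛ ε l m ≡ true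
    adjacent-place o       o         a = contradiction (levels-differ {o} {o} a) same-layer
    adjacent-place o       (u i)     a = refl
    adjacent-place o       (y k b)   a = contradiction (levels-differ {o} {y k b} a) two-apart
    adjacent-place o       (z p q)   a = contradiction (levels-differ {o} {z p q} a) three-apart
    adjacent-place (u i)   o         a = refl
    adjacent-place (u i)   (u j)     a = contradiction (levels-differ {u i} {u j} a) same-layer
    adjacent-place (u i)   (y k b)   a = dec-true (lookup sᵛ k Fin.≟ i) (trans (lookup-sᵛ k) (U-unique a))
    adjacent-place (u i)   (z p q)   a = contradiction (levels-differ {u i} {z p q} a) two-apart
    adjacent-place (y k b) o         a = contradiction (levels-differ {o} {y k b} (adj-sym a)) two-apart
    adjacent-place (y k b) (u i)     a = dec-true (lookup sᵛ k Fin.≟ i) (trans (lookup-sᵛ k) (U-unique (adj-sym a)))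
    adjacent-place (y k b) (y k′ b′) a = contradiction (levels-differ {y k b} {y k′ b′} a) same-layer
    adjacent-place (y k b) (z p q)   a = ==-complete (bit-unique (dZ p q) k (Y-Z k p q) a)
    adjacent-place (z p q) o         a = contradiction (levels-differ {o} {z p q} (adj-sym a)) three-apart
    adjacent-place (z p q) (u i)     a = contradiction (levels-differ {u i} {z p q} (adj-sym a)) two-apart
    adjacent-place (z p q) (y k b)   a = ==-complete (bit-unique (dZ p q) k (Y-Z k p q) (adj-sym a))
    adjacent-place (z p q) (z p′ q′) a = contradiction (levels-differ {z p q} {z p′ q′} a) same-layer

    adj?-place : ∀ l m → does (adj? (place l) (place m)) ≡ adjacent sᵛ ε l m
    adj?-place l m = agree (adj? (place l) (place m)) (adjacent-place l m) (place-adjacent l m)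
      where
      agree : ∀ {P : Set} {b} (P? : Dec P) → (P → b ≡ true) → (b ≡ true → P) → does P? ≡ b
      agree             (yes p) to _    = sym (to p)
      agree {b = true}  (no ¬p) _  from = contradiction (from refl) ¬p
      agree {b = false} (no _)  _  _    = refl

    -- The spheres 1 and 2 are covered by the orderings. A vertex at distance 3 equals the corner
    -- with its own bits in pairs 0 and 1, by `determined`.
    place-surjective : ∀ v → ∃[ l ] place l ≡ v
    place-surjective v = at (d x v) refl (d≤3 x v)
      where
      at : ∀ h → d x v ≡ h → h ℕ.≤ 3 → ∃[ l ] place l ≡ v
      at 0 eq _ = o , d≡0⇒≡ eq
      at 1 eq _ = let i , Ui≡v = U-covers eq in u i , Ui≡v
      at 2 eq _ = let k , b , Ykb≡v = Y-covers eq in y k b , Ykb≡v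
      at 3 eq _ =
        let p , a = bit eq 0F
            q , a′ = bit eq 1F
        in z p q , determined (dZ p q) eq {0F} {p} {1F} {q} (λ ()) (Y-Z₀ p q) (Y-Z₁ p q) a a′
      at (suc (suc (suc (suc _)))) _ (ℕ.s≤s (ℕ.s≤s (ℕ.s≤s ())))

  -- The spectrum mentions no base vertex, so it needs one whose spheres are ordered suitably.

  module Orderings (x : Fin n) where

    private
      E₁ = neighbours x

    sphere₁ : Fin 3 → Fin n
    sphere₁ = elem E₁

    private
      dE₁ : ∀ i → d x (sphere₁ i) ≡ 1
      dE₁ i = proj₁ (sound E₁ i)

      E₂ : ∀ i → Enum (λ t → d (sphere₁ i) t ≡ 1 × d x t ≡ 2) 2
      E₂ i = up₁ (dE₁ i)

    -- Upper neighbours are listed in pairs, one pair for each vertex of `sphere₁`, so that the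
    -- common-neighbour condition is built in.
    sphere₂ : Fin 6 → Fin n
    sphere₂ j = elem (E₂ (proj₁ (remQuot {3} 2 j))) (proj₂ (remQuot {3} 2 j))

    sphere₁-orders : OrdersSphere Γ 1 x sphere₁
    sphere₁-orders = record
      { injective = injective E₁
      ; covers    = λ v → mk⇔ (λ eq → complete E₁ (eq , eq)) (λ { (i , refl) → dE₁ i })
      }

    sphere₂-orders : OrdersSphere Γ 2 x sphere₂
    sphere₂-orders = record
      { injective = λ {i} {j} eq → trans (sym (Fin.combine-remQuot {3} 2 i))
          (trans (cong (λ ik → Fin.combine {3} {2} (proj₁ ik) (proj₂ ik)) (pair-injective (remQuot {3} 2 i) (remQuot {3} 2 j) eq))
            (Fin.combine-remQuot {3} 2 j))
      ; covers    = λ v → mk⇔ (covered v) (λ { (j , refl) → proj₂ (sound (E₂ (proj₁ (remQuot {3} 2 j))) (proj₂ (remQuot {3} 2 j))) })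
      }
      where
      pair-injective : (ik jl : Fin 3 × Fin 2) →
        elem (E₂ (proj₁ ik)) (proj₂ ik) ≡ elem (E₂ (proj₁ jl)) (proj₂ jl) → ik ≡ jl
      pair-injective (i , k) (j , l) eq = same-pair (injective E₁ (at-most-one (down₂ (proj₂ (sound (E₂ j) l)))
        (trans (d-sym (elem (E₂ j) l) (sphere₁ i)) (trans (cong (d (sphere₁ i)) (sym eq)) (proj₁ (sound (E₂ i) k))) , dE₁ i)
        (trans (d-sym (elem (E₂ j) l) (sphere₁ j)) (proj₁ (sound (E₂ j) l)) , dE₁ j))) eq
        where
        same-pair : ∀ {i j} → i ≡ j → elem (E₂ i) k ≡ elem (E₂ j) l → (i , k) ≡ (j , l)
        same-pair {i} refl eq = cong (i ,_) (injective (E₂ i) eq)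
      covered : ∀ v → d x v ≡ 2 → ∃[ j ] sphere₂ j ≡ v
      covered v eq =
        let D₂ = down₂ eq
            w = elem D₂ 0F
            dvw , dxw = sound D₂ 0F
            i , Ui≡w = complete E₁ (dxw , dxw)
            k , e = complete (E₂ i) (trans (d-sym (sphere₁ i) v) (trans (cong (d v) Ui≡w) dvw) , eq)
        in Fin.combine {3} {2} i k , trans (cong (λ ik → elem (E₂ (proj₁ ik)) (proj₂ ik)) (Fin.remQuot-combine {3} {2} i k)) e

    sphere₂-common : ∀ i → CommonNeighbourIn₁ Γ x (sphere₂ (Fin.combine {3} {2} i 0F)) (sphere₂ (Fin.combine {3} {2} i 1F))
    sphere₂-common i = sphere₁ i , dE₁ i , adjacent 0F , adjacent 1F
      where
      adjacent : ∀ k → Adj (sphere₁ i) (sphere₂ (Fin.combine {3} {2} i k))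
      adjacent k = subst (λ ik → Adj (sphere₁ i) (elem (E₂ (proj₁ ik)) (proj₂ ik))) (sym (Fin.remQuot-combine {3} {2} i k))
        (d≡1⇒adj (proj₁ (sound (E₂ i) k)))

-- The frame of the Heawood graph

module HeawoodFrame {Γ : ConnectedGraph 14} (Γ-dr : DistanceRegular Γ)
  (array : DistanceRegular.intersectionArray Γ-dr ≡ (3 ∷ 2 ∷ 2 ∷ [] , 1 ∷ 1 ∷ 3 ∷ []))
  (x : Fin 14) (U : Fin 3 → Fin 14) (Y′ : Fin 6 → Fin 14)
  (U-orders : OrdersSphere Γ 1 x U) (Y-orders : OrdersSphere Γ 2 x Y′)
  (common₀ : CommonNeighbourIn₁ Γ x (Y′ 0F) (Y′ 1F))
  (common₁ : CommonNeighbourIn₁ Γ x (Y′ 2F) (Y′ 3F))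
  (common₂ : CommonNeighbourIn₁ Γ x (Y′ 4F) (Y′ 5F)) where
  open Scalars
  open Sums
  open LinearMaps
  open Blocks
  open Frames
  open Model
  open ConnectedGraph Γ
  open Geometry Γ-dr array
  open Labelling x U Y′ U-orders Y-orders common₀ common₁ common₂
  open Terwilliger Γ-dr x using (A; e*; E*)
  open Complex using (_≈_; _+_; _*_; -_; 0ℂ; 1ℂ; conj)
  open import Relation.Binary.Reasoning.Setoid K.setoid

  label-surjective : ∀ l → ∃[ i ] label i ≡ l
  label-surjective o              = 0F , refl
  label-surjective (u 0F)         = 1F , refl
  label-surjective (u 1F)         = 2F , refl
  label-surjective (u 2F)         = 3F , refl
  label-surjective (y 0F false)   = 4F , refl
  label-surjective (y 0F true)    = 5F , refl
  label-surjective (y 1F false)   = suc 5F , refl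
  label-surjective (y 1F true)    = suc (suc 5F) , refl
  label-surjective (y 2F false)   = suc (suc (suc 5F)) , refl
  label-surjective (y 2F true)    = suc (suc (suc (suc 5F))) , refl
  label-surjective (z false false) = suc (suc (suc (suc (suc 5F)))) , refl
  label-surjective (z false true)  = suc (suc (suc (suc (suc (suc 5F))))) , refl
  label-surjective (z true false)  = suc (suc (suc (suc (suc (suc (suc 5F)))))) , refl
  label-surjective (z true true)   = suc (suc (suc (suc (suc (suc (suc (suc 5F))))))) , refl

  π : Fin 14 → Fin 14
  π i = place (label i)

  π-surjective : ∀ v → ∃[ i ] π i ≡ v
  π-surjective v =
    let l , eq = place-surjective v
        i , eq′ = label-surjective l
    in i , trans (cong place eq′) eq

  private
    π⁻¹ : Fin 14 → Fin 14
    π⁻¹ v = proj₁ (π-surjective v)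

    π-π⁻¹ : ∀ v → π (π⁻¹ v) ≡ v
    π-π⁻¹ v = proj₂ (π-surjective v)

    -- Here the order 14 enters: a section of a surjection between sets of equal finite size is
    -- injective, hence surjective, hence a two-sided inverse.
    π⁻¹-π : ∀ i → π⁻¹ (π i) ≡ i
    π⁻¹-π i =
      let v , eq = Counting.injective⇒surjective π⁻¹
            (λ {v} {w} eq → trans (sym (π-π⁻¹ v)) (trans (cong π eq) (π-π⁻¹ w))) i
      in trans (cong (λ i → π⁻¹ (π i)) (sym eq)) (trans (cong π⁻¹ (π-π⁻¹ v)) eq)

    everywhere : ∀ {P : Fin 14 → Set} → (∀ m → P (π m)) → ∀ v → P v
    everywhere {P} Pπ v = subst P (π-π⁻¹ v) (Pπ (π⁻¹ v))

  relabel : Permutation 14 14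
  relabel = permutation π π⁻¹ π-π⁻¹ π⁻¹-π

  ∑-relabel : (f : Vector ℂ 14) → ∑ f ≈ ∑ λ m → f (π m)
  ∑-relabel f = ∑-permute f relabel

  valid : Valid sᵛ ε
  valid = all-valid ε (s 0F) (s 1F) (s 2F)
    (s-injective 0F 1F λ ()) (s-injective 0F 2F λ ()) (s-injective 1F 2F λ ())
  open Valid valid

  bℤ : ∀ α → Fin (dim (kind α)) → Fin 14 → ℤ
  bℤ α j m = basis sᵛ ε α j (label m)

  HasCoordinates : Vector ℂ 14 → (Fin 14 → ℤ) → Set
  HasCoordinates v c = ∀ m → v (π m) ≈ ι (c m)

  A-entry : ∀ l m → A (π l) (π m) ≈ ι (if adjacent sᵛ ε (label l) (label m) then 1ℤ else 0ℤ)
  A-entry l m = K.trans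
    (≡⇒≈ (cong (if_then 1ℂ else 0ℂ) (adj?-place (label l) (label m))))
    (indicator (adjacent sᵛ ε (label l) (label m)))
    where
    indicator : ∀ t → (if t then 1ℂ else 0ℂ) ≈ ι (if t then 1ℤ else 0ℤ)
    indicator true  = K.sym ι-1
    indicator false = K.sym ι-0

  e*-entry : ∀ l m → e* l (π m) ≈ ι (if does (layer (label m) ℕ.≟ l) then 1ℤ else 0ℤ)
  e*-entry l m = K.trans
    (≡⇒≈ (cong (λ k → if does (k ℕ.≟ l) then 1ℂ else 0ℂ) (d-place (label m))))
    (indicator (does (layer (label m) ℕ.≟ l)))
    where
    indicator : ∀ t → (if t then 1ℂ else 0ℂ) ≈ ι (if t then 1ℤ else 0ℤ)
    indicator true  = K.sym ι-1
    indicator false = K.sym ι-0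

  A-coordinates : ∀ v c → HasCoordinates v c → HasCoordinates (A · v)
    (λ l → ∑ℤ λ m → (if adjacent sᵛ ε (label l) (label m) then 1ℤ else 0ℤ) ℤ.* c m)
  A-coordinates v c v-c l = begin
    (A · v) (π l)  ≈⟨ ∑-relabel (λ w → A (π l) w * v w) ⟩
    (∑ λ m → A (π l) (π m) * v (π m))  ≈⟨ ∑-cong (λ m → K.*-cong (A-entry l m) (v-c m)) ⟩
    (∑ λ m → ι (a m) * ι (c m))  ≈⟨ ι-∑* a c ⟨
    ι (∑ℤ λ m → a m ℤ.* c m)  ∎
    where
    a : Fin 14 → ℤ
    a m = if adjacent sᵛ ε (label l) (label m) then 1ℤ else 0ℤ

  withEssentialPart-at : ∀ {k} (v : Fin k → Fin 14) (a : Vec ℤ k) {w} j → v j ≡ w →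
    (∀ i → v i ≡ w → i ≡ j) → withEssentialPart v (fromEntries a) w ≈ ι (lookup a j)
  withEssentialPart-at v a {w} j vj≡w only = K.trans
    (∑-only j λ i i≢j → ≡⇒≈ (cong (if_then ι (lookup a i) else 0ℂ)
      (dec-false (v i Fin.≟ w) λ eq → i≢j (only i eq))))
    (≡⇒≈ (cong (if_then ι (lookup a j) else 0ℂ) (dec-true (v j Fin.≟ w) vj≡w)))

  withEssentialPart-off : ∀ {k} (v : Fin k → Fin 14) (a : Vec ℤ k) {w} → (∀ i → v i ≢ w) →
    withEssentialPart v (fromEntries a) w ≈ ι 0ℤ
  withEssentialPart-off v a {w} off = K.trans
    (∑-zero λ i → ≡⇒≈ (cong (if_then ι (lookup a i) else 0ℂ) (dec-false (v i Fin.≟ w) (off i))))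
    (K.sym ι-0)

  private
    U≢ : ∀ l → 1 ≢ layer l → ∀ i → U i ≢ place l
    U≢ l 1≢ i eq = 1≢ (trans (sym (dU i)) (trans (cong (d x) eq) (d-place l)))

    Y≢ : ∀ l → 2 ≢ layer l → ∀ j → Y′ j ≢ place l
    Y≢ l 2≢ j eq = 2≢ (trans (sym (dY (proj₁ (unside j)) (proj₂ (unside j))))
      (trans (cong (λ j → d x (Y′ j)) (side-unside j)) (trans (cong (d x) eq) (d-place l))))

  seed₁-place : ∀ a l → withEssentialPart U (fromEntries a) (place l) ≈ ι (seed₁ sᵛ ε a 0F l)
  seed₁-place a o       = withEssentialPart-off U a (U≢ o λ ())
  seed₁-place a (u i)   = withEssentialPart-at U a i refl λ j → OrdersSphere.injective U-orders
  seed₁-place a (y k b) = withEssentialPart-off U a (U≢ (y k b) λ ())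
  seed₁-place a (z p q) = withEssentialPart-off U a (U≢ (z p q) λ ())

  essential₁ : Fin 2 → Vec ℤ 3
  essential₁ 0F = 1ℤ ∷ -[1+ 0 ] ∷ 0ℤ ∷ []
  essential₁ 1F = 1ℤ ∷ 1ℤ ∷ -[1+ 1 ] ∷ []

  essential₂ : Fin 3 → Vec ℤ 6
  essential₂ 0F = 1ℤ ∷ -[1+ 0 ] ∷ 0ℤ ∷ 0ℤ ∷ 0ℤ ∷ 0ℤ ∷ []
  essential₂ 1F = 0ℤ ∷ 0ℤ ∷ 1ℤ ∷ -[1+ 0 ] ∷ 0ℤ ∷ 0ℤ ∷ []
  essential₂ 2F = 0ℤ ∷ 0ℤ ∷ 0ℤ ∷ 0ℤ ∷ 1ℤ ∷ -[1+ 0 ] ∷ []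

  ν₁ : Fin 2 → Vector ℂ 14
  ν₁ m = withEssentialPart U (fromEntries (essential₁ m))

  ν₂ : Fin 3 → Vector ℂ 14
  ν₂ m = withEssentialPart Y′ (fromEntries (essential₂ m))

  b : ∀ α → Fin (dim (kind α)) → Vector ℂ 14
  b 0F = e* 0 ▹ e* 1 ▹ e* 2 ▹ e* 3 ▹ ⟨⟩
  b 1F = ν₁ 0F ▹ A · ν₁ 0F ▹ ⟨⟩
  b 2F = ν₁ 1F ▹ A · ν₁ 1F ▹ ⟨⟩
  b 3F = ν₂ 0F ▹ A · ν₂ 0F ▹ ⟨⟩
  b 4F = ν₂ 1F ▹ A · ν₂ 1F ▹ ⟨⟩
  b 5F = ν₂ 2F ▹ A · ν₂ 2F ▹ ⟨⟩

  private
    -- `neighbour-sums` unfolded on the column (0, 1) of a small block: `A` takes the seed to the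
    -- second basis vector.
    second : ∀ {p q} → p ≡ 0ℤ ℤ.+ (1ℤ ℤ.* q ℤ.+ 0ℤ) → p ≡ q
    second {p} {q} eq = trans eq (trans (ℤ.+-identityˡ _) (trans (ℤ.+-identityʳ _) (ℤ.*-identityˡ q)))

    image : ∀ v c d → HasCoordinates v c →
      (∀ l → (∑ℤ λ m → (if adjacent sᵛ ε (label l) (label m) then 1ℤ else 0ℤ) ℤ.* c m) ≡ d l) →
      HasCoordinates (A · v) d
    image v c d v-c eq l = K.trans (A-coordinates v c v-c l) (≡⇒≈ (cong ι (eq l)))

  essential₂-entry : ∀ m k b → lookup (essential₂ m) (side k b) ≡ seed₂ sᵛ ε m 0F (y k b)
  essential₂-entry 0F 0F false = refl
  essential₂-entry 0F 0F true  = refl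
  essential₂-entry 0F 1F false = refl
  essential₂-entry 0F 1F true  = refl
  essential₂-entry 0F 2F false = refl
  essential₂-entry 0F 2F true  = refl
  essential₂-entry 1F 0F false = refl
  essential₂-entry 1F 0F true  = refl
  essential₂-entry 1F 1F false = refl
  essential₂-entry 1F 1F true  = refl
  essential₂-entry 1F 2F false = refl
  essential₂-entry 1F 2F true  = refl
  essential₂-entry 2F 0F false = refl
  essential₂-entry 2F 0F true  = refl
  essential₂-entry 2F 1F false = refl
  essential₂-entry 2F 1F true  = refl
  essential₂-entry 2F 2F false = refl
  essential₂-entry 2F 2F true  = refl

  ν₁-coordinates : ∀ m → HasCoordinates (ν₁ m) (λ i → seed₁ sᵛ ε (essential₁ m) 0F (label i))
  ν₁-coordinates m i = seed₁-place (essential₁ m) (label i)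

  ν₂-coordinates : ∀ m → HasCoordinates (ν₂ m) (λ i → seed₂ sᵛ ε m 0F (label i))
  ν₂-coordinates m i = at (label i)
    where
    a = essential₂ m
    at : ∀ l → ν₂ m (place l) ≈ ι (seed₂ sᵛ ε m 0F l)
    at o       = withEssentialPart-off Y′ a (Y≢ o λ ())
    at (u i)   = withEssentialPart-off Y′ a (Y≢ (u i) λ ())
    at (y k b) = K.trans
      (withEssentialPart-at Y′ a (side k b) refl λ j → OrdersSphere.injective Y-orders)
      (≡⇒≈ (cong ι (essential₂-entry m k b)))
    at (z p q) = withEssentialPart-off Y′ a (Y≢ (z p q) λ ())

  b-coordinates : ∀ α j → HasCoordinates (b α j) (bℤ α j)
  b-coordinates 0F 0F m = e*-entry 0 m
  b-coordinates 0F 1F m = e*-entry 1 m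
  b-coordinates 0F 2F m = e*-entry 2 m
  b-coordinates 0F 3F m = e*-entry 3 m
  b-coordinates 1F 0F m = ν₁-coordinates 0F m
  b-coordinates 1F 1F   = image (ν₁ 0F) (bℤ 1F 0F) (bℤ 1F 1F) (ν₁-coordinates 0F) λ l → second (neighbour-sums 1F 0F l)
  b-coordinates 2F 0F m = ν₁-coordinates 1F m
  b-coordinates 2F 1F   = image (ν₁ 1F) (bℤ 2F 0F) (bℤ 2F 1F) (ν₁-coordinates 1F) λ l → second (neighbour-sums 2F 0F l)
  b-coordinates 3F 0F m = ν₂-coordinates 0F m
  b-coordinates 3F 1F   = image (ν₂ 0F) (bℤ 3F 0F) (bℤ 3F 1F) (ν₂-coordinates 0F) λ l → second (neighbour-sums 3F 0F l)
  b-coordinates 4F 0F m = ν₂-coordinates 1F m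
  b-coordinates 4F 1F   = image (ν₂ 1F) (bℤ 4F 0F) (bℤ 4F 1F) (ν₂-coordinates 1F) λ l → second (neighbour-sums 4F 0F l)
  b-coordinates 5F 0F m = ν₂-coordinates 2F m
  b-coordinates 5F 1F   = image (ν₂ 2F) (bℤ 5F 0F) (bℤ 5F 1F) (ν₂-coordinates 2F) λ l → second (neighbour-sums 5F 0F l)

  private
    c : ℂ
    c = proj₁ (ι-positive 11)

    c*12 : ∀ k → c * ι (+ 12 ℤ.* k) ≈ ι k
    c*12 k = begin
      c * ι (+ 12 ℤ.* k)  ≈⟨ K.*-congˡ (ι-* (+ 12) k) ⟩
      c * (ι (+ 12) * ι k)  ≈⟨ K.*-assoc c (ι (+ 12)) (ι k) ⟨
      c * ι (+ 12) * ι k  ≈⟨ K.*-congʳ (proj₂ (ι-positive 11)) ⟩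
      1ℂ * ι k  ≈⟨ K.*-identityˡ (ι k) ⟩
      ι k  ∎

    w : ∀ α → Fin (dim (kind α)) → ℤ
    w = weight sᵛ ε

  -- Each basis vector divided by its squared norm, with 12 as common denominator; the coordinates
  -- are real integers, so no conjugation is required.
  κ : ∀ α → Fin (dim (kind α)) → Vector ℂ 14
  κ α i v = c * ι (w α i) * b α i v

  private
    κ-b : ∀ α i β j → ⟪ κ α i , b β j ⟫ ≈ c * ι (w α i ℤ.* gram sᵛ ε α i β j)
    κ-b α i β j = begin
      (∑ λ v → c * ι (w α i) * b α i v * b β j v)
        ≈⟨ ∑-relabel (λ v → c * ι (w α i) * b α i v * b β j v) ⟩
      (∑ λ m → c * ι (w α i) * b α i (π m) * b β j (π m))
        ≈⟨ ∑-cong (λ m → K.trans (K.*-assoc (c * ι (w α i)) (b α i (π m)) (b β j (π m)))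
          (K.*-congˡ (K.*-cong (b-coordinates α i m) (b-coordinates β j m)))) ⟩
      (∑ λ m → c * ι (w α i) * (ι (bℤ α i m) * ι (bℤ β j m)))
        ≈⟨ ∑-*ˡ (c * ι (w α i)) (λ m → ι (bℤ α i m) * ι (bℤ β j m)) ⟨
      c * ι (w α i) * (∑ λ m → ι (bℤ α i m) * ι (bℤ β j m))  ≈⟨ K.*-congˡ (ι-∑* (bℤ α i) (bℤ β j)) ⟨
      c * ι (w α i) * ι (gram sᵛ ε α i β j)  ≈⟨ K.*-assoc c (ι (w α i)) (ι (gram sᵛ ε α i β j)) ⟩
      c * (ι (w α i) * ι (gram sᵛ ε α i β j))  ≈⟨ K.*-congˡ (ι-* (w α i) (gram sᵛ ε α i β j)) ⟨
      c * ι (w α i ℤ.* gram sᵛ ε α i β j)  ∎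

    b-outside : ∀ α j m → endpt (kind α) ℕ.+ toℕ j ≢ layer (label m) → b α j (π m) ≈ 0ℂ
    b-outside α j m off = K.trans (b-coordinates α j m)
      (K.trans (≡⇒≈ (cong ι (layered α j m off))) ι-0)

  E*-· : ∀ l v → E* l · v 𝕍.≈ᴹ λ t → e* l t * v t
  E*-· l v t = K.trans
    (∑-only t λ r r≢t → K.trans
      (K.*-congʳ (≡⇒≈ (cong (if_then e* l t else 0ℂ) (dec-false (t Fin.≟ r) λ eq → r≢t (sym eq)))))
      (K.zeroˡ (v r)))
    (K.*-congʳ (≡⇒≈ (cong (if_then e* l t else 0ℂ) (dec-true (t Fin.≟ t) refl))))

  frame : Frame Γ-dr x
  frame = record
    { D≡3        = D≡3
    ; b          = b
    ; κ          = κ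
    ; dual       = λ α i j → K.trans (κ-b α i α j)
        (K.trans (K.*-congˡ (≡⇒≈ (cong ι (norms α i j)))) (c*12 (δ i j)))
    ; dual-≢     = λ {α} {β} α≢β i j → K.trans (κ-b α i β j) (begin
        c * ι (w α i ℤ.* gram sᵛ ε α i β j)  ≡⟨ cong (λ k → c * ι (w α i ℤ.* k)) (orthogonal α β α≢β i j) ⟩
        c * ι (w α i ℤ.* 0ℤ)  ≡⟨ cong (λ k → c * ι k) (ℤ.*-zeroʳ (w α i)) ⟩
        c * ι 0ℤ  ≈⟨ K.trans (K.*-congˡ ι-0) (K.zeroʳ c) ⟩
        0ℂ  ∎)
    ; complete   = λ v → everywhere λ l → K.sym (resolution v l)
    ; A-acts     = λ α → actsAs λ j → everywhere λ l → begin
        (A · b α j) (π l)  ≈⟨ A-coordinates (b α j) (bℤ α j) (b-coordinates α j) l ⟩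
        ι (neighbourSum sᵛ ε α j (label l))  ≡⟨ cong ι (neighbour-sums α j l) ⟩
        ι (∑ℤ λ i → adjacency (kind α) i j ℤ.* bℤ α i l)
          ≈⟨ ι-∑* (λ i → adjacency (kind α) i j) (λ i → bℤ α i l) ⟩
        (∑ λ i → ι (adjacency (kind α) i j) * ι (bℤ α i l))
          ≈⟨ ∑-cong (λ i → K.*-congˡ {ι (adjacency (kind α) i j)} (b-coordinates α i l)) ⟨
        (∑ λ i → ι (adjacency (kind α) i j) * b α i (π l))  ∎
    ; E*-acts    = λ l α → actsAs λ j → everywhere λ m → begin
        (E* l · b α j) (π m)  ≈⟨ E*-· l (b α j) (π m) ⟩
        e* l (π m) * b α j (π m)  ≈⟨ K.*-congʳ (e*-entry l m) ⟩
        ι (if does (layer (label m) ℕ.≟ l) then 1ℤ else 0ℤ) * b α j (π m)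
          ≈⟨ on-support l α j m (endpt (kind α) ℕ.+ toℕ j ℕ.≟ layer (label m)) ⟩
        ι (atLevel l (kind α) j) * b α j (π m)  ≈⟨ K.*-congˡ (combine-unit (b α) j (π m)) ⟨
        ι (atLevel l (kind α) j) * combine (b α) (λ i → ι (δ i j)) (π m)
          ≈⟨ combine-* (b α) (ι (atLevel l (kind α) j)) (λ i → ι (δ i j)) (π m) ⟨
        combine (b α) (λ i → ι (atLevel l (kind α) j) * ι (δ i j)) (π m)
          ≈⟨ combine-cong (b α) (λ i → ι-* (atLevel l (kind α) j) (δ i j)) (π m) ⟨
        combine (b α) (λ i → ι (level l (kind α) i j)) (π m)  ∎
    ; orthogonal = λ {α} {β} α≢β i j → begin
        (∑ λ v → b α i v * conj (b β j v))  ≈⟨ ∑-relabel (λ v → b α i v * conj (b β j v)) ⟩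
        (∑ λ m → b α i (π m) * conj (b β j (π m)))  ≈⟨ ∑-cong (λ m → K.*-cong (b-coordinates α i m)
            (K.trans (conj-cong (b-coordinates β j m)) (conj-ι (bℤ β j m)))) ⟩
        (∑ λ m → ι (bℤ α i m) * ι (bℤ β j m))  ≈⟨ ι-∑* (bℤ α i) (bℤ β j) ⟨
        ι (gram sᵛ ε α i β j)  ≡⟨ cong ι (orthogonal α β α≢β i j) ⟩
        ι 0ℤ  ≈⟨ ι-0 ⟩
        0ℂ  ∎
    }
    where
    -- The left side tests the distance of the vertex, the right side the level of the basis vector.
    -- They agree on the layer of that basis vector; elsewhere its coordinate is zero.
    on-support : ∀ l α j m → Dec (endpt (kind α) ℕ.+ toℕ j ≡ layer (label m)) →
      ι (if does (layer (label m) ℕ.≟ l) then 1ℤ else 0ℤ) * b α j (π m) ≈ ι (atLevel l (kind α) j) * b α j (π m)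
    on-support l α j m (yes eq) = K.*-congʳ
      (≡⇒≈ (cong (λ k → ι (if does (k ℕ.≟ l) then 1ℤ else 0ℤ)) (sym eq)))
    on-support l α j m (no neq) = K.trans
      (K.trans (K.*-congˡ (b-outside α j m neq)) (K.zeroʳ _))
      (K.sym (K.trans (K.*-congˡ (b-outside α j m neq)) (K.zeroʳ _)))
    summand : ∀ α i l m → ι (w α i) * b α i (π m) * b α i (π l) ≈ ι (w α i ℤ.* bℤ α i m ℤ.* bℤ α i l)
    summand α i l m = K.trans
      (K.*-cong (K.*-congˡ (b-coordinates α i m)) (b-coordinates α i l))
      (K.sym (K.trans (ι-* (w α i ℤ.* bℤ α i m) (bℤ α i l)) (K.*-congʳ (ι-* (w α i) (bℤ α i m)))))
    coordinate : ∀ v l α i → ⟪ κ α i , v ⟫ * b α i (π l) ≈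
      ∑ λ m → c * ι (w α i ℤ.* bℤ α i m ℤ.* bℤ α i l) * v (π m)
    coordinate v l α i = begin
      (∑ λ t → κ α i t * v t) * b α i (π l)  ≈⟨ K.*-congʳ (∑-relabel (λ t → κ α i t * v t)) ⟩
      (∑ λ m → κ α i (π m) * v (π m)) * b α i (π l)
        ≈⟨ ∑-*ʳ (b α i (π l)) (λ m → κ α i (π m) * v (π m)) ⟩
      (∑ λ m → c * ι (w α i) * b α i (π m) * v (π m) * b α i (π l))  ≈⟨ ∑-cong (λ m → K.trans
          (solve 5 (λ c w p v q → c :* w :* p :* v :* q :=
              c :* (w :* p :* q) :* v) K.refl c (ι (w α i)) (b α i (π m)) (v (π m)) (b α i (π l)))
          (K.*-congʳ (K.*-congˡ (summand α i l m)))) ⟩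
      (∑ λ m → c * ι (w α i ℤ.* bℤ α i m ℤ.* bℤ α i l) * v (π m))  ∎
      where
      open Solver
    -- Summation over the vertices is moved outside, leaving the kernel Σ w b bᵗ, which by
    -- `complete` of `Valid` is 12 times the identity.
    resolution : ∀ v l → (∑ λ α → combine (b α) (λ i → ⟪ κ α i , v ⟫) (π l)) ≈ v (π l)
    resolution v l = begin
      (∑ λ α → ∑ λ i → ⟪ κ α i , v ⟫ * b α i (π l))
        ≈⟨ ∑-cong (λ α → ∑-cong λ i → coordinate v l α i) ⟩
      (∑ λ α → ∑ λ i → ∑ λ m → c * ι (k α i m) * v (π m))
        ≈⟨ ∑-cong (λ α → ∑-swap λ i m → c * ι (k α i m) * v (π m)) ⟩
      (∑ λ α → ∑ λ m → ∑ λ i → c * ι (k α i m) * v (π m))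
        ≈⟨ ∑-swap (λ α m → ∑ λ i → c * ι (k α i m) * v (π m)) ⟩
      (∑ λ m → ∑ λ α → ∑ λ i → c * ι (k α i m) * v (π m))  ≈⟨ ∑-cong (λ m → collect m) ⟩
      (∑ λ m → ι (δ m l) * v (π m))  ≈⟨ ∑-δ (λ m → v (π m)) l ⟩
      v (π l)  ∎
      where
      k : ∀ α → Fin (dim (kind α)) → Fin 14 → ℤ
      k α i m = w α i ℤ.* bℤ α i m ℤ.* bℤ α i l
      collect : ∀ m → (∑ λ α → ∑ λ i → c * ι (k α i m) * v (π m)) ≈ ι (δ m l) * v (π m)
      collect m = begin
        (∑ λ α → ∑ λ i → c * ι (k α i m) * v (π m))
          ≈⟨ ∑-cong (λ α → ∑-*ʳ (v (π m)) λ i → c * ι (k α i m)) ⟨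
        (∑ λ α → (∑ λ i → c * ι (k α i m)) * v (π m))
          ≈⟨ ∑-*ʳ (v (π m)) (λ α → ∑ λ i → c * ι (k α i m)) ⟨
        (∑ λ α → ∑ λ i → c * ι (k α i m)) * v (π m)  ≈⟨ K.*-congʳ (∑-cong λ α → K.trans
            (K.*-congˡ (ι-∑ λ i → k α i m)) (∑-*ˡ c λ i → ι (k α i m))) ⟨
        (∑ λ α → c * ι (∑ℤ λ i → k α i m)) * v (π m)  ≈⟨ K.*-congʳ (∑-*ˡ c λ α → ι (∑ℤ λ i → k α i m)) ⟨
        c * (∑ λ α → ι (∑ℤ λ i → k α i m)) * v (π m)
          ≈⟨ K.*-congʳ (K.*-congˡ (ι-∑ λ α → ∑ℤ λ i → k α i m)) ⟨
        c * ι (∑ℤ λ α → ∑ℤ λ i → k α i m) * v (π m)  ≡⟨ cong (λ k → c * ι k * v (π m)) (complete l m) ⟩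
        c * ι (+ 12 ℤ.* δ m l) * v (π m)  ≈⟨ K.*-congʳ (c*12 (δ m l)) ⟩
        ι (δ m l) * v (π m)  ∎

-- Assembly of the theorem

module _ {n k : ℕ} {W W′ : Vector (Pred (Vector ℂ n) 0ℓ) k} (W≡W′ : ∀ i → W i ≡ W′ i) where

  private
    back : ∀ {v : Fin k → Vector ℂ n} → (∀ i → W′ i (v i)) → ∀ i → W i (v i)
    back {v} v∈ i = subst (λ P → P (v i)) (sym (W≡W′ i)) (v∈ i)

  -- The theorem lists the summands with `▹`, a family that agrees with `W` only pointwise, so
  -- properties of the whole family have to be transported index by index.
  orthogonalDirectSum-cong : OrthogonalDirectSum W → OrthogonalDirectSum W′
  orthogonalDirectSum-cong sum = record
    { directSum  = record
      { decompose = λ v → let w , w∈ , eq = decompose v in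
          w , (λ i → subst (λ P → P (w i)) (W≡W′ i) (w∈ i)) , eq
      ; unique    = λ w∈ w′∈ → unique (back w∈) (back w′∈)
      }
    ; orthogonal = λ {i} {j} i≢j {u} {v} u∈ v∈ → orthogonal i≢j
        (subst (λ P → P u) (sym (W≡W′ i)) u∈) (subst (λ P → P v) (sym (W≡W′ j)) v∈)
    }
    where
    open OrthogonalDirectSum sum
    open DirectSum directSum

module HeawoodModules {Γ : ConnectedGraph 14} (Γ-dr : DistanceRegular Γ)
  (array : DistanceRegular.intersectionArray Γ-dr ≡ (3 ∷ 2 ∷ 2 ∷ [] , 1 ∷ 1 ∷ 3 ∷ [])) where

  spectrum : HasSpectrum (adjacencyMatrix Γ) (Spectra.spectrum 1 6)
  spectrum = AdjacencySpectrum.A-spectrum (HeawoodFrame.frame Γ-dr array 0F sphere₁ sphere₂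
    sphere₁-orders sphere₂-orders (sphere₂-common 0F) (sphere₂-common 1F) (sphere₂-common 2F))
    where open Geometry.Orderings Γ-dr array 0F

  module _ {x : Fin 14} (F : Frames.Frame Γ-dr x) where
    open Terwilliger Γ-dr x
    open FrameTheory F using (W)
    open Modules F

    summands : Fin 6 → Subset-V
    summands = W 0F ▹ W 1F ▹ W 2F ▹ W 3F ▹ W 4F ▹ W 5F ▹ ⟨⟩

    W≡summands : ∀ α → W α ≡ summands α
    W≡summands 0F = refl
    W≡summands 1F = refl
    W≡summands 2F = refl
    W≡summands 3F = refl
    W≡summands 4F = refl
    W≡summands 5F = refl

    summands-orthogonal : OrthogonalDirectSum summands
    summands-orthogonal = orthogonalDirectSum-cong W≡summands orthogonalDirectSum

    summands-irreducible : ∀ α → Irreducible (summands α)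
    summands-irreducible α = subst Irreducible (W≡summands α) (irreducible α)

    summands-isomorphic : ∀ α β → Isomorphic (summands α) (summands β) ⇔ Blocks.kind α ≡ Blocks.kind β
    summands-isomorphic α β = subst₂ (λ V V′ → Isomorphic V V′ ⇔ Blocks.kind α ≡ Blocks.kind β)
      (W≡summands α) (W≡summands β) (isomorphic⇔ α β)

    summands-multiplicity : ∀ {V m} → MultiplicityIn W V m → MultiplicityIn summands V m
    summands-multiplicity {V} (S , S-spec , size) =
      S , (λ α → subst (λ V′ → α ∈ S ⇔ Isomorphic V′ V) (W≡summands α) (S-spec α)) , size

open import Data.Integer.Base using (-_)
open import Data.Nat.Base using (_+_; _^_)
open SquareRootOf2 using (√2; √2-positive; √2²≈2)

mainTheorem5 :
  Σ[ √2 ∈ ℝ ] Real.Positive √2 × √2 Real.* √2 Real.≈ Real.fromℚ (+ 2 / 1) ×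
  ((Γ : ConnectedGraph 14) (Γ-dr : DistanceRegular Γ) →
   DistanceRegular.intersectionArray Γ-dr ≡ (3 ∷ 2 ∷ 2 ∷ [] , 1 ∷ 1 ∷ 3 ∷ []) →
   let
     three = Complex.fromℤ (+ 3)
     root2 = Complex.fromℝ √2
   in
   HasSpectrum (adjacencyMatrix Γ)
     ((three , 1) ∷ (root2 , 6) ∷ (Complex.- root2 , 6) ∷ (Complex.- three , 1) ∷ [])
   ×
   ((x : Fin 14) (u : Fin 3 → Fin 14) (y : Fin 6 → Fin 14) →
    OrdersSphere Γ 1 x u → OrdersSphere Γ 2 x y →
    CommonNeighbourIn₁ Γ x (y 0F) (y 1F) →
    CommonNeighbourIn₁ Γ x (y 2F) (y 3F) →
    CommonNeighbourIn₁ Γ x (y 4F) (y 5F) →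
    let
      open Terwilliger Γ-dr x
      ν₁a = withEssentialPart u (fromEntries (1ℤ ∷ -1ℤ ∷ 0ℤ ∷ []))
      ν₁b = withEssentialPart u (fromEntries (1ℤ ∷ 1ℤ ∷ - (+ 2) ∷ []))
      ν₂a = withEssentialPart y (fromEntries (1ℤ ∷ -1ℤ ∷ 0ℤ ∷ 0ℤ ∷ 0ℤ ∷ 0ℤ ∷ []))
      ν₂b = withEssentialPart y (fromEntries (0ℤ ∷ 0ℤ ∷ 1ℤ ∷ -1ℤ ∷ 0ℤ ∷ 0ℤ ∷ []))
      ν₂c = withEssentialPart y (fromEntries (0ℤ ∷ 0ℤ ∷ 0ℤ ∷ 0ℤ ∷ 1ℤ ∷ -1ℤ ∷ []))
      B₀ = fromRows
        ( (0 ∷ 3 ∷ 0 ∷ 0 ∷ [])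
        ∷ (1 ∷ 0 ∷ 2 ∷ 0 ∷ [])
        ∷ (0 ∷ 1 ∷ 0 ∷ 2 ∷ [])
        ∷ (0 ∷ 0 ∷ 3 ∷ 0 ∷ []) ∷ [])
      B₁ = fromRows
        ( (0 ∷ 2 ∷ [])
        ∷ (1 ∷ 0 ∷ []) ∷ [])
      type = I ▹ II ▹ II ▹ III ▹ III ▹ III ▹ ⟨⟩
    in
    (Σ[ W₀ ∈ Subset-V ] Σ[ W₁a ∈ Subset-V ] Σ[ W₁b ∈ Subset-V ]
     Σ[ W₂a ∈ Subset-V ] Σ[ W₂b ∈ Subset-V ] Σ[ W₂c ∈ Subset-V ]
     let W = W₀ ▹ W₁a ▹ W₁b ▹ W₂a ▹ W₂b ▹ W₂c ▹ ⟨⟩ in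
       OrthogonalDirectSum W
     × (∀ i → Irreducible (W i))
     × (∀ i j → Isomorphic (W i) (W j) ⇔ type i ≡ type j)
     × MultiplicityIn W W₀ 1
     × HasData W₀ 0 4 3 (1 ∷ 1 ∷ 1 ∷ 1 ∷ []) (e* 0 ▹ e* 1 ▹ e* 2 ▹ e* 3 ▹ ⟨⟩) B₀
     × HasSpectrum B₀
         ((three , 1) ∷ (root2 , 1) ∷ (Complex.- root2 , 1) ∷ (Complex.- three , 1) ∷ [])
     × MultiplicityIn W W₁a 2 × HasData W₁a 1 2 1 (1 ∷ 1 ∷ []) (ν₁a ▹ A · ν₁a ▹ ⟨⟩) B₁ × HasSeed W₁a 1 ν₁a
     × MultiplicityIn W W₁b 2 × HasData W₁b 1 2 1 (1 ∷ 1 ∷ []) (ν₁b ▹ A · ν₁b ▹ ⟨⟩) B₁ × HasSeed W₁b 1 ν₁b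
     × HasSpectrum B₁ ((root2 , 1) ∷ (Complex.- root2 , 1) ∷ [])
     × MultiplicityIn W W₂a 3 × HasData W₂a 2 2 1 (1 ∷ 1 ∷ []) (ν₂a ▹ A · ν₂a ▹ ⟨⟩) B₁ × HasSeed W₂a 2 ν₂a
     × MultiplicityIn W W₂b 3 × HasData W₂b 2 2 1 (1 ∷ 1 ∷ []) (ν₂b ▹ A · ν₂b ▹ ⟨⟩) B₁ × HasSeed W₂b 2 ν₂b
     × MultiplicityIn W W₂c 3 × HasData W₂c 2 2 1 (1 ∷ 1 ∷ []) (ν₂c ▹ A · ν₂c ▹ ⟨⟩) B₁ × HasSeed W₂c 2 ν₂c)
    × 𝕄.HasDimension T (4 ^ 2 + 2 ^ 2 + 2 ^ 2)
    × 4 ^ 2 + 2 ^ 2 + 2 ^ 2 ≡ 24))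
mainTheorem5 = √2 , √2-positive , √2²≈2 , λ Γ Γ-dr array →
  HeawoodModules.spectrum Γ-dr array ,
  λ x u y u-orders y-orders common₀ common₁ common₂ →
    let F = HeawoodFrame.frame Γ-dr array x u y u-orders y-orders common₀ common₁ common₂
        open HeawoodModules Γ-dr array
        open FrameTheory F using (W)
        open Modules F
    in
    ( W 0F , W 1F , W 2F , W 3F , W 4F , W 5F
    , summands-orthogonal F
    , summands-irreducible F
    , summands-isomorphic F
    , summands-multiplicity F (multiplicity 0F) , hasData 0F
    , Spectra.block-I-spectrum
    , summands-multiplicity F (multiplicity 1F) , hasData 1F
    , record { spans = level-isBasis 1F 0F ; A-seed = λ w → K.sym (E*-fixes 1F 1F refl w) }
    , summands-multiplicity F (multiplicity 2F) , hasData 2F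
    , record { spans = level-isBasis 2F 0F ; A-seed = λ w → K.sym (E*-fixes 2F 1F refl w) }
    , Spectra.block-II-spectrum
    , summands-multiplicity F (multiplicity 3F) , hasData 3F
    , record { spans = level-isBasis 3F 0F ; A-seed = λ w → K.sym (E*-fixes 3F 1F refl w) }
    , summands-multiplicity F (multiplicity 4F) , hasData 4F
    , record { spans = level-isBasis 4F 0F ; A-seed = λ w → K.sym (E*-fixes 4F 1F refl w) }
    , summands-multiplicity F (multiplicity 5F) , hasData 5F
    , record { spans = level-isBasis 5F 0F ; A-seed = λ w → K.sym (E*-fixes 5F 1F refl w) } )
    , T-hasDimension
    , refl
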